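{- Let $p>2$ be a prime and let $\Psi$ be a $2\times k$ system over $\mathbb{F}_p$ such that $s(\Psi)=k-1$ and which does not contain an additive $k$-tuple. Then there exists $f:\mathbb{F}_p^2 \to [-1,1]$ with $\mathbb{E}_{x\in\mathbb{F}_p^2} f(x) = 0$ and such that $T_\Psi(f) < 0$.
   Context: A $2\times k$ system $\Psi$ is a system of $2$ homogeneous linear equations in $k$ variables, given by a $2\times k$ matrix $M_\Psi$ over $\mathbb{F}_p$ of full rank $2$, with $k>2$. For $n\ge1$, $\mathrm{sol}(\Psi;\mathbb{F}_p^n)$ is the set of $x=(x_1,\dots,x_k)\in(\mathbb{F}_p^n)^k$ with $M_\Psi x=0$. For $f:\mathbb{F}_p^n\to\mathbb{C}$, $T_\Psi(f)=\mathbb{E}_{x\in \mathrm{sol}(\Psi;\mathbb{F}_p^n)} f(x_1)\cdots f(x_k)$ (normalised average). The length of an equation is its number of nonzero coefficients; $s(\Psi)$ is the minimum length of a nonzero equation in the row space of $M_\Psi$. An additive $k$-tuple is (for $k$ even) the equation $x_1+\dots+x_{k/2}=x_{k/2+1}+\dots+x_k$; $\Psi$ contains an additive $k$-tuple if some nonzero vector in the row space of $M_\Psi$ is a nonzero scalar multiple of a vector having $k/2$ entries equal to $1$ and $k/2$ entries equal to $-1$ (for $k$ odd this never happens). -}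

module Defs where

open import Data.Nat using (ℕ; zero; suc; _+_; _*_; _∸_; _≤_; _<_; NonZero)
open import Data.Nat.DivMod using (_mod_)
open import Data.Bool using (Bool; true; false; if_then_else_)
open import Data.Fin using (Fin; toℕ)
open import Data.List using (List; []; _∷_; map; foldr; allFin; concatMap; filterᵇ; length)
open import Data.Bool.ListAction using (and)
open import Data.Vec.Functional using (Vector) renaming (_∷_ to _∷ᵛ_)
open import Data.Integer using (ℤ; +_)
open import Data.Rational using (ℚ; _/_; 0ℚ; 1ℚ) renaming (_+_ to _+ℚ_; _*_ to _*ℚ_)
open import Data.Product using (Σ; _×_; ∃; ∃-syntax; _,_)
open import Relation.Binary.PropositionalEquality using (_≡_; _≢_)
open import Relation.Nullary using (¬_)
import Data.Nat as ℕ

module _ (p : ℕ) .{{_ : NonZero p}} where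

  Fp : Set
  Fp = Fin p

  addF : Fp → Fp → Fp
  addF a b = (toℕ a + toℕ b) mod p

  mulF : Fp → Fp → Fp
  mulF a b = (toℕ a * toℕ b) mod p

  oneF : Fp
  oneF = 1 mod p

  minusOneF : Fp
  minusOneF = (p ∸ 1) mod p

  Matrix2 : ℕ → Set
  Matrix2 k = Fin 2 → Fin k → Fp

  rowComb : {k : ℕ} → Matrix2 k → Fp → Fp → Fin k → Fp
  rowComb M a b l = addF (mulF a (M Fin.zero l)) (mulF b (M (Fin.suc Fin.zero) l))
    where import Data.Fin as Fin

  IsZeroVec : {k : ℕ} → (Fin k → Fp) → Set
  IsZeroVec v = ∀ l → toℕ (v l) ≡ 0

  eqLength : {k : ℕ} → (Fin k → Fp) → ℕ
  eqLength {k} v = foldr (λ l n → (if toℕ (v l) ℕ.≡ᵇ 0 then 0 else 1) + n) 0 (allFin k)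

  FullRank : {k : ℕ} → Matrix2 k → Set
  FullRank M = ∀ a b → IsZeroVec (rowComb M a b) → (toℕ a ≡ 0) × (toℕ b ≡ 0)

  sIs : {k : ℕ} → Matrix2 k → ℕ → Set
  sIs M m =
    (∀ a b → ¬ IsZeroVec (rowComb M a b) → m ≤ eqLength (rowComb M a b))
    × (∃[ a ] ∃[ b ] (¬ IsZeroVec (rowComb M a b) × eqLength (rowComb M a b) ≡ m))

  countTrue : {k : ℕ} → (Fin k → Bool) → ℕ
  countTrue {k} w = foldr (λ l n → (if w l then 1 else 0) + n) 0 (allFin k)

  -- Ψ contains an additive k-tuple: some nonzero vector of the row space is
  -- c · w with c ≠ 0 and w having k/2 entries 1 and k/2 entries -1
  -- (w encoded by a Bool vector: true ↦ 1, false ↦ -1; "k/2 ones and k/2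
  -- minus ones" is encoded as 2 · #ones ≡ k).
  ContainsAdditiveTuple : {k : ℕ} → Matrix2 k → Set
  ContainsAdditiveTuple {k} M =
    ∃[ a ] ∃[ b ] (¬ IsZeroVec (rowComb M a b)
      × ∃[ c ] (toℕ c ≢ 0
        × ∃[ w ] ((2 * countTrue {k} w ≡ k)
          × (∀ l → rowComb M a b l ≡ mulF c (if w l then oneF else minusOneF)))))

allFuns : {A : Set} → (n : ℕ) → List A → List (Fin n → A)
allFuns zero    xs = (λ ()) ∷ []
allFuns (suc n) xs = concatMap (λ a → map (λ g → a ∷ᵛ g) (allFuns n xs)) xs

sumℚ : List ℚ → ℚ
sumℚ = foldr _+ℚ_ 0ℚ

-- mean of a list of rationals (the empty mean is set to 0; never used on
-- an empty list below)
mean : List ℚ → ℚ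
mean []       = 0ℚ
mean (x ∷ xs) = sumℚ (x ∷ xs) *ℚ ((+ 1) / suc (length xs))

module _ (p : ℕ) .{{_ : NonZero p}} where

  Points : ℕ → Set
  Points n = Fin n → Fp p

  allPoints : (n : ℕ) → List (Points n)
  allPoints n = allFuns n (allFin p)

  E : {n : ℕ} → (Points n → ℚ) → ℚ
  E {n} f = mean (map f (allPoints n))

  isSol : {k n : ℕ} → Matrix2 p k → (Fin k → Points n) → Bool
  isSol {k} {n} M x =
    and (concatMap (λ i → map (λ j →
      (foldr (λ l s → toℕ (M i l) * toℕ (x l j) + s) 0 (allFin k) ℕ.% p) ℕ.≡ᵇ 0)
      (allFin n)) (allFin 2))

  sol : {k : ℕ} → (n : ℕ) → Matrix2 p k → List (Fin k → Points n)
  sol {k} n M = filterᵇ (isSol M) (allFuns k (allPoints n))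

  T : {k n : ℕ} → Matrix2 p k → (Points n → ℚ) → ℚ
  T {k} {n} M f = mean (map (λ x → foldr (λ l r → f (x l) *ℚ r) 1ℚ (allFin k)) (sol n M))

{-# OPTIONS --safe #-}
module Submission where

-- Write m_1, …, m_k for the columns of M. Since s(Ψ) = k-1, any two columns are independent. Put
--   f_r(x) = Σ_j 2cos(2π(m_j·x + r_j)/p),   r ∈ F_p^k.
-- Expanding T(f_r) into characters gives one term for each choice of a sign s_l and an index j_l per
-- variable; after summation over the solutions the term survives only if (s_l m_{j_l})_l is orthogonal to
-- all of them, and then it equals cos(2π Σ_l s_l r_{j_l} / p). Testing against solutions supported on three
-- variables shows that l ↦ j_l must be injective or constant, and in the constant case (s_l)_l lies in the
-- row space. So T(f_0) > 0, which settles odd k through -f_0. For even k the average of T(f_r) over r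
-- vanishes: the only terms that could contribute have constant j_l and Σ_l s_l ≡ 0 mod p, and as k < p this
-- makes (s_l)_l an additive k-tuple. Hence T(f_r) < 0 for some r.
--
-- The values have to be rational, so the cosine is replaced by a rational function on F_p that satisfies
-- 2cos a · 2cos b = 2cos(a+b) + 2cos(a-b) up to an error ε. It is built from Chebyshev polynomials at a
-- rational point close to a root of sin pθ / sin θ, found by bisection.

open import Level using (0ℓ)
open import Data.Nat as ℕ using (ℕ; zero; suc; s≤s; z≤n)
import Data.Nat.Properties as ℕₚ
import Data.Nat.Divisibility as ℕ∣
import Data.Nat.DivMod as ℕD
open import Data.Nat.Primality using (Prime; euclidsLemma; prime⇒irreducible; ¬prime[1])
open import Data.Nat.Coprimality using (prime⇒coprime; coprime-Bézout)
open import Data.Nat.GCD using (module Bézout)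
open import Data.Integer as ℤ using (ℤ; -[1+_]; 0ℤ; 1ℤ; -1ℤ)
import Data.Integer.Properties as ℤₚ
open import Data.Integer.DivMod using (n%ℕd<d; a≡a%ℕn+[a/ℕn]*n)
open import Data.Integer.Divisibility.Signed
  using (_∣_; divides; ∣⇒∣ᵤ; ∣ᵤ⇒∣; _∣?_; ∣m∣n⇒∣m+n; ∣m⇒∣-m; ∣m∣n⇒∣m-n; ∣n⇒∣m*n; ∣m⇒∣m*n)
import Data.Rational.Unnormalised as ℚᵘ
import Data.Rational.Unnormalised.Properties as ℚᵘₚ
open import Data.Fin as Fin using (Fin; toℕ; fromℕ<)
open import Data.Fin.Patterns using (0F; 1F)
open import Data.Fin.Permutation using (Permutation; permutation; _⟨$⟩ʳ_)
import Data.Fin.Properties as Finₚ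
open import Data.Bool using (Bool; true; false; if_then_else_; _∧_; T?)
open import Data.Bool.Properties using (T-≡)
open import Data.List using (List; []; _∷_; map; foldr; allFin; concatMap; tabulate; length; _++_; filterᵇ)
open import Data.List.Properties using (map-tabulate; length-tabulate)
open import Data.List.Membership.Propositional using (_∈_)
open import Data.List.Membership.Propositional.Properties
  using (∈-filter⁻; ∈-filter⁺; ∈-allFin; ∈-concatMap⁺; ∈-map⁺; ∈-++⁺ˡ)
open import Data.List.Relation.Unary.Any as Any using (here; there)
open import Data.Vec.Functional using () renaming (_∷_ to _∷ᵛ_)
open import Data.Maybe using (Maybe; just; nothing)
open import Data.Product using (_×_; ∃-syntax; _,_; proj₁; proj₂)
open import Data.Sum using (_⊎_; inj₁; inj₂)
open import Function.Bundles using (Equivalence)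
open import Relation.Nullary using (yes; no; ¬_; contradiction; does; Dec)
open import Relation.Nullary.Decidable using (¬?; decidable-stable; toWitnessFalse; _×-dec_)
open import Relation.Binary.PropositionalEquality
open import Tactic.RingSolver using (solve-∀)
open import Tactic.RingSolver.Core.AlmostCommutativeRing using (AlmostCommutativeRing; fromCommutativeRing)
open import Data.Integer.Tactic.RingSolver using () renaming (solve-∀ to solveℤ)
open import Data.Nat.Tactic.RingSolver using () renaming (solve-∀ to solveℕ)

-- The mean of f must vanish exactly, whereas T(f) < 0 is an open condition. This dictates what the
-- rational cosine has to satisfy: periodicity mod p and zero mean are exact, so every orthogonality
-- argument is exact, and only the product formula carries an error. The accumulated error is ε
-- times a constant depending on k alone; dominating it against all p^k shifts at once is what fixes
-- ε. Why k < p: a vector w of signs in the row space can be completed by a row t to a basis of that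
-- space. Independence of the columns makes the quotients t_l / w_l pairwise distinct in F_p, so k
-- is at most p, and equality is excluded because k is even and p is odd. The integer Σ s_l has
-- absolute value at most k, so divisibility by p makes it zero. Why doubled angles: if sin pθ = 0
-- while sin θ is nonzero, then cos pθ may be 1 or -1, but n ↦ cos 2nθ has period p in either case.
-- Any such θ serves, so no particular root has to be isolated. Bisection still needs a point where
-- sin pθ / sin θ is not positive; it is obtained by following multiples of a tiny angle until the
-- sine first fails to be positive.

-- Inequalities, the Archimedean property and small powers of one half in the rationals.

module RationalBounds where
  open import Data.Rational
  open import Data.Rational.Properties

  ℚ-ring : AlmostCommutativeRing 0ℓ 0ℓ
  ℚ-ring = fromCommutativeRing +-*-commutativeRing isz
    where
    isz : ∀ x → Maybe (0ℚ ≡ x)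
    isz x with 0ℚ ≟ x
    ... | yes e = just e
    ... | no _  = nothing

  2ℚ 3ℚ : ℚ
  2ℚ = 1ℚ + 1ℚ
  3ℚ = 1ℚ + 2ℚ

  0≤1 : 0ℚ ≤ 1ℚ
  0≤1 = nonNegative⁻¹ 1ℚ

  0≤+ : ∀ {a b} → 0ℚ ≤ a → 0ℚ ≤ b → 0ℚ ≤ a + b
  0≤+ p q = +-mono-≤ p q

  0≤* : ∀ {a b} → 0ℚ ≤ a → 0ℚ ≤ b → 0ℚ ≤ a * b
  0≤* {a} {b} p q = nonNegative⁻¹ (a * b) {{nonNeg*nonNeg⇒nonNeg a {{nonNegative p}} b {{nonNegative q}}}}

  0<* : ∀ {a b} → 0ℚ < a → 0ℚ < b → 0ℚ < a * b
  0<* {a} {b} p q = positive⁻¹ (a * b) {{pos*pos⇒pos a {{positive p}} b {{positive q}}}}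

  *-mono-≤ˡ : ∀ {a b} c → 0ℚ ≤ c → a ≤ b → c * a ≤ c * b
  *-mono-≤ˡ c h = *-monoˡ-≤-nonNeg c {{nonNegative h}}

  *-mono-≤ʳ : ∀ {a b} c → 0ℚ ≤ c → a ≤ b → a * c ≤ b * c
  *-mono-≤ʳ c h = *-monoʳ-≤-nonNeg c {{nonNegative h}}

  *-mono-≤ : ∀ {a b c d} → 0ℚ ≤ c → 0ℚ ≤ b → a ≤ b → c ≤ d → a * c ≤ b * d
  *-mono-≤ {b = b} {c} hc hb p q = ≤-trans (*-mono-≤ʳ c hc p) (*-mono-≤ˡ b hb q)

  0≤-‿ : ∀ {a b} → a ≤ b → 0ℚ ≤ b - a
  0≤-‿ {a} {b} p = subst (_≤ b - a) (+-inverseʳ a) (+-monoˡ-≤ (- a) p)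

  ≤-by : ∀ {a b} d → 0ℚ ≤ d → b ≡ a + d → a ≤ b
  ≤-by {a} d p refl = subst (_≤ a + d) (+-identityʳ a) (+-monoʳ-≤ a p)

  <-by : ∀ {a b} d → 0ℚ < d → b ≡ a + d → a < b
  <-by {a} d p refl = subst (_< a + d) (+-identityʳ a) (+-monoʳ-< a p)

  neg≤0 : ∀ {a} → 0ℚ ≤ a → - a ≤ 0ℚ
  neg≤0 = neg-antimono-≤

  0≤neg : ∀ {a} → a ≤ 0ℚ → 0ℚ ≤ - a
  0≤neg = neg-antimono-≤

  0≤sq : ∀ a → 0ℚ ≤ a * a
  0≤sq a with ≤-total 0ℚ a
  ... | inj₁ p = 0≤* p p
  ... | inj₂ p = subst (0ℚ ≤_) (lem a) (0≤* (0≤neg p) (0≤neg p))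
    where lem : ∀ a → - a * - a ≡ a * a
          lem = solve-∀ ℚ-ring

  a≤∣a∣ : ∀ a → a ≤ ∣ a ∣
  a≤∣a∣ a with ≤-total 0ℚ a
  ... | inj₁ p = ≤-reflexive (sym (0≤p⇒∣p∣≡p p))
  ... | inj₂ p = ≤-trans p (0≤∣p∣ a)

  -a≤∣a∣ : ∀ a → - a ≤ ∣ a ∣
  -a≤∣a∣ a = subst (- a ≤_) (∣-p∣≡∣p∣ a) (a≤∣a∣ (- a))

  ∣+∣≤ : ∀ {a b c d} → ∣ a ∣ ≤ c → ∣ b ∣ ≤ d → ∣ a + b ∣ ≤ c + d
  ∣+∣≤ {a} {b} p q = ≤-trans (∣p+q∣≤∣p∣+∣q∣ a b) (+-mono-≤ p q)

  ∣-∣≤ : ∀ {a b c d} → ∣ a ∣ ≤ c → ∣ b ∣ ≤ d → ∣ a - b ∣ ≤ c + d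
  ∣-∣≤ {a} {b} p q = ≤-trans (∣p-q∣≤∣p∣+∣q∣ a b) (+-mono-≤ p q)

  ∣*∣≤ : ∀ {a b c d} → ∣ a ∣ ≤ c → ∣ b ∣ ≤ d → ∣ a * b ∣ ≤ c * d
  ∣*∣≤ {a} {b} {c} p q = subst (_≤ _) (sym (∣p*q∣≡∣p∣*∣q∣ a b))
    (*-mono-≤ (0≤∣p∣ b) (≤-trans (0≤∣p∣ a) p) p q)

  ∣sub-sym∣ : ∀ a b → ∣ a - b ∣ ≡ ∣ b - a ∣
  ∣sub-sym∣ a b = trans (cong ∣_∣ (lem a b)) (∣-p∣≡∣p∣ (b - a))
    where lem : ∀ a b → a - b ≡ - (b - a)
          lem = solve-∀ ℚ-ring

  sq≤1⇒∣∣≤1 : ∀ a → a * a ≤ 1ℚ → ∣ a ∣ ≤ 1ℚ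
  sq≤1⇒∣∣≤1 a a²≤1 with ∣ a ∣ ≤? 1ℚ
  ... | yes ∣a∣≤1 = ∣a∣≤1
  ... | no ∣a∣≰1  = contradiction (<-≤-trans 1<∣a∣² ∣a∣²≤1) (<-irrefl refl)
    where
    ∣a∣²≤1 : ∣ a ∣ * ∣ a ∣ ≤ 1ℚ
    ∣a∣²≤1 = subst (_≤ 1ℚ) (trans (sym (0≤p⇒∣p∣≡p (0≤sq a))) (∣p*q∣≡∣p∣*∣q∣ a a)) a²≤1
    0<∣a∣-1 : 0ℚ < ∣ a ∣ - 1ℚ
    0<∣a∣-1 = subst (_< ∣ a ∣ - 1ℚ) (+-inverseʳ 1ℚ) (+-monoˡ-< (- 1ℚ) (≰⇒> ∣a∣≰1))
    lem : ∀ x → x * x ≡ 1ℚ + (x - 1ℚ) * (x + 1ℚ)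
    lem = solve-∀ ℚ-ring
    1<∣a∣² : 1ℚ < ∣ a ∣ * ∣ a ∣
    1<∣a∣² = <-by ((∣ a ∣ - 1ℚ) * (∣ a ∣ + 1ℚ)) (0<* 0<∣a∣-1 (+-mono-≤-< (0≤∣p∣ a) (positive⁻¹ 1ℚ))) (lem ∣ a ∣)

  -- Defined by recursion so that `ι (suc n)` unfolds to `1ℚ + ι n`, the form in which inductions
  -- and ring identities use it.
  ι : ℕ → ℚ
  ι zero    = 0ℚ
  ι (suc n) = 1ℚ + ι n

  0≤ι : ∀ n → 0ℚ ≤ ι n
  0≤ι zero    = ≤-refl
  0≤ι (suc n) = 0≤+ 0≤1 (0≤ι n)

  1≤ι : ∀ n → 1ℚ ≤ ι (suc n)
  1≤ι n = ≤-by (ι n) (0≤ι n) refl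

  0<ι : ∀ n → 0ℚ < ι (suc n)
  0<ι n = <-≤-trans (positive⁻¹ 1ℚ) (1≤ι n)

  ι-mono : ∀ {m n} → m ℕ.≤ n → ι m ≤ ι n
  ι-mono {n = n} z≤n = 0≤ι n
  ι-mono (s≤s p) = +-monoʳ-≤ 1ℚ (ι-mono p)

  toℚᵘ-ι : ∀ n → toℚᵘ (ι n) ℚᵘ.≃ ℚᵘ.mkℚᵘ (ℤ.+ n) 0
  toℚᵘ-ι zero    = ℚᵘₚ.≃-refl
  toℚᵘ-ι (suc n) = ℚᵘₚ.≃-trans (toℚᵘ-homo-+ 1ℚ (ι n))
    (ℚᵘₚ.≃-trans (ℚᵘₚ.+-congʳ (toℚᵘ 1ℚ) (toℚᵘ-ι n)) (ℚᵘ.*≡* (lem (ℤ.+ n))))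
    where
    lem : ∀ m → (ℤ.1ℤ ℤ.* ℤ.1ℤ ℤ.+ m ℤ.* ℤ.1ℤ) ℤ.* ℤ.1ℤ ≡ (ℤ.1ℤ ℤ.+ m) ℤ.* ℤ.1ℤ
    lem = solveℤ

  -- The denominator is at least 1, so the absolute value of the numerator is a bound.
  archimedean : ∀ q → ∃[ n ] q ≤ ι n
  archimedean q@(mkℚ z d-1 _) = ℤ.∣ z ∣ , toℚᵘ-cancel-≤
      (ℚᵘₚ.≤-trans (ℚᵘ.*≤* step) (ℚᵘₚ.≤-reflexive (ℚᵘₚ.≃-sym (toℚᵘ-ι ℤ.∣ z ∣))))
    where
    i≤∣i∣ : ∀ i → i ℤ.≤ ℤ.+ ℤ.∣ i ∣
    i≤∣i∣ (ℤ.+ n) = ℤₚ.≤-refl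
    i≤∣i∣ -[1+ n ] = ℤ.-≤+
    step : z ℤ.* ℤ.1ℤ ℤ.≤ ℤ.+ ℤ.∣ z ∣ ℤ.* ℤ.+ suc d-1
    step = ℤₚ.≤-trans (subst (ℤ._≤ ℤ.+ ℤ.∣ z ∣) (sym (ℤₚ.*-identityʳ z)) (i≤∣i∣ z))
      (subst (ℤ.+ ℤ.∣ z ∣ ℤ.≤_) (ℤₚ.pos-* ℤ.∣ z ∣ (suc d-1)) (ℤ.+≤+ (ℕₚ.m≤m*n ℤ.∣ z ∣ (suc d-1))))

  halfPow : ℕ → ℚ
  halfPow zero    = 1ℚ
  halfPow (suc n) = ½ * halfPow n

  0<halfPow : ∀ n → 0ℚ < halfPow n
  0<halfPow zero    = positive⁻¹ 1ℚ
  0<halfPow (suc n) = 0<* (positive⁻¹ ½) (0<halfPow n)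

  halfPow≤1 : ∀ n → halfPow n ≤ 1ℚ
  halfPow≤1 zero    = ≤-refl
  halfPow≤1 (suc n) = ≤-trans (*-mono-≤ˡ ½ (nonNegative⁻¹ ½) (halfPow≤1 n)) (*≤* (ℤ.+≤+ (s≤s z≤n)))

  halfPow-anti : ∀ m n → halfPow (m ℕ.+ n) ≤ halfPow m
  halfPow-anti zero    n = halfPow≤1 n
  halfPow-anti (suc m) n = *-mono-≤ˡ ½ (nonNegative⁻¹ ½) (halfPow-anti m n)

  ι*halfPow≤1 : ∀ n → ι n * halfPow n ≤ 1ℚ
  ι*halfPow≤1 zero    = ≤-trans (≤-reflexive (*-zeroˡ 1ℚ)) 0≤1
  ι*halfPow≤1 (suc n) = subst (_≤ 1ℚ) (lem (ι n) (halfPow n))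
    (*-mono-≤ˡ ½ (nonNegative⁻¹ ½) (+-mono-≤ (halfPow≤1 n) (ι*halfPow≤1 n)))
    where
    lem : ∀ a b → ½ * (b + a * b) ≡ (1ℚ + a) * (½ * b)
    lem = solve-∀ ℚ-ring

  -- Since n / 2^n ≤ 1, any n above B / ε works.
  halfPow-small : ∀ B {ε} → 0ℚ < ε → ∃[ n ] B * halfPow n ≤ ε
  halfPow-small B {ε} 0<ε = n , *-cancelˡ-≤-pos (1/ ε) (≤-trans step (≤-reflexive (sym (*-inverseˡ ε))))
    where
    instance
      posε : Positive ε
      posε = positive 0<ε
      nzε : NonZero ε
      nzε = pos⇒nonZero ε
      posε⁻¹ : Positive (1/ ε)
      posε⁻¹ = 1/pos⇒pos ε
    n = proj₁ (archimedean (1/ ε * B))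
    step : 1/ ε * (B * halfPow n) ≤ 1ℚ
    step = ≤-trans (≤-reflexive (sym (*-assoc (1/ ε) B (halfPow n))))
      (≤-trans (*-mono-≤ʳ (halfPow n) (<⇒≤ (0<halfPow n)) (proj₂ (archimedean (1/ ε * B)))) (ι*halfPow≤1 n))

-- Trigonometric identities for Chebyshev polynomials at a rational point.

module Chebyshev where
  open RationalBounds
  open import Data.Rational
  open import Data.Rational.Properties

  -- Chebyshev polynomials: chebT h n = cos nθ and chebU h n = sin nθ / sin θ for h = cos θ.
  chebT chebU : ℚ → ℕ → ℚ
  chebT h zero    = 1ℚ
  chebT h (suc n) = h * chebT h n - (1ℚ - h * h) * chebU h n
  chebU h zero    = 0ℚ
  chebU h (suc n) = h * chebU h n + chebT h n

  module _ (h : ℚ) where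
    private
      T U : ℕ → ℚ
      T = chebT h
      U = chebU h
      d : ℚ
      d = 1ℚ - h * h

    -- The addition theorems for cosine and sine. The factor `d` is sin²θ: each `U` has been divided
    -- by sin θ, so only its square appears and everything stays polynomial in h.
    chebT-+ : ∀ m n → T (m ℕ.+ n) ≡ T m * T n - d * (U m * U n)
    chebU-+ : ∀ m n → U (m ℕ.+ n) ≡ U m * T n + T m * U n
    chebT-+ zero    n = lem d (T n) (U n)
      where lem : ∀ d t u → t ≡ 1ℚ * t - d * (0ℚ * u)
            lem = solve-∀ ℚ-ring
    chebT-+ (suc m) n = trans (cong₂ (λ x y → h * x - d * y) (chebT-+ m n) (chebU-+ m n))
      (lem h d (T m) (U m) (T n) (U n))
      where lem : ∀ h d a u b v → h * (a * b - d * (u * v)) - d * (u * b + a * v)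
                                 ≡ (h * a - d * u) * b - d * ((h * u + a) * v)
            lem = solve-∀ ℚ-ring
    chebU-+ zero    n = lem (T n) (U n)
      where lem : ∀ t u → u ≡ 0ℚ * t + 1ℚ * u
            lem = solve-∀ ℚ-ring
    chebU-+ (suc m) n = trans (cong₂ (λ x y → h * y + x) (chebT-+ m n) (chebU-+ m n))
      (lem h (T m) (U m) (T n) (U n))
      where lem : ∀ h a u b v → h * (u * b + a * v) + (a * b - (1ℚ - h * h) * (u * v))
                                 ≡ (h * u + a) * b + (h * a - (1ℚ - h * h) * u) * v
            lem = solve-∀ ℚ-ring

    pythagoras : ∀ n → T n * T n + d * (U n * U n) ≡ 1ℚ
    pythagoras zero    = lem d
      where lem : ∀ d → 1ℚ * 1ℚ + d * (0ℚ * 0ℚ) ≡ 1ℚ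
            lem = solve-∀ ℚ-ring
    pythagoras (suc n) = trans (lem h (T n) (U n)) (pythagoras n)
      where lem : ∀ h a u → (h * a - (1ℚ - h * h) * u) * (h * a - (1ℚ - h * h) * u)
                             + (1ℚ - h * h) * ((h * u + a) * (h * u + a))
                             ≡ a * a + (1ℚ - h * h) * (u * u)
            lem = solve-∀ ℚ-ring

    -- Sum-to-product with midpoint i + m and half-difference i; this parametrisation avoids
    -- subtraction of naturals.
    chebT-sum : ∀ i m → T (i ℕ.+ (i ℕ.+ m)) + T m ≡ 2ℚ * (T i * T (i ℕ.+ m))
    chebT-sum i m = begin
      T (i ℕ.+ (i ℕ.+ m)) + T m
        ≡⟨ cong (_+ T m) (chebT-+ i (i ℕ.+ m)) ⟩
      T i * T (i ℕ.+ m) - d * (U i * U (i ℕ.+ m)) + T m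
        ≡⟨ cong₂ (λ x y → T i * x - d * (U i * y) + T m) (chebT-+ i m) (chebU-+ i m) ⟩
      T i * (T i * T m - d * (U i * U m)) - d * (U i * (U i * T m + T i * U m)) + T m
        ≡⟨ lem₁ d (T i) (U i) (T m) (U m) ⟩
      2ℚ * (T i * (T i * T m - d * (U i * U m))) + T m * (1ℚ - (T i * T i + d * (U i * U i)))
        ≡⟨ cong₂ (λ x y → 2ℚ * (T i * x) + T m * (1ℚ - y)) (sym (chebT-+ i m)) (pythagoras i) ⟩
      2ℚ * (T i * T (i ℕ.+ m)) + T m * (1ℚ - 1ℚ)
        ≡⟨ lem₂ (2ℚ * (T i * T (i ℕ.+ m))) (T m) ⟩
      2ℚ * (T i * T (i ℕ.+ m)) ∎
      where
      open ≡-Reasoning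
      lem₁ : ∀ d a u b v → a * (a * b - d * (u * v)) - d * (u * (u * b + a * v)) + b
           ≡ (1ℚ + 1ℚ) * (a * (a * b - d * (u * v))) + b * (1ℚ - (a * a + d * (u * u)))
      lem₁ = solve-∀ ℚ-ring
      lem₂ : ∀ x y → x + y * (1ℚ - 1ℚ) ≡ x
      lem₂ = solve-∀ ℚ-ring

    -- Both the half-difference i and the midpoint i + m occur as an index of `U`, so a near-zero of
    -- `U` at either one makes the two cosines nearly equal. The first gives periodicity, the second
    -- reflection.
    chebT-difference : ∀ i m → T (i ℕ.+ (i ℕ.+ m)) - T m ≡ - (2ℚ * (d * (U i * U (i ℕ.+ m))))
    chebT-difference i m = begin
      T (i ℕ.+ (i ℕ.+ m)) - T m
        ≡⟨ cong (_- T m) (chebT-+ i (i ℕ.+ m)) ⟩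
      T i * T (i ℕ.+ m) - d * (U i * U (i ℕ.+ m)) - T m
        ≡⟨ cong₂ (λ x y → T i * x - d * (U i * y) - T m) (chebT-+ i m) (chebU-+ i m) ⟩
      T i * (T i * T m - d * (U i * U m)) - d * (U i * (U i * T m + T i * U m)) - T m
        ≡⟨ lem₁ d (T i) (U i) (T m) (U m) ⟩
      - (2ℚ * (d * (U i * (U i * T m + T i * U m)))) + T m * (T i * T i + d * (U i * U i) - 1ℚ)
        ≡⟨ cong₂ (λ x y → - (2ℚ * (d * (U i * x))) + T m * (y - 1ℚ)) (sym (chebU-+ i m)) (pythagoras i) ⟩
      - (2ℚ * (d * (U i * U (i ℕ.+ m)))) + T m * (1ℚ - 1ℚ)
        ≡⟨ lem₂ (- (2ℚ * (d * (U i * U (i ℕ.+ m))))) (T m) ⟩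
      - (2ℚ * (d * (U i * U (i ℕ.+ m)))) ∎
      where
      open ≡-Reasoning
      lem₁ : ∀ d a u b v → a * (a * b - d * (u * v)) - d * (u * (u * b + a * v)) - b
           ≡ - ((1ℚ + 1ℚ) * (d * (u * (u * b + a * v)))) + b * (a * a + d * (u * u) - 1ℚ)
      lem₁ = solve-∀ ℚ-ring
      lem₂ : ∀ x y → x + y * (1ℚ - 1ℚ) ≡ x
      lem₂ = solve-∀ ℚ-ring

    -- Replacing θ by sθ. For `U` the quotient sin(nsθ) / sin(sθ) is cleared of its denominator,
    -- which might vanish.
    chebT-comp : ∀ s n → chebT (T s) n ≡ T (n ℕ.* s)
    chebU-comp : ∀ s n → chebU (T s) n * U s ≡ U (n ℕ.* s)
    chebT-comp s zero    = refl
    chebT-comp s (suc n) = begin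
      T s * chebT (T s) n - (1ℚ - T s * T s) * chebU (T s) n
        ≡⟨ cong (λ x → T s * chebT (T s) n - (x - T s * T s) * chebU (T s) n) (sym (pythagoras s)) ⟩
      T s * chebT (T s) n - (T s * T s + d * (U s * U s) - T s * T s) * chebU (T s) n
        ≡⟨ lem (T s) (U s) d (chebT (T s) n) (chebU (T s) n) ⟩
      T s * chebT (T s) n - d * (U s * (chebU (T s) n * U s))
        ≡⟨ cong₂ (λ x y → T s * x - d * (U s * y)) (chebT-comp s n) (chebU-comp s n) ⟩
      T s * T (n ℕ.* s) - d * (U s * U (n ℕ.* s))
        ≡⟨ sym (chebT-+ s (n ℕ.* s)) ⟩
      T (s ℕ.+ n ℕ.* s) ∎
      where
      open ≡-Reasoning
      lem : ∀ t u d a v → t * a - (t * t + d * (u * u) - t * t) * v ≡ t * a - d * (u * (v * u))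
      lem = solve-∀ ℚ-ring
    chebU-comp s zero    = *-zeroˡ (U s)
    chebU-comp s (suc n) = begin
      (T s * chebU (T s) n + chebT (T s) n) * U s
        ≡⟨ lem (T s) (U s) (chebT (T s) n) (chebU (T s) n) ⟩
      U s * chebT (T s) n + T s * (chebU (T s) n * U s)
        ≡⟨ cong₂ (λ x y → U s * x + T s * y) (chebT-comp s n) (chebU-comp s n) ⟩
      U s * T (n ℕ.* s) + T s * U (n ℕ.* s)
        ≡⟨ sym (chebU-+ s (n ℕ.* s)) ⟩
      U (s ℕ.+ n ℕ.* s) ∎
      where
      open ≡-Reasoning
      lem : ∀ t u a v → (t * v + a) * u ≡ u * a + t * (v * u)
      lem = solve-∀ ℚ-ring

    -- sin(N+r)θ sin θ = sin Nθ sin(r+1)θ - sin(N-1)θ sin rθ.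
    chebU-shift : ∀ n r → U (suc n ℕ.+ r) ≡ U (suc n) * U (suc r) - U n * U r
    chebU-shift n r = trans (chebU-+ (suc n) r) (lem h (T n) (U n) (T r) (U r))
      where lem : ∀ h a u b v → (h * u + a) * b + (h * a - (1ℚ - h * h) * u) * v
                               ≡ (h * u + a) * (h * v + b) - u * v
            lem = solve-∀ ℚ-ring

    -- Used to see that two consecutive nonnegative values cannot both be small: the square of their
    -- sum is at least 1.
    chebU-square : ∀ n → (U n + U (suc n)) * (U n + U (suc n)) ≡ 1ℚ + 2ℚ * ((1ℚ + h) * (U n * U (suc n)))
    chebU-square n = trans (lem h (T n) (U n)) (cong (_+ 2ℚ * ((1ℚ + h) * (U n * U (suc n)))) (pythagoras n))
      where lem : ∀ h a u → (u + (h * u + a)) * (u + (h * u + a))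
                         ≡ a * a + (1ℚ - h * h) * (u * u) + (1ℚ + 1ℚ) * ((1ℚ + h) * (u * (h * u + a)))
            lem = solve-∀ ℚ-ring

    -- The sum of 2cos(2iθ) over 0 ≤ i < n, a Dirichlet-type kernel.
    evenSum : ℕ → ℚ
    evenSum zero    = 0ℚ
    evenSum (suc n) = evenSum n + 2ℚ * T (n ℕ.+ n)

    -- The bracket is cos((n-1)θ) written without a predecessor. What matters is the factor `U n`:
    -- the cosines almost sum to zero near a root.
    evenSum-closed : ∀ n → evenSum n ≡ 2ℚ * ((h * T n + d * U n) * U n)
    evenSum-closed zero    = lem h d
      where lem : ∀ h d → 0ℚ ≡ (1ℚ + 1ℚ) * ((h * 1ℚ + d * 0ℚ) * 0ℚ)
            lem = solve-∀ ℚ-ring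
    evenSum-closed (suc n) = trans (cong₂ (λ x y → x + 2ℚ * y) (evenSum-closed n) (chebT-+ n n)) (lem h (T n) (U n))
      where lem : ∀ h a u → (1ℚ + 1ℚ) * ((h * a + (1ℚ - h * h) * u) * u) + (1ℚ + 1ℚ) * (a * a - (1ℚ - h * h) * (u * u))
               ≡ (1ℚ + 1ℚ) * ((h * (h * a - (1ℚ - h * h) * u) + (1ℚ - h * h) * (h * u + a)) * (h * u + a))
            lem = solve-∀ ℚ-ring

    module _ (∣h∣≤1 : ∣ h ∣ ≤ 1ℚ) where

      h²≤1 : h * h ≤ 1ℚ
      h²≤1 = ≤-trans (a≤∣a∣ (h * h)) (∣*∣≤ ∣h∣≤1 ∣h∣≤1)

      0≤d : 0ℚ ≤ d
      0≤d = 0≤-‿ h²≤1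

      ∣d∣≤1 : ∣ d ∣ ≤ 1ℚ
      ∣d∣≤1 = subst (_≤ 1ℚ) (sym (0≤p⇒∣p∣≡p 0≤d)) (≤-by (h * h) (0≤sq h) (lem (h * h)))
        where lem : ∀ x → 1ℚ ≡ 1ℚ - x + x
              lem = solve-∀ ℚ-ring

      chebT-bound : ∀ n → ∣ T n ∣ ≤ 1ℚ
      chebT-bound n = sq≤1⇒∣∣≤1 (T n) (≤-by (d * (U n * U n)) (0≤* 0≤d (0≤sq (U n))) (sym (pythagoras n)))

      chebU-bound : ∀ n → ∣ U n ∣ ≤ ι n
      chebU-bound zero    = ≤-refl
      chebU-bound (suc n) = subst (∣ U (suc n) ∣ ≤_) (lem (ι n))
        (∣+∣≤ (∣*∣≤ {h} {U n} ∣h∣≤1 (chebU-bound n)) (chebT-bound n))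
        where lem : ∀ x → 1ℚ * x + 1ℚ ≡ 1ℚ + x
              lem = solve-∀ ℚ-ring

      -- The factor `U i` of `chebT-difference` is small and `U (i + m)` is at most n; in the primed
      -- version the two roles are exchanged.
      chebT-mirror : ∀ i m n {η} → i ℕ.+ m ℕ.≤ n → ∣ U i ∣ ≤ η →
                     ∣ T (i ℕ.+ (i ℕ.+ m)) - T m ∣ ≤ 2ℚ * (ι n * η)
      chebT-mirror i m n {η} le ui = subst (_≤ _) (sym (trans (cong ∣_∣ (chebT-difference i m)) (∣-p∣≡∣p∣ _)))
        (subst (∣ 2ℚ * (d * (U i * U (i ℕ.+ m))) ∣ ≤_) (lem (ι n) η)
          (∣*∣≤ {2ℚ} {d * (U i * U (i ℕ.+ m))} ≤-refl
            (∣*∣≤ {d} {U i * U (i ℕ.+ m)} ∣d∣≤1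
              (∣*∣≤ {U i} ui (≤-trans (chebU-bound (i ℕ.+ m)) (ι-mono le))))))
        where lem : ∀ x y → (1ℚ + 1ℚ) * (1ℚ * (y * x)) ≡ (1ℚ + 1ℚ) * (x * y)
              lem = solve-∀ ℚ-ring

      chebT-mirror′ : ∀ i m n {η} → i ℕ.+ m ℕ.≤ n → i ℕ.≤ n → ∣ U (i ℕ.+ m) ∣ ≤ η →
                     ∣ T (i ℕ.+ (i ℕ.+ m)) - T m ∣ ≤ 2ℚ * (ι n * η)
      chebT-mirror′ i m n {η} le le′ ui = subst (_≤ _) (sym (trans (cong ∣_∣ (chebT-difference i m)) (∣-p∣≡∣p∣ _)))
        (subst (∣ 2ℚ * (d * (U i * U (i ℕ.+ m))) ∣ ≤_) (lem (ι n) η)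
          (∣*∣≤ {2ℚ} {d * (U i * U (i ℕ.+ m))} ≤-refl
            (∣*∣≤ {d} {U i * U (i ℕ.+ m)} ∣d∣≤1
              (∣*∣≤ {U i} (≤-trans (chebU-bound i) (ι-mono le′)) ui))))
        where lem : ∀ x y → (1ℚ + 1ℚ) * (1ℚ * (x * y)) ≡ (1ℚ + 1ℚ) * (x * y)
              lem = solve-∀ ℚ-ring

      evenSum-bound : ∀ n {η} → ∣ U n ∣ ≤ η → ∣ evenSum n ∣ ≤ 2ℚ * ((1ℚ + ι n) * η)
      evenSum-bound n {η} un = subst (λ x → ∣ x ∣ ≤ _) (sym (evenSum-closed n))
        (subst (∣ 2ℚ * ((h * T n + d * U n) * U n) ∣ ≤_) (lem (ι n) η)
          (∣*∣≤ {2ℚ} {(h * T n + d * U n) * U n} ≤-refl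
            (∣*∣≤ {h * T n + d * U n} (∣+∣≤ (∣*∣≤ {h} ∣h∣≤1 (chebT-bound n)) (∣*∣≤ {d} ∣d∣≤1 (chebU-bound n))) un)))
        where lem : ∀ x y → (1ℚ + 1ℚ) * ((1ℚ * 1ℚ + 1ℚ * x) * y) ≡ (1ℚ + 1ℚ) * ((1ℚ + x) * y)
              lem = solve-∀ ℚ-ring

  chebU-at-1 : ∀ n → chebU 1ℚ n ≡ ι n
  chebT-at-1 : ∀ n → chebT 1ℚ n ≡ 1ℚ
  chebU-at-1 zero    = refl
  chebU-at-1 (suc n) = trans (cong₂ (λ x y → 1ℚ * x + y) (chebU-at-1 n) (chebT-at-1 n)) (lem (ι n))
    where lem : ∀ x → 1ℚ * x + 1ℚ ≡ 1ℚ + x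
          lem = solve-∀ ℚ-ring
  chebT-at-1 zero    = refl
  chebT-at-1 (suc n) = trans (cong (λ y → 1ℚ * y - 0ℚ * chebU 1ℚ n) (chebT-at-1 n)) (lem (chebU 1ℚ n))
    where lem : ∀ x → 1ℚ * 1ℚ - 0ℚ * x ≡ 1ℚ
          lem = solve-∀ ℚ-ring

-- A rational point where sin pθ / sin θ is arbitrarily small.

module ApproximateRoot where
  open RationalBounds
  open Chebyshev
  open import Data.Rational
  open import Data.Rational.Properties

  -- Restricted to [-1,1]. The sup bound travels with the slope because the slope of a product needs
  -- both.
  record Lipschitz (f : ℚ → ℚ) : Set where
    field
      sup      : ℚ
      slope    : ℚ
      bounded  : ∀ x → ∣ x ∣ ≤ 1ℚ → ∣ f x ∣ ≤ sup
      lipschitz : ∀ x y → ∣ x ∣ ≤ 1ℚ → ∣ y ∣ ≤ 1ℚ → ∣ f x - f y ∣ ≤ slope * ∣ x - y ∣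
  open Lipschitz

  lip-const : ∀ c → Lipschitz (λ _ → c)
  lip-const c .sup = ∣ c ∣
  lip-const c .slope = 0ℚ
  lip-const c .bounded _ _ = ≤-refl
  lip-const c .lipschitz x y _ _ = ≤-reflexive (trans (cong ∣_∣ (+-inverseʳ c)) (sym (*-zeroˡ ∣ x - y ∣)))

  lip-id : Lipschitz (λ x → x)
  lip-id .sup = 1ℚ
  lip-id .slope = 1ℚ
  lip-id .bounded _ p = p
  lip-id .lipschitz x y _ _ = ≤-reflexive (sym (*-identityˡ ∣ x - y ∣))

  lip-+ : ∀ {f g} → Lipschitz f → Lipschitz g → Lipschitz (λ x → f x + g x)
  lip-+ F G .sup = sup F + sup G
  lip-+ F G .slope = slope F + slope G
  lip-+ F G .bounded x p = ∣+∣≤ (bounded F x p) (bounded G x p)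
  lip-+ {f} {g} F G .lipschitz x y p q =
    subst₂ _≤_ (cong ∣_∣ (sym (lem (f x) (f y) (g x) (g y)))) (sym (*-distribʳ-+ ∣ x - y ∣ (slope F) (slope G)))
      (∣+∣≤ (lipschitz F x y p q) (lipschitz G x y p q))
    where lem : ∀ a b c d → a + c - (b + d) ≡ (a - b) + (c - d)
          lem = solve-∀ ℚ-ring

  lip-* : ∀ {f g} → Lipschitz f → Lipschitz g → Lipschitz (λ x → f x * g x)
  lip-* F G .sup = sup F * sup G
  lip-* F G .slope = sup F * slope G + sup G * slope F
  lip-* {f} {g} F G .bounded x p = ∣*∣≤ {f x} {g x} (bounded F x p) (bounded G x p)
  lip-* {f} {g} F G .lipschitz x y p q =
    subst₂ _≤_ (cong ∣_∣ (sym (lem (f x) (f y) (g x) (g y)))) (lem₂ (sup F) (slope G) (sup G) (slope F) ∣ x - y ∣)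
      (∣+∣≤ (∣*∣≤ {f x} (bounded F x p) (lipschitz G x y p q)) (∣*∣≤ {g y} (bounded G y q) (lipschitz F x y p q)))
    where lem : ∀ a b c d → a * c - b * d ≡ a * (c - d) + d * (a - b)
          lem = solve-∀ ℚ-ring
          lem₂ : ∀ a b c d x → a * (b * x) + c * (d * x) ≡ (a * b + c * d) * x
          lem₂ = solve-∀ ℚ-ring

  lip-neg : ∀ {f} → Lipschitz f → Lipschitz (λ x → - f x)
  lip-neg F .sup = sup F
  lip-neg F .slope = slope F
  lip-neg {f} F .bounded x p = subst (_≤ sup F) (sym (∣-p∣≡∣p∣ (f x))) (bounded F x p)
  lip-neg {f} F .lipschitz x y p q = subst (_≤ _) (trans (∣sub-sym∣ (f x) (f y)) (cong ∣_∣ (lem (f x) (f y))))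
      (lipschitz F x y p q)
    where lem : ∀ a b → b - a ≡ - a - - b
          lem = solve-∀ ℚ-ring

  chebT-lip : ∀ n → Lipschitz (λ h → chebT h n)
  chebU-lip : ∀ n → Lipschitz (λ h → chebU h n)
  chebT-lip zero    = lip-const 1ℚ
  chebT-lip (suc n) = lip-+ (lip-* lip-id (chebT-lip n))
    (lip-neg (lip-* (lip-+ (lip-const 1ℚ) (lip-neg (lip-* lip-id lip-id))) (chebU-lip n)))
  chebU-lip zero    = lip-const 0ℚ
  chebU-lip (suc n) = lip-+ (lip-* lip-id (chebU-lip n)) (chebT-lip n)

  record SignChange (f : ℚ → ℚ) (δ : ℚ) : Set where
    constructor signChange
    field
      left right : ℚ
      ∣left∣≤1   : ∣ left ∣ ≤ 1ℚ
      ∣right∣≤1  : ∣ right ∣ ≤ 1ℚ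
      f-left≤0   : f left ≤ 0ℚ
      0≤f-right  : 0ℚ ≤ f right
      close      : ∣ right - left ∣ ≤ δ

  bisect-step : ∀ {f δ} → SignChange f δ → SignChange f (½ * δ)
  bisect-step {f} {δ} (signChange l r ∣l∣ ∣r∣ fl fr c) with ≤-total (f (½ * (l + r))) 0ℚ
  ... | inj₁ fm≤0 = signChange (½ * (l + r)) r mid ∣r∣ fm≤0 fr
          (subst (λ x → ∣ x ∣ ≤ ½ * δ) (lem l r) (∣*∣≤ {½} {r - l} ≤-refl c))
    where
    mid : ∣ ½ * (l + r) ∣ ≤ 1ℚ
    mid = ∣*∣≤ {½} {l + r} ≤-refl (∣+∣≤ ∣l∣ ∣r∣)
    lem : ∀ l r → ½ * (r - l) ≡ r - ½ * (l + r)
    lem l r = trans (lem₁ l r) (cong (_- ½ * (l + r)) (*-identityˡ r))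
      where
      lem₁ : ∀ l r → ½ * (r - l) ≡ (½ + ½) * r - ½ * (l + r)
      lem₁ = solve-∀ ℚ-ring
  ... | inj₂ 0≤fm = signChange l (½ * (l + r)) ∣l∣ mid fl 0≤fm
          (subst (λ x → ∣ x ∣ ≤ ½ * δ) (lem l r) (∣*∣≤ {½} {r - l} ≤-refl c))
    where
    mid : ∣ ½ * (l + r) ∣ ≤ 1ℚ
    mid = ∣*∣≤ {½} {l + r} ≤-refl (∣+∣≤ ∣l∣ ∣r∣)
    lem : ∀ l r → ½ * (r - l) ≡ ½ * (l + r) - l
    lem l r = trans (lem₁ l r) (cong (λ z → ½ * (l + r) - z) (*-identityˡ l))
      where
      lem₁ : ∀ l r → ½ * (r - l) ≡ ½ * (l + r) - (½ + ½) * l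
      lem₁ = solve-∀ ℚ-ring

  bisect : ∀ {f δ} n → SignChange f δ → SignChange f (halfPow n * δ)
  bisect {f} {δ} zero    s = subst (SignChange f) (sym (*-identityˡ δ)) s
  bisect {f} {δ} (suc n) s = subst (SignChange f) (sym (*-assoc ½ (halfPow n) δ)) (bisect-step (bisect n s))

  -- No limit is taken: the value at the right endpoint is nonnegative and at most f(right) -
  -- f(left), hence at most slope times width, and bisection shrinks the width.
  intermediateValue : ∀ {f δ η} → Lipschitz f → SignChange f δ → 0ℚ < η → ∃[ x ] ∣ x ∣ ≤ 1ℚ × ∣ f x ∣ ≤ η
  intermediateValue {f} {δ} {η} F s 0<η = right , ∣right∣≤1 , subst (_≤ η) (sym (0≤p⇒∣p∣≡p 0≤f-right)) small
    where
    ∃n = halfPow-small (∣ slope F ∣ * δ) 0<η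
    n = proj₁ ∃n
    open SignChange (bisect n s)
    lem₂ : ∀ a b c → a * (b * c) ≡ a * c * b
    lem₂ = solve-∀ ℚ-ring
    small : f right ≤ η
    small = begin
      f right                                ≤⟨ ≤-by (- f left) (0≤neg f-left≤0) refl ⟩
      f right - f left                       ≤⟨ a≤∣a∣ _ ⟩
      ∣ f right - f left ∣                   ≤⟨ lipschitz F right left ∣right∣≤1 ∣left∣≤1 ⟩
      slope F * ∣ right - left ∣             ≤⟨ *-mono-≤ʳ _ (0≤∣p∣ (right - left)) (a≤∣a∣ (slope F)) ⟩
      ∣ slope F ∣ * ∣ right - left ∣         ≤⟨ *-mono-≤ˡ _ (0≤∣p∣ (slope F)) close ⟩
      ∣ slope F ∣ * (halfPow n * δ)          ≡⟨ lem₂ ∣ slope F ∣ (halfPow n) δ ⟩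
      ∣ slope F ∣ * δ * halfPow n            ≤⟨ proj₂ ∃n ⟩
      η                                      ∎
      where open ≤-Reasoning

  module _ (h : ℚ) (0≤h : 0ℚ ≤ h) (∣h∣≤1 : ∣ h ∣ ≤ 1ℚ) where
    private
      T U : ℕ → ℚ
      T = chebT h
      U = chebU h
      d : ℚ
      d = 1ℚ - h * h

    Positive≤ : ℕ → Set
    Positive≤ n = ∀ i → suc i ℕ.≤ n → 0ℚ < U (suc i)

    0≤U : ∀ {n} → Positive≤ n → ∀ i → i ℕ.≤ n → 0ℚ ≤ U i
    0≤U P zero    _ = ≤-refl
    0≤U P (suc i) q = <⇒≤ (P i q)

    -- By `chebU-square` the sum s satisfies s² ≥ 1, while 0 ≤ s < 1 would give s² ≤ s < 1.
    1≤U+U : ∀ n → 0ℚ ≤ U n → 0ℚ ≤ U (suc n) → 1ℚ ≤ U n + U (suc n)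
    1≤U+U n p q with 1ℚ ≤? U n + U (suc n)
    ... | yes r = r
    ... | no r  = contradiction (<-≤-trans s<1 1≤s²) (λ s<s² → <-irrefl refl (<-≤-trans s<s² s²≤s))
      where
      s = U n + U (suc n)
      s<1 : s < 1ℚ
      s<1 = ≰⇒> r
      0≤s : 0ℚ ≤ s
      0≤s = 0≤+ p q
      1≤s² : 1ℚ ≤ s * s
      1≤s² = ≤-by _ (0≤* {2ℚ} (nonNegative⁻¹ 2ℚ) (0≤* (0≤+ 0≤1 0≤h) (0≤* p q))) (chebU-square h n)
      s²≤s : s * s ≤ s
      s²≤s = subst (s * s ≤_) (*-identityʳ s) (*-mono-≤ˡ s 0≤s (<⇒≤ s<1))

    -- Σ U telescopes to a bounded quantity, while consecutive positive terms have sum at least 1.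
    telescope : ∀ n → Positive≤ (n ℕ.+ n) → T (n ℕ.+ n) + T (suc (n ℕ.+ n)) + 2ℚ * (d * ι n) ≤ 2ℚ
    telescope zero    _ = subst (_≤ 2ℚ) (sym (trans (lem h d) refl)) (+-monoʳ-≤ 1ℚ (≤-trans (a≤∣a∣ h) ∣h∣≤1))
      where lem : ∀ h d → 1ℚ + (h * 1ℚ - d * 0ℚ) + (1ℚ + 1ℚ) * (d * 0ℚ) ≡ 1ℚ + h
            lem = solve-∀ ℚ-ring
    telescope (suc n) P rewrite ℕₚ.+-suc n n = ≤-trans (≤-by slack 0≤slack eq) (telescope n P′)
      where
      P′ : Positive≤ (n ℕ.+ n)
      P′ i q = P i (ℕₚ.m≤n⇒m≤1+n (ℕₚ.m≤n⇒m≤1+n q))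
      m = n ℕ.+ n
      slack = 2ℚ * (d * (U (suc m) + U (suc (suc m)) - 1ℚ))
      0≤slack : 0ℚ ≤ slack
      0≤slack = 0≤* {2ℚ} (nonNegative⁻¹ 2ℚ) (0≤* (0≤d h ∣h∣≤1) (0≤-‿ (1≤U+U (suc m)
        (0≤U P (suc m) (ℕₚ.n≤1+n (suc m))) (0≤U P (suc (suc m)) ℕₚ.≤-refl))))
      lem : ∀ a h u k → a + (h * a - (1ℚ - h * h) * u) + (1ℚ + 1ℚ) * ((1ℚ - h * h) * k)
          ≡ (h * (h * a - (1ℚ - h * h) * u) - (1ℚ - h * h) * (h * u + a))
          + (h * (h * (h * a - (1ℚ - h * h) * u) - (1ℚ - h * h) * (h * u + a)) - (1ℚ - h * h) *
              (h * (h * u + a) + (h * a - (1ℚ - h * h) * u)))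
          + (1ℚ + 1ℚ) * ((1ℚ - h * h) * (1ℚ + k))
          + (1ℚ + 1ℚ) * ((1ℚ - h * h) * ((h * u + a) + (h * (h * u + a) + (h * a - (1ℚ - h * h) * u)) - 1ℚ))
      lem = solve-∀ ℚ-ring
      eq : T m + T (suc m) + 2ℚ * (d * ι n) ≡ T (suc (suc m)) + T (suc (suc (suc m))) + 2ℚ * (d * ι (suc n)) + slack
      eq = lem (T m) h (U m) (ι n)

    firstExit : ∀ n → Positive≤ n ⊎ ∃[ N ] (suc N ℕ.≤ n × U (suc N) ≤ 0ℚ × Positive≤ N)
    firstExit zero    = inj₁ λ _ ()
    firstExit (suc n) with firstExit n
    ... | inj₂ (N , a , b) = inj₂ (N , ℕₚ.m≤n⇒m≤1+n a , b)
    ... | inj₁ P with U (suc n) ≤? 0ℚ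
    ...   | yes q = inj₂ (n , ℕₚ.≤-refl , q , P)
    ...   | no q  = inj₁ P′
      where
      P′ : Positive≤ (suc n)
      P′ i le with ℕₚ.m≤n⇒m<n∨m≡n le
      ... | inj₁ (s≤s lt) = P i lt
      ... | inj₂ refl = ≰⇒> q

    exit : h < 1ℚ → ∃[ N ] (U (suc N) ≤ 0ℚ × Positive≤ N)
    exit h<1 = decide (firstExit (n ℕ.+ n))
      where
      lem₁ : ∀ h → (1ℚ - h) * (1ℚ + h) ≡ 1ℚ - h * h
      lem₁ = solve-∀ ℚ-ring
      0<1-h : 0ℚ < 1ℚ - h
      0<1-h = subst (_< 1ℚ - h) (+-inverseʳ h) (+-monoˡ-< (- h) h<1)
      0<d : 0ℚ < d
      0<d = subst (0ℚ <_) (lem₁ h) (0<* 0<1-h (+-mono-<-≤ (positive⁻¹ 1ℚ) 0≤h))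
      instance
        d-pos : Positive d
        d-pos = positive 0<d
        d≢0 : NonZero d
        d≢0 = pos⇒nonZero d
      -- If all `U` up to 2n were positive, `telescope` and T ≥ -1 would give d·n ≤ 2. Choosing d·n
      -- ≥ 3 contradicts this.
      n : ℕ
      n = proj₁ (archimedean (3ℚ * 1/ d))
      3≤dn : 3ℚ ≤ d * ι n
      3≤dn = ≤-trans (≤-reflexive (sym (trans (lem₂ d (1/ d))
          (trans (cong (3ℚ *_) (*-inverseʳ d)) (*-identityʳ 3ℚ)))))
        (*-mono-≤ˡ d (<⇒≤ 0<d) (proj₂ (archimedean (3ℚ * 1/ d))))
        where lem₂ : ∀ d e → d * (3ℚ * e) ≡ 3ℚ * (d * e)
              lem₂ = solve-∀ ℚ-ring
      -1≤T : ∀ m → - 1ℚ ≤ T m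
      -1≤T m = subst (- 1ℚ ≤_) (lem₂ (T m)) (neg-antimono-≤ (≤-trans (-a≤∣a∣ (T m)) (chebT-bound h ∣h∣≤1 m)))
        where lem₂ : ∀ a → - - a ≡ a
              lem₂ = solve-∀ ℚ-ring
      decide : Positive≤ (n ℕ.+ n) ⊎ ∃[ N ] (suc N ℕ.≤ n ℕ.+ n × U (suc N) ≤ 0ℚ × Positive≤ N) → _
      decide (inj₂ (N , _ , r)) = N , r
      decide (inj₁ P) = contradiction (≤-trans (+-mono-≤ (+-mono-≤ (-1≤T (n ℕ.+ n)) (-1≤T (suc (n ℕ.+ n))))
        (*-mono-≤ˡ 2ℚ (nonNegative⁻¹ 2ℚ) 3≤dn)) (telescope n P))
            (toWitnessFalse {a? = - 1ℚ + - 1ℚ + 2ℚ * 3ℚ ≤? 2ℚ} _)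

    -- In `chebU-shift` at N both terms are nonpositive while r < N, so the sine cannot become
    -- positive again before almost N further steps.
    U-past-exit : ∀ N → U (suc N) ≤ 0ℚ → Positive≤ N → ∀ r → suc r ℕ.≤ N → U (suc N ℕ.+ r) ≤ 0ℚ
    U-past-exit N U≤0 P r r<N = subst (_≤ 0ℚ) (sym (chebU-shift h N r))
      (+-mono-≤ {x = U (suc N) * U (suc r)}
        (subst (U (suc N) * U (suc r) ≤_) (*-zeroˡ (U (suc r))) (*-mono-≤ʳ (U (suc r)) (0≤U P (suc r) r<N) U≤0))
        (neg≤0 (0≤* (0≤U P N ℕₚ.≤-refl) (0≤U P r (ℕₚ.<⇒≤ r<N)))))

  -- A cosine of so small an angle that the first nonpositive sine comes after index p + 1; this
  -- leaves room to round that index up to a multiple of p.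
  record NearOne (p : ℕ) : Set where
    field
      h      : ℚ
      0≤h    : 0ℚ ≤ h
      ∣h∣≤1  : ∣ h ∣ ≤ 1ℚ
      h<1    : h < 1ℚ
      positiveUpTo : ∀ i → i ℕ.≤ p → 0ℚ < chebU h (suc i)

  -- Take h = 1 - y. As 1 - h² ≤ 2y and U_i ≤ p, one step lowers `T` by at most y(1 + 2p). With p(1
  -- + 2p)y ≤ ½ the first p values of `T` stay at least ½, and `U` inherits positivity from its
  -- recursion.
  nearOne : ∀ p → NearOne p
  nearOne p = record { h = h ; 0≤h = 0≤h ; ∣h∣≤1 = ∣h∣≤1 ; h<1 = <-by y (0<halfPow n) (lem₀ y) ; positiveUpTo =
      U>0 }
    where
    B : ℚ
    B = ι p * (1ℚ + 2ℚ * ι p)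
    n = proj₁ (halfPow-small B (positive⁻¹ ½))
    y h : ℚ
    y = halfPow n
    h = 1ℚ - y
    By≤½ : B * y ≤ ½
    By≤½ = proj₂ (halfPow-small B (positive⁻¹ ½))
    0≤y : 0ℚ ≤ y
    0≤y = <⇒≤ (0<halfPow n)
    lem₀ : ∀ y → 1ℚ ≡ 1ℚ - y + y
    lem₀ = solve-∀ ℚ-ring
    0≤h : 0ℚ ≤ h
    0≤h = 0≤-‿ (halfPow≤1 n)
    ∣h∣≤1 : ∣ h ∣ ≤ 1ℚ
    ∣h∣≤1 = subst (_≤ 1ℚ) (sym (0≤p⇒∣p∣≡p 0≤h)) (≤-by y 0≤y (lem₀ y))
    T U : ℕ → ℚ
    T = chebT h
    U = chebU h
    d = 1ℚ - h * h
    T-drop : ∀ i → i ℕ.≤ p → T i - y * (1ℚ + 2ℚ * ι p) ≤ T (suc i)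
    T-drop i i≤p = ≤-by (y * (1ℚ - T i) + (d * (ι p - U i) + (y * y) * ι p))
        (0≤+ (0≤* 0≤y (0≤-‿ (≤-trans (a≤∣a∣ (T i)) (chebT-bound h ∣h∣≤1 i))))
         (0≤+ (0≤* (0≤d h ∣h∣≤1) (0≤-‿ (≤-trans (a≤∣a∣ (U i)) (≤-trans (chebU-bound h ∣h∣≤1 i) (ι-mono i≤p)))))
             (0≤* (0≤sq y) (0≤ι p))))
         (lem y (T i) (U i) (ι p))
      where lem : ∀ y t u k → (1ℚ - y) * t - (1ℚ - (1ℚ - y) * (1ℚ - y)) * u
              ≡ t - y * (1ℚ + (1ℚ + 1ℚ) * k) + (y * (1ℚ - t) + ((1ℚ - (1ℚ - y) * (1ℚ - y)) * (k - u) + (y * y) * k))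
            lem = solve-∀ ℚ-ring
    T-lower : ∀ i → i ℕ.≤ p → 1ℚ - ι i * (y * (1ℚ + 2ℚ * ι p)) ≤ T i
    T-lower zero    _ = ≤-reflexive (lem (y * (1ℚ + 2ℚ * ι p)))
      where lem : ∀ a → 1ℚ - 0ℚ * a ≡ 1ℚ
            lem = solve-∀ ℚ-ring
    T-lower (suc i) le = ≤-trans (≤-reflexive (lem (ι i) (y * (1ℚ + 2ℚ * ι p))))
        (≤-trans (+-monoˡ-≤ (- (y * (1ℚ + 2ℚ * ι p))) (T-lower i i≤p)) (T-drop i i≤p))
      where
      i≤p = ℕₚ.<⇒≤ le
      lem : ∀ i a → 1ℚ - (1ℚ + i) * a ≡ 1ℚ - i * a - a
      lem = solve-∀ ℚ-ring
    T>0 : ∀ i → i ℕ.≤ p → 0ℚ < T i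
    T>0 i le = <-≤-trans (positive⁻¹ ½) (≤-trans (≤-by (½ - ι i * (y * (1ℚ + 2ℚ * ι p)))
        (0≤-‿ (≤-trans (*-mono-≤ʳ (y * (1ℚ + 2ℚ * ι p))
            (0≤* 0≤y (0≤+ 0≤1 (0≤* {2ℚ} (nonNegative⁻¹ 2ℚ) (0≤ι p)))) (ι-mono le))
          (subst (_≤ ½) (lem₁ (ι p) y) By≤½))) (lem₂ (ι i * (y * (1ℚ + 2ℚ * ι p))))) (T-lower i le))
      where
      lem₁ : ∀ k y → k * (1ℚ + (1ℚ + 1ℚ) * k) * y ≡ k * (y * (1ℚ + (1ℚ + 1ℚ) * k))
      lem₁ = solve-∀ ℚ-ring
      lem₂ : ∀ a → (½ + ½) - a ≡ ½ + (½ - a)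
      lem₂ = solve-∀ ℚ-ring
    0≤U′ : ∀ i → i ℕ.≤ p → 0ℚ ≤ U i
    0≤U′ zero    _ = ≤-refl
    0≤U′ (suc i) le = 0≤+ (0≤* 0≤h (0≤U′ i (ℕₚ.<⇒≤ le))) (<⇒≤ (T>0 i (ℕₚ.<⇒≤ le)))
    U>0 : ∀ i → i ℕ.≤ p → 0ℚ < U (suc i)
    U>0 i le = +-mono-≤-< (0≤* 0≤h (0≤U′ i le)) (T>0 i le)

  -- cos(sθ) with p·sθ just past π, read off from the first sign change of sin nθ for a small angle θ.
  chebU-nonpos-from : ∀ p → 2 ℕ.≤ p → ∀ h (0≤h : 0ℚ ≤ h) (∣h∣≤1 : ∣ h ∣ ≤ 1ℚ) →
    (∀ i → i ℕ.≤ p → 0ℚ < chebU h (suc i)) →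
    ∀ N → chebU h (suc N) ≤ 0ℚ → Positive≤ h 0≤h ∣h∣≤1 N → ∃[ x ] (∣ x ∣ ≤ 1ℚ × chebU x p ≤ 0ℚ)
  chebU-nonpos-from p@(suc p-1) 2≤p h 0≤h ∣h∣≤1 positiveUpTo N exits below =
      chebT h s , chebT-bound h ∣h∣≤1 s , nonpos
    where
    p≤N : p ℕ.< N
    p≤N with p ℕₚ.<? N
    ... | yes q = q
    ... | no q  = contradiction (<-≤-trans (positiveUpTo N (ℕₚ.≮⇒≥ q)) exits) (<-irrefl refl)
    s t r : ℕ
    -- The ceiling of (N + 1) / p, so that p·s = N + 1 + r with an overshoot r < p.
    s = (suc N ℕ.+ p-1) ℕ./ p
    t = (suc N ℕ.+ p-1) ℕ.% p
    t≤p-1 : t ℕ.≤ p-1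
    t≤p-1 = ℕ.s≤s⁻¹ (ℕD.m%n<n (suc N ℕ.+ p-1) p)
    r = p-1 ℕ.∸ t
    ps≡ : p ℕ.* s ≡ suc N ℕ.+ r
    ps≡ = ℕₚ.+-cancelʳ-≡ t _ _ (begin
      p ℕ.* s ℕ.+ t             ≡⟨ cong (ℕ._+ t) (ℕₚ.*-comm p s) ⟩
      s ℕ.* p ℕ.+ t             ≡⟨ ℕₚ.+-comm (s ℕ.* p) t ⟩
      t ℕ.+ s ℕ.* p             ≡⟨ sym (ℕD.m≡m%n+[m/n]*n (suc N ℕ.+ p-1) p) ⟩
      suc N ℕ.+ p-1             ≡⟨ cong (suc N ℕ.+_) (sym (ℕₚ.m∸n+n≡m t≤p-1)) ⟩
      suc N ℕ.+ (r ℕ.+ t)       ≡⟨ sym (ℕₚ.+-assoc (suc N) r t) ⟩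
      suc N ℕ.+ r ℕ.+ t         ∎)
      where open ≡-Reasoning
    r<N : suc r ℕ.≤ N
    r<N = ℕₚ.≤-trans (s≤s (ℕₚ.m∸n≤m p-1 t)) (ℕₚ.<⇒≤ p≤N)
    -- The index s is still in the positive range: p·s = N + (r + 1) ≤ 2N ≤ p·N, hence s ≤ N.
    0<Us : 0ℚ < chebU h s
    0<Us with s in eq
    ... | zero  = contradiction (trans (sym ps≡) (trans (cong (p ℕ.*_) eq) (ℕₚ.*-zeroʳ p))) λ ()
    ... | suc s′ = below s′ (ℕₚ.*-cancelˡ-≤ p {{_}} (begin
      p ℕ.* suc s′      ≡⟨ cong (p ℕ.*_) (sym eq) ⟩
      p ℕ.* s           ≡⟨ ps≡ ⟩
      suc N ℕ.+ r       ≡⟨ sym (ℕₚ.+-suc N r) ⟩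
      N ℕ.+ suc r       ≤⟨ ℕₚ.+-monoʳ-≤ N r<N ⟩
      N ℕ.+ N           ≡⟨ cong (N ℕ.+_) (sym (ℕₚ.+-identityʳ N)) ⟩
      2 ℕ.* N           ≤⟨ ℕₚ.*-monoˡ-≤ N 2≤p ⟩
      p ℕ.* N           ∎))
      where open ℕₚ.≤-Reasoning
    -- By `chebU-comp` this value times the positive `chebU h s` equals `chebU h (p * s)`, which
    -- lies just past the exit.
    nonpos : chebU (chebT h s) p ≤ 0ℚ
    nonpos = *-cancelʳ-≤-pos (chebU h s) {{positive 0<Us}}
      (subst₂ _≤_ (sym (trans (chebU-comp h s p) (cong (chebU h) ps≡))) (sym (*-zeroˡ (chebU h s)))
        (U-past-exit h 0≤h ∣h∣≤1 N exits below r r<N))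

  chebU-nonpos : ∀ p → 2 ℕ.≤ p → ∃[ x ] (∣ x ∣ ≤ 1ℚ × chebU x p ≤ 0ℚ)
  chebU-nonpos p 2≤p = chebU-nonpos-from p 2≤p h 0≤h ∣h∣≤1 positiveUpTo (proj₁ ex) (proj₁ (proj₂ ex))
      (proj₂ (proj₂ ex))
    where
    open NearOne (nearOne p)
    ex = exit h 0≤h ∣h∣≤1 h<1

  -- The other end of the sign change is 1, where the polynomial takes the value p.
  approximateRoot : ∀ p → 2 ℕ.≤ p → ∀ {η} → 0ℚ < η → ∃[ h ] (∣ h ∣ ≤ 1ℚ × ∣ chebU h p ∣ ≤ η)
  approximateRoot p 2≤p 0<η = intermediateValue (chebU-lip p) s 0<η
    where
    root = chebU-nonpos p 2≤p
    h = proj₁ root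
    s : SignChange (λ h → chebU h p) ∣ 1ℚ - h ∣
    s = signChange h 1ℚ (proj₁ (proj₂ root)) ≤-refl (proj₂ (proj₂ root))
          (subst (0ℚ ≤_) (sym (chebU-at-1 p)) (0≤ι p)) ≤-refl

-- Finite sums over lists.

module FiniteSums where
  open import Defs
  open RationalBounds
  open import Data.Rational
  open import Data.Rational.Properties
  open import Algebra.Properties.CommutativeMonoid.Sum +-0-commutativeMonoid using (sum; sum-permute)

  private variable
    A B : Set

  ∑ : List A → (A → ℚ) → ℚ
  ∑ xs f = sumℚ (map f xs)

  ∑-cong : (xs : List A) {f g : A → ℚ} → (∀ x → f x ≡ g x) → ∑ xs f ≡ ∑ xs g
  ∑-cong []       e = refl
  ∑-cong (x ∷ xs) e = cong₂ _+_ (e x) (∑-cong xs e)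

  ∑-zero : (xs : List A) {f : A → ℚ} → (∀ x → f x ≡ 0ℚ) → ∑ xs f ≡ 0ℚ
  ∑-zero []       e = refl
  ∑-zero (x ∷ xs) e = trans (cong₂ _+_ (e x) (∑-zero xs e)) (+-identityʳ 0ℚ)

  ∑-+ : (xs : List A) (f g : A → ℚ) → ∑ xs (λ x → f x + g x) ≡ ∑ xs f + ∑ xs g
  ∑-+ []       f g = refl
  ∑-+ (x ∷ xs) f g = trans (cong (f x + g x +_) (∑-+ xs f g)) (lem (f x) (g x) (∑ xs f) (∑ xs g))
    where lem : ∀ a b c d → a + b + (c + d) ≡ a + c + (b + d)
          lem = solve-∀ ℚ-ring

  ∑-*ˡ : (xs : List A) (c : ℚ) (f : A → ℚ) → ∑ xs (λ x → c * f x) ≡ c * ∑ xs f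
  ∑-*ˡ []       c f = sym (*-zeroʳ c)
  ∑-*ˡ (x ∷ xs) c f = trans (cong (c * f x +_) (∑-*ˡ xs c f)) (sym (*-distribˡ-+ c (f x) (∑ xs f)))

  ∑-*ʳ : (xs : List A) (c : ℚ) (f : A → ℚ) → ∑ xs (λ x → f x * c) ≡ ∑ xs f * c
  ∑-*ʳ xs c f = trans (∑-cong xs (λ x → *-comm (f x) c)) (trans (∑-*ˡ xs c f) (*-comm c (∑ xs f)))

  ∑-const : (xs : List A) (c : ℚ) → ∑ xs (λ _ → c) ≡ ι (length xs) * c
  ∑-const []       c = sym (*-zeroˡ c)
  ∑-const (x ∷ xs) c = trans (cong (c +_) (∑-const xs c)) (lem c (ι (length xs)))
    where lem : ∀ c n → c + n * c ≡ (1ℚ + n) * c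
          lem = solve-∀ ℚ-ring

  ∑-swap : (xs : List A) (ys : List B) (f : A → B → ℚ) →
           ∑ xs (λ x → ∑ ys (f x)) ≡ ∑ ys (λ y → ∑ xs (λ x → f x y))
  ∑-swap []       ys f = sym (∑-zero ys (λ _ → refl))
  ∑-swap (x ∷ xs) ys f = trans (cong (∑ ys (f x) +_) (∑-swap xs ys f))
    (sym (∑-+ ys (f x) (λ y → ∑ xs (λ x → f x y))))

  ∑-++ : (xs ys : List A) (f : A → ℚ) → ∑ (xs ++ ys) f ≡ ∑ xs f + ∑ ys f
  ∑-++ []       ys f = sym (+-identityˡ _)
  ∑-++ (x ∷ xs) ys f = trans (cong (f x +_) (∑-++ xs ys f)) (sym (+-assoc (f x) _ _))

  ∑-map : (g : A → B) (xs : List A) (f : B → ℚ) → ∑ (map g xs) f ≡ ∑ xs (λ x → f (g x))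
  ∑-map g []       f = refl
  ∑-map g (x ∷ xs) f = cong (f (g x) +_) (∑-map g xs f)

  ∑-concatMap : (g : A → List B) (xs : List A) (f : B → ℚ) → ∑ (concatMap g xs) f ≡ ∑ xs (λ x → ∑ (g x) f)
  ∑-concatMap g []       f = refl
  ∑-concatMap g (x ∷ xs) f = trans (∑-++ (g x) (concatMap g xs) f) (cong (∑ (g x) f +_) (∑-concatMap g xs f))

  ∑-nonneg : (xs : List A) {f : A → ℚ} → (∀ x → x ∈ xs → 0ℚ ≤ f x) → 0ℚ ≤ ∑ xs f
  ∑-nonneg []       e = ≤-refl
  ∑-nonneg (x ∷ xs) e = 0≤+ (e x (here refl)) (∑-nonneg xs (λ y m → e y (there m)))

  ∑-abs : (xs : List A) {f : A → ℚ} {c : ℚ} → (∀ x → ∣ f x ∣ ≤ c) → ∣ ∑ xs f ∣ ≤ ι (length xs) * c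
  ∑-abs []       {c = c} e = ≤-reflexive (sym (*-zeroˡ c))
  ∑-abs (x ∷ xs) {f} {c} e = subst (∣ f x + ∑ xs f ∣ ≤_) (lem c (ι (length xs))) (∣+∣≤ (e x) (∑-abs xs e))
    where lem : ∀ c n → c + n * c ≡ (1ℚ + n) * c
          lem = solve-∀ ℚ-ring

  ∑-member : {xs : List A} {f : A → ℚ} → (∀ x → x ∈ xs → 0ℚ ≤ f x) → ∀ {x} → x ∈ xs → f x ≤ ∑ xs f
  ∑-member {xs = x ∷ xs} {f} nn (here refl) = ≤-by (∑ xs f) (∑-nonneg xs (λ y m → nn y (there m))) refl
  ∑-member {xs = y ∷ xs} {f} nn {x} (there m) = ≤-trans (∑-member {xs = xs} (λ z q → nn z (there q)) m)
    (≤-by (f y) (nn y (here refl)) (+-comm (f y) (∑ xs f)))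

  map-allFin : ∀ n {f : Fin (suc n) → A} → map f (allFin (suc n)) ≡ f Fin.zero ∷ map (λ i → f (Fin.suc i))
      (allFin n)
  map-allFin n {f} = cong (f Fin.zero ∷_) (trans (map-tabulate Fin.suc f)
      (sym (map-tabulate (λ i → i) (λ i → f (Fin.suc i)))))

  foldr-allFin : ∀ n (f : Fin (suc n) → A → A) (e : A) →
                 foldr f e (allFin (suc n)) ≡ f Fin.zero (foldr (λ i → f (Fin.suc i)) e (allFin n))
  foldr-allFin {A} n f e = cong (f Fin.zero) (lem (λ i → i))
    where
    lem : ∀ {m} (g : Fin m → Fin n) → foldr f e (tabulate (λ i → Fin.suc (g i))) ≡ foldr (λ i → f (Fin.suc i)) e
        (tabulate g)
    lem {zero}  g = refl
    lem {suc m} g = cong (f (Fin.suc (g Fin.zero))) (lem (λ i → g (Fin.suc i)))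

  ∑-allFin : ∀ n (f : Fin (suc n) → ℚ) → ∑ (allFin (suc n)) f ≡ f Fin.zero + ∑ (allFin n) (λ i → f (Fin.suc i))
  ∑-allFin n f = cong sumℚ (map-allFin n {f})

  -- Peels off the last term, which is how `evenSum` recurses, whereas `allFin` grows at the front.
  ∑-allFin-last : ∀ n (F : ℕ → ℚ) → ∑ (allFin (suc n)) (λ i → F (toℕ i)) ≡ ∑ (allFin n) (λ i → F (toℕ i)) + F n
  ∑-allFin-last zero    F = trans (+-identityʳ (F 0)) (sym (+-identityˡ (F 0)))
  ∑-allFin-last (suc n) F = trans (∑-allFin (suc n) (λ i → F (toℕ i)))
    (trans (cong (F 0 +_) (∑-allFin-last n (λ i → F (suc i))))
    (trans (sym (+-assoc (F 0) _ _)) (cong (_+ F (suc n)) (sym (∑-allFin n (λ i → F (toℕ i)))))))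

  ∑-allFin-sum : ∀ n (f : Fin n → ℚ) → ∑ (allFin n) f ≡ sum f
  ∑-allFin-sum zero    f = refl
  ∑-allFin-sum (suc n) f = trans (∑-allFin n f) (cong (f Fin.zero +_) (∑-allFin-sum n (λ i → f (Fin.suc i))))

  ∑-permute : ∀ {n} (f : Fin n → ℚ) (π : Permutation n n) → ∑ (allFin n) f ≡ ∑ (allFin n) (λ i → f (π ⟨$⟩ʳ i))
  ∑-permute {n} f π = trans (∑-allFin-sum n f) (trans (sum-permute f π) (sym (∑-allFin-sum n (λ i → f (π ⟨$⟩ʳ i)))))

  length-allFin : ∀ n → ι (length (allFin n)) ≡ ι n
  length-allFin n = cong ι (lem n (λ i → i))
    where open import Data.List.Properties using (length-tabulate)
          lem : ∀ n (f : Fin n → Fin n) → length (tabulate f) ≡ n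
          lem n f = length-tabulate f

  ∑-filter : (P : A → Bool) (xs : List A) (f : A → ℚ) →
             ∑ (filterᵇ P xs) f ≡ ∑ xs (λ x → if P x then f x else 0ℚ)
  ∑-filter P []       f = refl
  ∑-filter P (x ∷ xs) f with P x
  ... | true  = cong (f x +_) (∑-filter P xs f)
  ... | false = trans (∑-filter P xs f) (sym (+-identityˡ _))

-- Congruences modulo p and reindexing of sums over residues.

module ModularArithmetic where
  open RationalBounds
  open FiniteSums
  open import Data.Integer using (+_; _+_; _*_; _-_; -_; _%ℕ_; _/ℕ_)
  open import Data.Rational using (ℚ)

  module Modular (p : ℕ) .{{_ : ℕ.NonZero p}} where

    infix 4 _≈_ _≉0
    -- A record, so that both sides can be recovered from the type; a bare divisibility of `x - y`
    -- does not determine them.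
    record _≈_ (x y : ℤ) : Set where
      constructor by∣
      field difference : + p ∣ x - y

    _≉0 : ℤ → Set
    x ≉0 = ¬ (+ p ∣ x)

    ≡⇒≈ : ∀ {x y} → x ≡ y → x ≈ y
    ≡⇒≈ {x} refl = by∣ (divides 0ℤ (ℤₚ.+-inverseʳ x))

    ≈-sym : ∀ {x y} → x ≈ y → y ≈ x
    ≈-sym {x} {y} (by∣ h) = by∣ (subst (+ p ∣_) (lem x y) (∣m⇒∣-m h))
      where lem : ∀ x y → - (x - y) ≡ y - x
            lem = solveℤ

    ≈-trans : ∀ {x y z} → x ≈ y → y ≈ z → x ≈ z
    ≈-trans {x} {y} {z} (by∣ h) (by∣ k) = by∣ (subst (+ p ∣_) (lem x y z) (∣m∣n⇒∣m+n h k))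
      where lem : ∀ x y z → x - y + (y - z) ≡ x - z
            lem = solveℤ

    +-cong : ∀ {x y z w} → x ≈ y → z ≈ w → x + z ≈ y + w
    +-cong {x} {y} {z} {w} (by∣ h) (by∣ k) = by∣ (subst (+ p ∣_) (lem x y z w) (∣m∣n⇒∣m+n h k))
      where lem : ∀ x y z w → x - y + (z - w) ≡ x + z - (y + w)
            lem = solveℤ

    -‿cong : ∀ {x y} → x ≈ y → - x ≈ - y
    -‿cong {x} {y} (by∣ h) = by∣ (subst (+ p ∣_) (lem x y) (∣m⇒∣-m h))
      where lem : ∀ x y → - (x - y) ≡ - x - - y
            lem = solveℤ

    *-cong : ∀ {x y z w} → x ≈ y → z ≈ w → x * z ≈ y * w
    *-cong {x} {y} {z} {w} (by∣ h) (by∣ k) = by∣ (subst (+ p ∣_) (lem x y z w)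
        (∣m∣n⇒∣m+n (∣n⇒∣m*n z h) (∣n⇒∣m*n y k)))
      where lem : ∀ x y z w → z * (x - y) + y * (z - w) ≡ x * z - y * w
            lem = solveℤ

    *-congˡ : ∀ x {y z} → y ≈ z → x * y ≈ x * z
    *-congˡ x = *-cong {x} {x} (≡⇒≈ refl)

    ∣⇒≈0 : ∀ {x} → + p ∣ x → x ≈ 0ℤ
    ∣⇒≈0 {x} h = by∣ (subst (+ p ∣_) (sym (ℤₚ.+-identityʳ x)) h)

    ∣-resp : ∀ {x y} → x ≈ y → + p ∣ y → + p ∣ x
    ∣-resp {x} {y} (by∣ h) k = subst (+ p ∣_) (lem x y) (∣m∣n⇒∣m+n h k)
      where lem : ∀ x y → x - y + y ≡ x
            lem = solveℤ

    rem : ℤ → Fin p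
    rem n = fromℕ< (n%ℕd<d n p)

    toℕ-rem : ∀ n → toℕ (rem n) ≡ n %ℕ p
    toℕ-rem n = Finₚ.toℕ-fromℕ< (n%ℕd<d n p)

    %ℕ-≈ : ∀ n → + (n %ℕ p) ≈ n
    %ℕ-≈ n = by∣ (divides (- (n /ℕ p)) (trans (cong (λ z → + (n %ℕ p) - z) (a≡a%ℕn+[a/ℕn]*n n p))
        (lem (+ (n %ℕ p)) (n /ℕ p) (+ p))))
      where lem : ∀ r q p → r - (r + q * p) ≡ - q * p
            lem = solveℤ

    rem-≈ : ∀ n → + toℕ (rem n) ≈ n
    rem-≈ n = subst (λ z → + z ≈ n) (sym (toℕ-rem n)) (%ℕ-≈ n)

    small-multiple : ∀ n → n ℕ.< p → p ℕ∣.∣ n → n ≡ 0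
    small-multiple zero    _ _ = refl
    small-multiple (suc n) l d = contradiction (ℕ∣.∣⇒≤ d) (ℕₚ.<⇒≱ l)

    residue-unique : ∀ {a b} → a ℕ.< p → b ℕ.< p → + a ≈ + b → a ≡ b
    residue-unique {a} {b} a<p b<p h with ℕₚ.≤-total a b
    ... | inj₁ a≤b = ℕₚ.≤-antisym a≤b (ℕₚ.m∸n≡0⇒m≤n (small-multiple (b ℕ.∸ a) (ℕₚ.≤-<-trans (ℕₚ.m∸n≤m b a) b<p)
        (∣⇒∣ᵤ (subst (+ p ∣_) (trans (ℤₚ.m-n≡m⊖n b a) (ℤₚ.⊖-≥ a≤b)) (_≈_.difference (≈-sym h))))))
    ... | inj₂ b≤a = ℕₚ.≤-antisym (ℕₚ.m∸n≡0⇒m≤n (small-multiple (a ℕ.∸ b) (ℕₚ.≤-<-trans (ℕₚ.m∸n≤m a b) a<p)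
        (∣⇒∣ᵤ (subst (+ p ∣_) (trans (ℤₚ.m-n≡m⊖n a b) (ℤₚ.⊖-≥ b≤a)) (_≈_.difference h))))) b≤a

    Fin-unique : ∀ {i j : Fin p} → + toℕ i ≈ + toℕ j → i ≡ j
    Fin-unique {i} {j} h = Finₚ.toℕ-injective (residue-unique (Finₚ.toℕ<n i) (Finₚ.toℕ<n j) h)

    %ℕ-unique : ∀ {n r} → r ℕ.< p → + r ≈ n → n %ℕ p ≡ r
    %ℕ-unique {n} r<p h = residue-unique (n%ℕd<d n p) r<p (≈-trans (%ℕ-≈ n) (≈-sym h))

    module _ (pr : Prime p) where

      1≉0 : 1ℤ ≉0
      1≉0 d = ¬prime[1] (subst Prime (ℕ∣.∣1⇒≡1 (∣⇒∣ᵤ d)) pr)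

      euclid : ∀ x y → + p ∣ x * y → + p ∣ x ⊎ + p ∣ y
      euclid x y h with euclidsLemma ℤ.∣ x ∣ ℤ.∣ y ∣ pr (subst (p ℕ∣.∣_) (ℤₚ.abs-* x y) (∣⇒∣ᵤ h))
      ... | inj₁ d = inj₁ (∣ᵤ⇒∣ d)
      ... | inj₂ d = inj₂ (∣ᵤ⇒∣ d)

      ≉0-* : ∀ {x y} → x ≉0 → y ≉0 → x * y ≉0
      ≉0-* {x} {y} hx hy d with euclid x y d
      ... | inj₁ e = hx e
      ... | inj₂ e = hy e

      cancel-≉0 : ∀ {x y} → x ≉0 → + p ∣ x * y → + p ∣ y
      cancel-≉0 {x} {y} hx d with euclid x y d
      ... | inj₁ e = contradiction e hx
      ... | inj₂ e = e

      -- The residue of t lies strictly between 0 and p, hence is coprime to p, and a Bézout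
      -- identity supplies the inverse.
      inverse : ∀ t → t ≉0 → ∃[ t′ ] t * t′ ≈ 1ℤ
      inverse t t≉0 with t %ℕ p in eq
      ... | zero  = contradiction (∣-resp (≈-sym (subst (λ z → + z ≈ t) eq (%ℕ-≈ t))) (divides 0ℤ refl)) t≉0
      ... | suc k with coprime-Bézout (prime⇒coprime pr (subst (ℕ._< p) eq (n%ℕd<d t p)))
      ...   | Bézout.+- x y e = - + y , ≈-trans (*-cong {t} {+ suc k} { - + y} { - + y} t≈ (≡⇒≈ refl))
               (by∣ (divides (- + x) (lem (+ suc k) (+ y) (+ x) (+ p)
                   (trans (cong (λ z → 1ℤ + z) (sym (ℤₚ.pos-* y (suc k)))) (trans (cong +_ e) (ℤₚ.pos-* x p))))))
        where
        t≈ : t ≈ + suc k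
        t≈ = ≈-sym (subst (λ z → + z ≈ t) eq (%ℕ-≈ t))
        lem : ∀ k y x p → 1ℤ + y * k ≡ x * p → k * - y - 1ℤ ≡ - x * p
        lem k y x p e = trans (lem₁ k y) (trans (cong -_ e) (lem₂ x p))
          where lem₁ : ∀ k y → k * - y - 1ℤ ≡ - (1ℤ + y * k)
                lem₁ = solveℤ
                lem₂ : ∀ x p → - (x * p) ≡ - x * p
                lem₂ = solveℤ
      ...   | Bézout.-+ x y e = + y , ≈-trans (*-cong {t} {+ suc k} {+ y} {+ y} t≈ (≡⇒≈ refl))
               (by∣ (divides (+ x) (lem (+ suc k) (+ y) (+ x) (+ p)
                   (trans (cong (λ z → 1ℤ + z) (sym (ℤₚ.pos-* x p))) (trans (cong +_ e) (ℤₚ.pos-* y (suc k)))))))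
        where
        t≈ : t ≈ + suc k
        t≈ = ≈-sym (subst (λ z → + z ≈ t) eq (%ℕ-≈ t))
        lem : ∀ k y x p → 1ℤ + x * p ≡ y * k → k * y - 1ℤ ≡ x * p
        lem k y x p e = trans (lem₁ k y) (trans (cong (λ z → z - 1ℤ) (sym e)) (lem₂ (x * p)))
          where lem₁ : ∀ k y → k * y - 1ℤ ≡ y * k - 1ℤ
                lem₁ = solveℤ
                lem₂ : ∀ x → 1ℤ + x - 1ℤ ≡ x
                lem₂ = solveℤ

      Periodic : (ℤ → ℚ) → Set
      Periodic F = ∀ {m n} → m ≈ n → F m ≡ F n

      -- The map i ↦ a + t·i permutes the residues.
      ∑-affine : ∀ (F : ℤ → ℚ) → Periodic F → ∀ a t → t ≉0 →
                 ∑ (allFin p) (λ i → F (a + t * + toℕ i)) ≡ ∑ (allFin p) (λ i → F (+ toℕ i))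
      ∑-affine F per a t t≉0 = trans (∑-cong (allFin p) (λ i → per (≈-sym (rem-≈ (a + t * + toℕ i)))))
        (sym (∑-permute (λ i → F (+ toℕ i)) (permutation to from left right)))
        where
        t′ = proj₁ (inverse t t≉0)
        tt′ : t * t′ ≈ 1ℤ
        tt′ = proj₂ (inverse t t≉0)
        to from : Fin p → Fin p
        to i = rem (a + t * + toℕ i)
        from j = rem (t′ * (+ toℕ j - a))
        left : ∀ j → to (from j) ≡ j
        left j = Fin-unique (≈-trans (rem-≈ (a + t * + toℕ (from j)))
          (≈-trans (+-cong {a} {a} (≡⇒≈ refl) (*-congˡ t (rem-≈ (t′ * (+ toℕ j - a)))))
          (by∣ (subst (+ p ∣_) (lem a t t′ (+ toℕ j)) (∣n⇒∣m*n (+ toℕ j - a) (_≈_.difference tt′))))))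
          where lem : ∀ a t s j → (j - a) * (t * s - 1ℤ) ≡ a + t * (s * (j - a)) - j
                lem = solveℤ
        right : ∀ i → from (to i) ≡ i
        right i = Fin-unique (≈-trans (rem-≈ (t′ * (+ toℕ (to i) - a)))
          (≈-trans (*-congˡ t′ (+-cong {_} {_} { - a} { - a} (rem-≈ (a + t * + toℕ i)) (≡⇒≈ refl)))
          (by∣ (subst (+ p ∣_) (lem a t t′ (+ toℕ i)) (∣n⇒∣m*n (+ toℕ i) (_≈_.difference tt′))))))
          where lem : ∀ a t s i → i * (t * s - 1ℤ) ≡ s * (a + t * i - a) - i
                lem = solveℤ

-- The rational stand-in for the cosine modulo p.

module ApproximateCosine where
  open RationalBounds
  open Chebyshev
  open ApproximateRoot
  open FiniteSums
  open ModularArithmetic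
  open import Data.Rational
  open import Data.Rational.Properties hiding (-‿cong)

  module _ (p : ℕ) .{{_ : ℕ.NonZero p}} where
    open Modular p

    -- A rational p-periodic stand-in for 2cos(2πn/p).
    record ApproxCos (ε : ℚ) : Set where
      field
        C         : ℤ → ℚ
        periodic  : ∀ {m n} → m ≈ n → C m ≡ C n
        bounded   : ∀ n → ∣ C n ∣ ≤ 3ℚ
        1≤C0      : 1ℚ ≤ C ℤ.0ℤ
        mean-zero : ∑ (allFin p) (λ i → C (ℤ.+ toℕ i)) ≡ 0ℚ
        product   : ∀ m n → ∣ C m * C n - (C (m ℤ.+ n) + C (m ℤ.- n)) ∣ ≤ ε

  module _ (h : ℚ) where
    private
      T : ℕ → ℚ
      T = chebT h
      dbl : ℕ → ℕ
      dbl n = n ℕ.+ n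

    -- An exact product formula for natural indices; the approximation enters only when y + z and
    -- the distance of y and z are reduced modulo p.
    chebT-product : ∀ y z → 2ℚ * (T (dbl y) * T (dbl z)) ≡ T (dbl (y ℕ.+ z)) + T (dbl ℕ.∣ y - z ∣)
    chebT-product y z with ℕₚ.≤-total y z
    ... | inj₁ y≤z = trans (cong (λ w → 2ℚ * (T (dbl y) * T w)) (sym e₁))
          (trans (sym (chebT-sum h (dbl y) (dbl (z ℕ.∸ y))))
              (cong₂ (λ v w → T v + T (dbl w)) e₂ (sym (ℕₚ.m≤n⇒∣m-n∣≡n∸m y≤z))))
      where
      lem : ∀ a b → a ℕ.+ a ℕ.+ (b ℕ.+ b) ≡ (a ℕ.+ b) ℕ.+ (a ℕ.+ b)
      lem = solveℕ
      e₁ : dbl y ℕ.+ dbl (z ℕ.∸ y) ≡ dbl z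
      e₁ = trans (lem y (z ℕ.∸ y)) (cong dbl (ℕₚ.m+[n∸m]≡n y≤z))
      e₂ : dbl y ℕ.+ (dbl y ℕ.+ dbl (z ℕ.∸ y)) ≡ dbl (y ℕ.+ z)
      e₂ = trans (cong (dbl y ℕ.+_) e₁) (lem y z)
    ... | inj₂ z≤y = trans (cong (2ℚ *_) (*-comm (T (dbl y)) (T (dbl z))))
        (trans (cong (λ w → 2ℚ * (T (dbl z) * T w)) (sym e₁))
          (trans (sym (chebT-sum h (dbl z) (dbl (y ℕ.∸ z))))
              (cong₂ (λ v w → T v + T (dbl w)) e₂ (sym (ℕₚ.m≤n⇒∣n-m∣≡n∸m z≤y)))))
      where
      lem : ∀ a b → a ℕ.+ a ℕ.+ (b ℕ.+ b) ≡ (a ℕ.+ b) ℕ.+ (a ℕ.+ b)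
      lem = solveℕ
      lem₂ : ∀ a b → b ℕ.+ b ℕ.+ (a ℕ.+ a) ≡ (a ℕ.+ b) ℕ.+ (a ℕ.+ b)
      lem₂ = solveℕ
      e₁ : dbl z ℕ.+ dbl (y ℕ.∸ z) ≡ dbl y
      e₁ = trans (lem z (y ℕ.∸ z)) (cong dbl (ℕₚ.m+[n∸m]≡n z≤y))
      e₂ : dbl z ℕ.+ (dbl z ℕ.+ dbl (y ℕ.∸ z)) ≡ dbl (y ℕ.+ z)
      e₂ = trans (cong (dbl z ℕ.+_) e₁) (lem₂ y z)

    -- A root of chebU h p makes n ↦ T (2n) both p-periodic and even about p / 2.
    chebT-wrap : ∣ h ∣ ≤ 1ℚ → ∀ {p η} → ∣ chebU h p ∣ ≤ η → ∀ {x s} → x ℕ.< p ℕ.+ p → s ℕ.< p → x ≡ s ⊎ x ≡ s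
        ℕ.+ p →
                 ∣ T (dbl x) - T (dbl s) ∣ ≤ 2ℚ * (ι (p ℕ.+ (p ℕ.+ p)) * η)
    chebT-wrap ∣h∣≤1 {p} {η} U≤η {s = s} _ s<p (inj₁ refl) =
      subst (_≤ _) (sym (cong ∣_∣ (+-inverseʳ (T (dbl s)))))
          (0≤* {2ℚ} (nonNegative⁻¹ 2ℚ) (0≤* (0≤ι (p ℕ.+ (p ℕ.+ p))) (≤-trans (0≤∣p∣ _) U≤η)))
    chebT-wrap ∣h∣≤1 {p} {η} U≤η {s = s} x<2p s<p (inj₂ refl) =
      subst (λ w → ∣ T w - T (dbl s) ∣ ≤ 2ℚ * (ι (p ℕ.+ (p ℕ.+ p)) * η)) (lem p s)
        (chebT-mirror h ∣h∣≤1 p (dbl s) (p ℕ.+ (p ℕ.+ p))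
            (ℕₚ.+-monoʳ-≤ p (ℕₚ.+-mono-≤ (ℕₚ.<⇒≤ s<p) (ℕₚ.<⇒≤ s<p))) U≤η)
      where
      lem : ∀ p s → p ℕ.+ (p ℕ.+ (s ℕ.+ s)) ≡ s ℕ.+ p ℕ.+ (s ℕ.+ p)
      lem = solveℕ

    -- The indices 2e and 2t lie symmetrically about t + e = p, so here the near-zero of `chebU`
    -- sits at the midpoint, not at the half-difference.
    chebT-flip : ∣ h ∣ ≤ 1ℚ → ∀ {p η} → ∣ chebU h p ∣ ≤ η → ∀ {t e} → t ℕ.+ e ≡ p →
                 ∣ T (dbl e) - T (dbl t) ∣ ≤ 2ℚ * (ι (p ℕ.+ (p ℕ.+ p)) * η)
    chebT-flip ∣h∣≤1 {p} {η} U≤η {t} {e} te with ℕₚ.≤-total t e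
    ... | inj₁ t≤e = subst (λ w → ∣ T w - T (dbl t) ∣ ≤ 2ℚ * (ι (p ℕ.+ (p ℕ.+ p)) * η)) eq
          (chebT-mirror′ h ∣h∣≤1 (e ℕ.∸ t) (dbl t) (p ℕ.+ (p ℕ.+ p))
              (ℕₚ.≤-trans (ℕₚ.≤-reflexive i+m) (ℕₚ.m≤m+n p (p ℕ.+ p)))
            (ℕₚ.≤-trans (ℕₚ.m≤m+n (e ℕ.∸ t) (dbl t)) (ℕₚ.≤-trans (ℕₚ.≤-reflexive i+m) (ℕₚ.m≤m+n p (p ℕ.+ p))))
            (subst (λ w → ∣ chebU h w ∣ ≤ η) (sym i+m) U≤η))
      where
      i+m : e ℕ.∸ t ℕ.+ dbl t ≡ p
      i+m = trans (sym (ℕₚ.+-assoc (e ℕ.∸ t) t t))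
          (trans (cong (ℕ._+ t) (ℕₚ.m∸n+n≡m t≤e)) (trans (ℕₚ.+-comm e t) te))
      eq : e ℕ.∸ t ℕ.+ (e ℕ.∸ t ℕ.+ dbl t) ≡ dbl e
      eq = trans (lem (e ℕ.∸ t) t) (cong dbl (ℕₚ.m∸n+n≡m t≤e))
        where lem : ∀ a b → a ℕ.+ (a ℕ.+ (b ℕ.+ b)) ≡ a ℕ.+ b ℕ.+ (a ℕ.+ b)
              lem = solveℕ
    ... | inj₂ e≤t = subst (_≤ _) (∣sub-sym∣ (T (dbl t)) (T (dbl e)))
        (subst (λ w → ∣ T w - T (dbl e) ∣ ≤ 2ℚ * (ι (p ℕ.+ (p ℕ.+ p)) * η)) eq
          (chebT-mirror′ h ∣h∣≤1 (t ℕ.∸ e) (dbl e) (p ℕ.+ (p ℕ.+ p))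
              (ℕₚ.≤-trans (ℕₚ.≤-reflexive i+m) (ℕₚ.m≤m+n p (p ℕ.+ p)))
            (ℕₚ.≤-trans (ℕₚ.m≤m+n (t ℕ.∸ e) (dbl e)) (ℕₚ.≤-trans (ℕₚ.≤-reflexive i+m) (ℕₚ.m≤m+n p (p ℕ.+ p))))
            (subst (λ w → ∣ chebU h w ∣ ≤ η) (sym i+m) U≤η)))
      where
      i+m : t ℕ.∸ e ℕ.+ dbl e ≡ p
      i+m = trans (sym (ℕₚ.+-assoc (t ℕ.∸ e) e e)) (trans (cong (ℕ._+ e) (ℕₚ.m∸n+n≡m e≤t)) te)
      eq : t ℕ.∸ e ℕ.+ (t ℕ.∸ e ℕ.+ dbl e) ≡ dbl t
      eq = trans (lem (t ℕ.∸ e) e) (cong dbl (ℕₚ.m∸n+n≡m e≤t))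
        where lem : ∀ a b → a ℕ.+ (a ℕ.+ (b ℕ.+ b)) ≡ a ℕ.+ b ℕ.+ (a ℕ.+ b)
              lem = solveℕ

  evenSum-∑ : ∀ h n → ∑ (allFin n) (λ i → 2ℚ * chebT h (toℕ i ℕ.+ toℕ i)) ≡ evenSum h n
  evenSum-∑ h zero    = refl
  evenSum-∑ h (suc n) = trans (∑-allFin-last n (λ y → 2ℚ * chebT h (y ℕ.+ y)))
      (cong (_+ 2ℚ * chebT h (n ℕ.+ n)) (evenSum-∑ h n))

  module _ (q : ℕ) where
    private
      p : ℕ
      p = suc q
    open Modular p

    -- Two residues sum to less than 2p, so there is at most one carry.
    residue-+ : ∀ m n → let x = m ℤ.%ℕ p ℕ.+ n ℤ.%ℕ p ; s = (m ℤ.+ n) ℤ.%ℕ p in x ≡ s ⊎ x ≡ s ℕ.+ p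
    residue-+ m n with m ℤ.%ℕ p ℕ.+ n ℤ.%ℕ p ℕₚ.<? p
    ... | yes x<p = inj₁ (sym (%ℕ-unique x<p (≈-trans (≡⇒≈ (ℤₚ.pos-+ (m ℤ.%ℕ p) (n ℤ.%ℕ p)))
        (+-cong (%ℕ-≈ m) (%ℕ-≈ n)))))
    ... | no x≮p = inj₂ (trans (sym (ℕₚ.m∸n+n≡m p≤x)) (cong (ℕ._+ p) (sym (%ℕ-unique small
            (≈-trans (≈-trans (≡⇒≈ (sym (ℤₚ.⊖-≥ p≤x))) (≈-trans (≡⇒≈ (sym (ℤₚ.m-n≡m⊖n x p))) -p))
                (≈-trans (≡⇒≈ (ℤₚ.pos-+ (m ℤ.%ℕ p) (n ℤ.%ℕ p))) (+-cong (%ℕ-≈ m) (%ℕ-≈ n))))))))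
      where
      x = m ℤ.%ℕ p ℕ.+ n ℤ.%ℕ p
      p≤x = ℕₚ.≮⇒≥ x≮p
      small : x ℕ.∸ p ℕ.< p
      small = ℕₚ.+-cancelʳ-< p _ _ (subst (ℕ._< p ℕ.+ p) (sym (ℕₚ.m∸n+n≡m p≤x))
          (ℕₚ.+-mono-< (n%ℕd<d m p) (n%ℕd<d n p)))
      -p : ℤ.+ x ℤ.- ℤ.+ p ≈ ℤ.+ x
      -p = by∣ (divides ℤ.-1ℤ (lem (ℤ.+ x) (ℤ.+ p)))
        where
        lem : ∀ x p → x ℤ.- p ℤ.- x ≡ ℤ.-1ℤ ℤ.* p
        lem = solveℤ

    -- The second case, m having the smaller residue, is the one that calls for `chebT-flip`.
    residue-- : ∀ m n → let e = ℕ.∣ m ℤ.%ℕ p - n ℤ.%ℕ p ∣ ; t = (m ℤ.- n) ℤ.%ℕ p in e ≡ t ⊎ t ℕ.+ e ≡ p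
    residue-- m n with ℕₚ.≤-<-connex (n ℤ.%ℕ p) (m ℤ.%ℕ p)
    ... | inj₁ z≤y = inj₁ (trans (ℕₚ.m≤n⇒∣n-m∣≡n∸m z≤y)
        (sym (%ℕ-unique (ℕₚ.≤-<-trans (ℕₚ.m∸n≤m (m ℤ.%ℕ p) (n ℤ.%ℕ p)) (n%ℕd<d m p))
          (≈-trans (≡⇒≈ (trans (sym (ℤₚ.⊖-≥ z≤y)) (sym (ℤₚ.m-n≡m⊖n (m ℤ.%ℕ p) (n ℤ.%ℕ p)))))
              (+-cong (%ℕ-≈ m) (-‿cong (%ℕ-≈ n)))))))
    ... | inj₂ y<z = inj₂ (trans (cong₂ ℕ._+_ t≡ (ℕₚ.m≤n⇒∣m-n∣≡n∸m (ℕₚ.<⇒≤ y<z))) (ℕₚ.m∸n+n≡m (ℕₚ.<⇒≤ e<p)))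
      where
      y z e : ℕ
      y = m ℤ.%ℕ p
      z = n ℤ.%ℕ p
      e = z ℕ.∸ y
      e<p : e ℕ.< p
      e<p = ℕₚ.≤-<-trans (ℕₚ.m∸n≤m z y) (n%ℕd<d n p)
      0<e : 0 ℕ.< e
      0<e = ℕₚ.m<n⇒0<n∸m y<z
      lem : ∀ p y z → p ℤ.- (z ℤ.- y) ℤ.- (y ℤ.- z) ≡ ℤ.1ℤ ℤ.* p
      lem = solveℤ
      cast : ℤ.+ (p ℕ.∸ e) ≡ ℤ.+ p ℤ.- (ℤ.+ z ℤ.- ℤ.+ y)
      cast = trans (trans (sym (ℤₚ.⊖-≥ (ℕₚ.<⇒≤ e<p))) (sym (ℤₚ.m-n≡m⊖n p e)))
        (cong (λ w → ℤ.+ p ℤ.- w) (trans (sym (ℤₚ.⊖-≥ (ℕₚ.<⇒≤ y<z))) (sym (ℤₚ.m-n≡m⊖n z y))))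
      t≡ : (m ℤ.- n) ℤ.%ℕ p ≡ p ℕ.∸ e
      t≡ = %ℕ-unique (ℕₚ.∸-monoʳ-< 0<e (ℕₚ.<⇒≤ e<p))
        (≈-trans (≡⇒≈ cast) (≈-trans (by∣ (divides ℤ.1ℤ (lem (ℤ.+ p) (ℤ.+ y) (ℤ.+ z))))
            (+-cong (%ℕ-≈ m) (-‿cong (%ℕ-≈ n)))))

    module Construction (h : ℚ) (∣h∣≤1 : ∣ h ∣ ≤ 1ℚ) {η} (U≤η : ∣ chebU h p ∣ ≤ η)
                        (η-small : 2ℚ * ((1ℚ + ι p) * η) ≤ 1ℚ) where
      T : ℕ → ℚ
      T = chebT h

      instance
        ιp-pos : Positive (ι p)
        ιp-pos = positive (0<ι q)
        ιp≢0 : NonZero (ι p)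
        ιp≢0 = pos⇒nonZero (ι p)

      -- The mean of 2T(2i) over the residues. Subtracting it makes the mean of `C` exactly zero, at
      -- a small cost, since `evenSum h p` has the factor `chebU h p`.
      μ : ℚ
      μ = 1/ ι p * evenSum h p

      ιp*μ : ι p * μ ≡ evenSum h p
      ιp*μ = trans (sym (*-assoc (ι p) (1/ ι p) (evenSum h p)))
          (trans (cong (_* evenSum h p) (*-inverseʳ (ι p))) (*-identityˡ _))

      ∣μ∣≤ : ∣ μ ∣ ≤ 2ℚ * ((1ℚ + ι p) * η)
      ∣μ∣≤ = ≤-trans (≤-trans (≤-reflexive (sym (*-identityˡ ∣ μ ∣))) (*-mono-≤ʳ ∣ μ ∣ (0≤∣p∣ μ) (1≤ι q)))
        (≤-trans (≤-reflexive (trans (cong (_* ∣ μ ∣) (sym (0≤p⇒∣p∣≡p (0≤ι p))))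
            (trans (sym (∣p*q∣≡∣p∣*∣q∣ (ι p) μ)) (cong ∣_∣ ιp*μ))))
          (evenSum-bound h ∣h∣≤1 p U≤η))

      ∣μ∣≤1 : ∣ μ ∣ ≤ 1ℚ
      ∣μ∣≤1 = ≤-trans ∣μ∣≤ η-small

      T2 : ℕ → ℚ
      T2 y = 2ℚ * T (y ℕ.+ y)

      ∣T2∣≤2 : ∀ y → ∣ T2 y ∣ ≤ 2ℚ
      ∣T2∣≤2 y = ∣*∣≤ {2ℚ} {T (y ℕ.+ y)} {2ℚ} {1ℚ} ≤-refl (chebT-bound h ∣h∣≤1 (y ℕ.+ y))

      C : ℤ → ℚ
      C n = T2 (n ℤ.%ℕ p) - μ

      C-periodic : ∀ {m n} → m ≈ n → C m ≡ C n
      C-periodic {m} {n} m≈n = cong (λ r → T2 r - μ)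
          (residue-unique (n%ℕd<d m p) (n%ℕd<d n p) (≈-trans (%ℕ-≈ m) (≈-trans m≈n (≈-sym (%ℕ-≈ n)))))

      C-bounded : ∀ n → ∣ C n ∣ ≤ 3ℚ
      C-bounded n = ∣-∣≤ {T2 (n ℤ.%ℕ p)} {μ} {2ℚ} {1ℚ} (∣T2∣≤2 (n ℤ.%ℕ p)) ∣μ∣≤1

      1≤C0 : 1ℚ ≤ C ℤ.0ℤ
      1≤C0 = ≤-by (1ℚ - μ) (0≤-‿ (≤-trans (a≤∣a∣ μ) ∣μ∣≤1)) (lem μ)
        where lem : ∀ μ → (1ℚ + 1ℚ) * 1ℚ - μ ≡ 1ℚ + (1ℚ - μ)
              lem = solve-∀ ℚ-ring

      C-mean-zero : ∑ (allFin p) (λ i → C (ℤ.+ toℕ i)) ≡ 0ℚ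
      C-mean-zero = begin
        ∑ (allFin p) (λ i → C (ℤ.+ toℕ i))
          ≡⟨ ∑-cong (allFin p) (λ i → cong (λ r → T2 r - μ) (%ℕ-unique (Finₚ.toℕ<n i) (≡⇒≈ refl))) ⟩
        ∑ (allFin p) (λ i → T2 (toℕ i) + - μ)
          ≡⟨ ∑-+ (allFin p) (λ i → T2 (toℕ i)) (λ _ → - μ) ⟩
        ∑ (allFin p) (λ i → T2 (toℕ i)) + ∑ (allFin p) (λ _ → - μ)
          ≡⟨ cong₂ _+_ (evenSum-∑ h p) (trans (∑-const (allFin p) (- μ)) (cong (_* - μ) (length-allFin p))) ⟩
        evenSum h p + ι p * - μ
          ≡⟨ cong (evenSum h p +_) (trans (sym (neg-distribʳ-* (ι p) μ)) (cong -_ ιp*μ)) ⟩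
        evenSum h p - evenSum h p
          ≡⟨ +-inverseʳ (evenSum h p) ⟩
        0ℚ ∎
        where open ≡-Reasoning

      E : ℚ
      E = 2ℚ * (ι (p ℕ.+ (p ℕ.+ p)) * η)

      T2-wrap : ∀ m n → ∣ T2 (m ℤ.%ℕ p ℕ.+ n ℤ.%ℕ p) - T2 ((m ℤ.+ n) ℤ.%ℕ p) ∣ ≤ 2ℚ * E
      T2-wrap m n = subst (λ w → ∣ w ∣ ≤ 2ℚ * E) (lem (T (x ℕ.+ x)) (T (s ℕ.+ s)))
        (∣*∣≤ {2ℚ} {T (x ℕ.+ x) - T (s ℕ.+ s)} ≤-refl
          (chebT-wrap h ∣h∣≤1 {p} U≤η (ℕₚ.+-mono-< (n%ℕd<d m p) (n%ℕd<d n p)) (n%ℕd<d (m ℤ.+ n) p) (residue-+ m n)))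
        where
        x s : ℕ
        x = m ℤ.%ℕ p ℕ.+ n ℤ.%ℕ p
        s = (m ℤ.+ n) ℤ.%ℕ p
        lem : ∀ a b → (1ℚ + 1ℚ) * (a - b) ≡ (1ℚ + 1ℚ) * a - (1ℚ + 1ℚ) * b
        lem = solve-∀ ℚ-ring

      T2-flip : ∀ m n → ∣ T2 ℕ.∣ m ℤ.%ℕ p - n ℤ.%ℕ p ∣ - T2 ((m ℤ.- n) ℤ.%ℕ p) ∣ ≤ 2ℚ * E
      T2-flip m n = subst (λ w → ∣ w ∣ ≤ 2ℚ * E) (lem (T (e ℕ.+ e)) (T (t ℕ.+ t)))
        (∣*∣≤ {2ℚ} {T (e ℕ.+ e) - T (t ℕ.+ t)} ≤-refl (bound (residue-- m n)))
        where
        e t : ℕ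
        e = ℕ.∣ m ℤ.%ℕ p - n ℤ.%ℕ p ∣
        t = (m ℤ.- n) ℤ.%ℕ p
        lem : ∀ a b → (1ℚ + 1ℚ) * (a - b) ≡ (1ℚ + 1ℚ) * a - (1ℚ + 1ℚ) * b
        lem = solve-∀ ℚ-ring
        bound : e ≡ t ⊎ t ℕ.+ e ≡ p → ∣ T (e ℕ.+ e) - T (t ℕ.+ t) ∣ ≤ E
        bound (inj₁ e≡t) = chebT-wrap h ∣h∣≤1 {p} U≤η
            (subst (ℕ._< p ℕ.+ p) (sym e≡t) (ℕₚ.<-≤-trans t<p (ℕₚ.m≤m+n p p))) t<p (inj₁ e≡t)
          where t<p = n%ℕd<d (m ℤ.- n) p
        bound (inj₂ te) = chebT-flip h ∣h∣≤1 U≤η {t} {e} te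

      -- Two reduction errors, for m + n and m - n, and the contribution of `μ`: its size times 1 +
      -- (2 + 2) + 2, a bound for μ - (Y + Z) + 2 with Y, Z the two values of `T2`.
      K : ℚ
      K = (2ℚ * E + 2ℚ * E) + 2ℚ * ((1ℚ + ι p) * η) * (1ℚ + (2ℚ + 2ℚ) + 2ℚ)

      C-product : ∀ m n → ∣ C m * C n - (C (m ℤ.+ n) + C (m ℤ.- n)) ∣ ≤ K
      C-product m n = subst (λ w → ∣ w ∣ ≤ K) (sym expand)
        (∣+∣≤ (∣+∣≤ (T2-wrap m n) (T2-flip m n))
              (∣*∣≤ {μ} ∣μ∣≤ (∣+∣≤ (∣-∣≤ {μ} ∣μ∣≤1 (∣+∣≤ (∣T2∣≤2 y) (∣T2∣≤2 z))) (≤-refl {∣ 2ℚ ∣}))))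
        where
        y z x e s t : ℕ
        y = m ℤ.%ℕ p
        z = n ℤ.%ℕ p
        x = y ℕ.+ z
        e = ℕ.∣ y - z ∣
        s = (m ℤ.+ n) ℤ.%ℕ p
        t = (m ℤ.- n) ℤ.%ℕ p
        T2-product : T2 y * T2 z ≡ T2 x + T2 e
        T2-product = trans (lem₁ (T (y ℕ.+ y)) (T (z ℕ.+ z)))
            (trans (cong (2ℚ *_) (chebT-product h y z)) (*-distribˡ-+ 2ℚ (T (x ℕ.+ x)) (T (e ℕ.+ e))))
          where lem₁ : ∀ a b → ((1ℚ + 1ℚ) * a) * ((1ℚ + 1ℚ) * b) ≡ (1ℚ + 1ℚ) * ((1ℚ + 1ℚ) * (a * b))
                lem₁ = solve-∀ ℚ-ring
        lem : ∀ Y Z S D X E μ → (Y - μ) * (Z - μ) - ((S - μ) + (D - μ))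
              ≡ (X - S + (E - D)) + μ * (μ - (Y + Z) + (1ℚ + 1ℚ)) + (Y * Z - (X + E))
        lem = solve-∀ ℚ-ring
        expand : C m * C n - (C (m ℤ.+ n) + C (m ℤ.- n)) ≡ (T2 x - T2 s + (T2 e - T2 t)) + μ *
            (μ - (T2 y + T2 z) + 2ℚ)
        expand = trans (lem (T2 y) (T2 z) (T2 s) (T2 t) (T2 x) (T2 e) μ)
          (trans (cong (λ w → (T2 x - T2 s + (T2 e - T2 t)) + μ * (μ - (T2 y + T2 z) + 2ℚ) +
              (w - (T2 x + T2 e))) T2-product)
          (trans (cong ((T2 x - T2 s + (T2 e - T2 t)) + μ * (μ - (T2 y + T2 z) + 2ℚ) +_)
              (+-inverseʳ (T2 x + T2 e))) (+-identityʳ _)))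

    approxCos-fromRoot : ∀ {ε η} → 2ℚ * (1ℚ + ι p) * η ≤ 1ℚ →
      (2ℚ * (2ℚ * ι (p ℕ.+ (p ℕ.+ p))) + 2ℚ * (2ℚ * ι (p ℕ.+ (p ℕ.+ p))) + 2ℚ * (1ℚ + ι p) *
          (1ℚ + (2ℚ + 2ℚ) + 2ℚ)) * η ≤ ε →
      ∃[ h ] (∣ h ∣ ≤ 1ℚ × ∣ chebU h p ∣ ≤ η) → ApproxCos p ε
    approxCos-fromRoot {ε} {η} aη≤1 bη≤ε (h , ∣h∣≤1 , U≤η) = record
      { C = C ; periodic = C-periodic ; bounded = C-bounded ; 1≤C0 = 1≤C0 ; mean-zero = C-mean-zero
      ; product = λ m n → ≤-trans (C-product m n) (≤-trans
          (≤-reflexive (lem (ι (p ℕ.+ (p ℕ.+ p))) η (1ℚ + ι p) (1ℚ + (2ℚ + 2ℚ) + 2ℚ))) bη≤ε) }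
      where
      open Construction h ∣h∣≤1 U≤η (subst (_≤ 1ℚ) (*-assoc 2ℚ (1ℚ + ι p) η) aη≤1)
      lem : ∀ x η a c → (1ℚ + 1ℚ) * ((1ℚ + 1ℚ) * (x * η)) + (1ℚ + 1ℚ) * ((1ℚ + 1ℚ) * (x * η)) + (1ℚ + 1ℚ) *
          (a * η) * c
          ≡ ((1ℚ + 1ℚ) * ((1ℚ + 1ℚ) * x) + (1ℚ + 1ℚ) * ((1ℚ + 1ℚ) * x) + (1ℚ + 1ℚ) * a * c) * η
      lem = solve-∀ ℚ-ring

  -- Both smallness conditions on η are linear, so the exponents that settle them separately are
  -- simply added.
  approxCos : ∀ p .{{_ : ℕ.NonZero p}} → 2 ℕ.≤ p → ∀ {ε} → 0ℚ < ε → ApproxCos p ε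
  approxCos p@(suc q) 2≤p {ε} 0<ε = approxCos-fromRoot q
      (small a 1ℚ m n (proj₂ sm) (0≤* {2ℚ} (nonNegative⁻¹ 2ℚ) 0≤1+ιp))
      (≤-trans (≤-reflexive (cong (λ k → b * halfPow k) (ℕₚ.+-comm m n))) (small b ε n m (proj₂ sn) 0≤b))
          (approximateRoot p 2≤p (0<halfPow (m ℕ.+ n)))
    where
    a b : ℚ
    a = 2ℚ * (1ℚ + ι p)
    b = 2ℚ * (2ℚ * ι (p ℕ.+ (p ℕ.+ p))) + 2ℚ * (2ℚ * ι (p ℕ.+ (p ℕ.+ p))) + 2ℚ * (1ℚ + ι p) * (1ℚ + (2ℚ + 2ℚ) + 2ℚ)
    sm = halfPow-small a {1ℚ} (positive⁻¹ 1ℚ)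
    sn = halfPow-small b {ε} 0<ε
    m n : ℕ
    m = proj₁ sm
    n = proj₁ sn
    0≤1+ιp : 0ℚ ≤ 1ℚ + ι p
    0≤1+ιp = 0≤+ 0≤1 (0≤ι p)
    0≤b : 0ℚ ≤ b
    0≤b = 0≤+ (0≤+ 0≤4x 0≤4x) (0≤* {2ℚ * (1ℚ + ι p)} {1ℚ + (2ℚ + 2ℚ) + 2ℚ} (0≤* {2ℚ} (nonNegative⁻¹ 2ℚ) 0≤1+ιp)
        (nonNegative⁻¹ _))
      where 0≤4x = 0≤* {2ℚ} (nonNegative⁻¹ 2ℚ) (0≤* {2ℚ} (nonNegative⁻¹ 2ℚ) (0≤ι (p ℕ.+ (p ℕ.+ p))))
    small : ∀ c δ i j → c * halfPow i ≤ δ → 0ℚ ≤ c → c * halfPow (i ℕ.+ j) ≤ δ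
    small c δ i j le 0≤c = ≤-trans (*-mono-≤ˡ c 0≤c (halfPow-anti i j)) le

-- Expanding a product of cosine sums into single cosines.

module CharacterExpansion where
  open import Defs
  open RationalBounds
  open FiniteSums
  open ModularArithmetic
  open ApproximateCosine
  open import Data.Rational
  open import Data.Rational.Properties hiding (-‿cong)

  private variable
    A : Set

  ∑-allFuns : ∀ n (xs : List A) (G : (Fin (suc n) → A) → ℚ) →
              ∑ (allFuns (suc n) xs) G ≡ ∑ xs (λ a → ∑ (allFuns n xs) (λ g → G (a ∷ᵛ g)))
  ∑-allFuns n xs G = trans (∑-concatMap (λ a → map (λ g → a ∷ᵛ g) (allFuns n xs)) xs G)
    (∑-cong xs (λ a → ∑-map (λ g → a ∷ᵛ g) (allFuns n xs) G))

  -- allFuns only lists functions up to pointwise equality, so invariance is stated for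
  -- summands that respect a relation on the values.
  ∑-allFuns-invariant : (R : A → A → Set) → (∀ {a} → R a a) → (xs : List A) → ∀ n (τ : Fin n → A → A) →
    (∀ l (H : A → ℚ) → (∀ {a b} → R a b → H a ≡ H b) → ∑ xs H ≡ ∑ xs (λ a → H (τ l a))) →
    (G : (Fin n → A) → ℚ) → (∀ {x y} → (∀ l → R (x l) (y l)) → G x ≡ G y) →
    ∑ (allFuns n xs) G ≡ ∑ (allFuns n xs) (λ x → G (λ l → τ l (x l)))
  ∑-allFuns-invariant R R-refl xs zero    τ inv G resp = cong (_+ 0ℚ) (resp (λ ()))
  ∑-allFuns-invariant R R-refl xs (suc n) τ inv G resp = begin
    ∑ (allFuns (suc n) xs) G
      ≡⟨ ∑-allFuns n xs G ⟩
    ∑ xs (λ a → ∑ (allFuns n xs) (λ g → G (a ∷ᵛ g)))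
      ≡⟨ ∑-cong xs (λ a → ∑-allFuns-invariant R R-refl xs n (λ l → τ (Fin.suc l)) (λ l → inv (Fin.suc l))
          (λ g → G (a ∷ᵛ g))
           (λ e → resp λ { Fin.zero → R-refl ; (Fin.suc l) → e l })) ⟩
    ∑ xs (λ a → ∑ (allFuns n xs) (λ g → G (a ∷ᵛ (λ l → τ (Fin.suc l) (g l)))))
      ≡⟨ inv Fin.zero _ (λ r → ∑-cong (allFuns n xs) (λ g → resp λ { Fin.zero → r ; (Fin.suc l) → R-refl })) ⟩
    ∑ xs (λ a → ∑ (allFuns n xs) (λ g → G (τ Fin.zero a ∷ᵛ (λ l → τ (Fin.suc l) (g l)))))
      ≡⟨ ∑-cong xs (λ a → ∑-cong (allFuns n xs) (λ g → resp λ { Fin.zero → R-refl ; (Fin.suc l) → R-refl })) ⟩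
    ∑ xs (λ a → ∑ (allFuns n xs) (λ g → G (λ l → τ l ((a ∷ᵛ g) l))))
      ≡⟨ sym (∑-allFuns n xs (λ x → G (λ l → τ l (x l)))) ⟩
    ∑ (allFuns (suc n) xs) (λ x → G (λ l → τ l (x l))) ∎
    where open ≡-Reasoning

  Σℤ : ∀ n → (Fin n → ℤ) → ℤ
  Σℤ zero    F = 0ℤ
  Σℤ (suc n) F = F Fin.zero ℤ.+ Σℤ n (λ i → F (Fin.suc i))

  Σℤ-cong : ∀ n {F G : Fin n → ℤ} → (∀ i → F i ≡ G i) → Σℤ n F ≡ Σℤ n G
  Σℤ-cong zero    e = refl
  Σℤ-cong (suc n) e = cong₂ ℤ._+_ (e Fin.zero) (Σℤ-cong n (λ i → e (Fin.suc i)))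

  Σℤ-+ : ∀ n (F G : Fin n → ℤ) → Σℤ n (λ i → F i ℤ.+ G i) ≡ Σℤ n F ℤ.+ Σℤ n G
  Σℤ-+ zero    F G = refl
  Σℤ-+ (suc n) F G = trans (cong (λ z → F Fin.zero ℤ.+ G Fin.zero ℤ.+ z)
      (Σℤ-+ n (λ i → F (Fin.suc i)) (λ i → G (Fin.suc i))))
    (lem (F Fin.zero) (G Fin.zero) _ _)
    where lem : ∀ a b c d → a ℤ.+ b ℤ.+ (c ℤ.+ d) ≡ a ℤ.+ c ℤ.+ (b ℤ.+ d)
          lem = solveℤ

  Σℤ-*ˡ : ∀ n c (F : Fin n → ℤ) → Σℤ n (λ i → c ℤ.* F i) ≡ c ℤ.* Σℤ n F
  Σℤ-*ˡ zero    c F = sym (ℤₚ.*-zeroʳ c)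
  Σℤ-*ˡ (suc n) c F = trans (cong (λ z → c ℤ.* F Fin.zero ℤ.+ z) (Σℤ-*ˡ n c (λ i → F (Fin.suc i))))
    (sym (ℤₚ.*-distribˡ-+ c (F Fin.zero) _))

  Σℤ-zero : ∀ n {F : Fin n → ℤ} → (∀ i → F i ≡ 0ℤ) → Σℤ n F ≡ 0ℤ
  Σℤ-zero zero    e = refl
  Σℤ-zero (suc n) e = trans (cong₂ ℤ._+_ (e Fin.zero) (Σℤ-zero n (λ i → e (Fin.suc i)))) refl

  Σℤ-swap : ∀ m n (F : Fin m → Fin n → ℤ) → Σℤ m (λ i → Σℤ n (F i)) ≡ Σℤ n (λ j → Σℤ m (λ i → F i j))
  Σℤ-swap zero    n F = sym (Σℤ-zero n (λ _ → refl))
  Σℤ-swap (suc m) n F = trans (cong (λ z → Σℤ n (F Fin.zero) ℤ.+ z) (Σℤ-swap m n (λ i → F (Fin.suc i))))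
    (sym (Σℤ-+ n (F Fin.zero) (λ j → Σℤ m (λ i → F (Fin.suc i) j))))

  δ : ∀ {n} → Fin n → Fin n → ℤ
  δ i j = if does (i Fin.≟ j) then 1ℤ else 0ℤ

  δ-refl : ∀ {n} (i : Fin n) → δ i i ≡ 1ℤ
  δ-refl i with i Fin.≟ i
  ... | yes _ = refl
  ... | no ne = contradiction refl ne

  δ-≢ : ∀ {n} {i j : Fin n} → i ≢ j → δ i j ≡ 0ℤ
  δ-≢ {i = i} {j} ne with i Fin.≟ j
  ... | yes e = contradiction e ne
  ... | no _  = refl

  Σℤ-single : ∀ n (a : Fin n) (F : Fin n → ℤ) → (∀ i → i ≢ a → F i ≡ 0ℤ) → Σℤ n F ≡ F a
  Σℤ-single (suc n) Fin.zero    F e = trans (cong (λ z → F Fin.zero ℤ.+ z)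
      (Σℤ-zero n (λ i → e (Fin.suc i) λ ()))) (ℤₚ.+-identityʳ _)
  Σℤ-single (suc n) (Fin.suc a) F e = trans (cong₂ ℤ._+_ (e Fin.zero λ ())
    (Σℤ-single n a (λ i → F (Fin.suc i)) (λ i ne → e (Fin.suc i) (λ eq → ne (Finₚ.suc-injective eq)))))
        (ℤₚ.+-identityˡ _)

  Σℤ-δ : ∀ n (a : Fin n) (F : Fin n → ℤ) → Σℤ n (λ i → F i ℤ.* δ i a) ≡ F a
  Σℤ-δ n a F = trans (Σℤ-single n a (λ i → F i ℤ.* δ i a)
      (λ i ne → trans (cong (F i ℤ.*_) (δ-≢ ne)) (ℤₚ.*-zeroʳ (F i))))
    (trans (cong (F a ℤ.*_) (δ-refl a)) (ℤₚ.*-identityʳ (F a)))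

  product : ∀ n → (Fin n → ℚ) → ℚ
  product n φ = foldr (λ l r → φ l * r) 1ℚ (allFin n)

  product-suc : ∀ n (φ : Fin (suc n) → ℚ) → product (suc n) φ ≡ φ Fin.zero * product n (λ l → φ (Fin.suc l))
  product-suc n φ = foldr-allFin n (λ l r → φ l * r) 1ℚ

  power : ℚ → ℕ → ℚ
  power c zero    = 1ℚ
  power c (suc n) = c * power c n

  product-bound : ∀ n {φ : Fin n → ℚ} {c} → (∀ l → ∣ φ l ∣ ≤ c) → ∣ product n φ ∣ ≤ power c n
  product-bound zero    e = ≤-refl
  product-bound (suc n) {φ} {c} e = subst (λ z → ∣ z ∣ ≤ power c (suc n)) (sym (product-suc n φ))
    (∣*∣≤ {φ Fin.zero} (e Fin.zero) (product-bound n (λ l → e (Fin.suc l))))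

  product-scale : ∀ n c (φ : Fin n → ℚ) → product n (λ l → c * φ l) ≡ power c n * product n φ
  product-scale zero    c φ = refl
  product-scale (suc n) c φ = trans (product-suc n (λ l → c * φ l))
    (trans (cong (c * φ Fin.zero *_) (product-scale n c (λ l → φ (Fin.suc l))))
    (trans (lem c (φ Fin.zero) (power c n) _) (cong (c * power c n *_) (sym (product-suc n φ)))))
    where lem : ∀ c a p q → c * a * (p * q) ≡ c * p * (a * q)
          lem = solve-∀ ℚ-ring

  sgn : Bool → ℤ
  sgn true  = 1ℤ
  sgn false = -1ℤ

  signed : List A → List (Bool × A)
  signed L = map (true ,_) L ++ map (false ,_) L

  ∑-signed : (L : List A) (G : Bool × A → ℚ) → ∑ (signed L) G ≡ ∑ L (λ a → G (true , a) + G (false , a))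
  ∑-signed L G = trans (∑-++ (map (true ,_) L) (map (false ,_) L) G)
    (trans (cong₂ _+_ (∑-map (true ,_) L G) (∑-map (false ,_) L G))
        (sym (∑-+ L (λ a → G (true , a)) (λ a → G (false , a)))))

  -- With N summands per factor and n + 1 factors: each summand of the first factor pays ε against
  -- the remaining product, at most (3N)^n, and leaves two expansions of length n.
  expansionError : ℚ → ℕ → ℚ
  expansionError N zero    = 0ℚ
  expansionError N (suc n) = N * power (N * 3ℚ) n + N * (expansionError N n + expansionError N n)

  module _ (p : ℕ) .{{_ : ℕ.NonZero p}} (pr : Prime p) {ε : ℚ} (Cos : ApproxCos p ε) where
    open Modular p
    open ApproxCos Cos renaming (product to C-product)

    -- Iterating C(a)C(b) ≈ C(a+b) + C(a-b).
    expansion : (L : List A) → ∀ n (y : Fin n → A → ℤ) t →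
      ∣ C t * product n (λ l → ∑ L (λ a → C (y l a)))
        - ∑ (allFuns n (signed L)) (λ q → C (t ℤ.+ Σℤ n (λ l → sgn (proj₁ (q l)) ℤ.* y l (proj₂ (q l))))) ∣
      ≤ expansionError (ι (length L)) n * ε
    expansion L zero    y t = ≤-reflexive (trans (cong ∣_∣
        (trans (cong (λ z → C t * 1ℚ - (C z + 0ℚ)) (ℤₚ.+-identityʳ t)) (lem (C t)))) (sym (*-zeroˡ ε)))
      where lem : ∀ c → c * 1ℚ - (c + 0ℚ) ≡ 0ℚ
            lem = solve-∀ ℚ-ring
    expansion L (suc n) y t = subst₂ (λ u v → ∣ u ∣ ≤ v) (sym split) errors
        (∣+∣≤ (∑-abs L step-bound) (∑-abs L rest-bound))
      where
      N P : ℚ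
      N = ι (length L)
      P = product n (λ l → ∑ L (λ a → C (y (Fin.suc l) a)))
      R : ℤ → ℚ
      R t = ∑ (allFuns n (signed L)) (λ q → C (t ℤ.+ Σℤ n
          (λ l → sgn (proj₁ (q l)) ℤ.* y (Fin.suc l) (proj₂ (q l)))))
      -- `step` is the defect of the product formula for the first factor; `rest` is the inductive
      -- error at the two shifted phases t + y and t - y.
      step rest : _ → ℚ
      step a = (C t * C (y Fin.zero a) - (C (t ℤ.+ y Fin.zero a) + C (t ℤ.- y Fin.zero a))) * P
      rest a = (C (t ℤ.+ y Fin.zero a) * P - R (t ℤ.+ y Fin.zero a)) +
          (C (t ℤ.- y Fin.zero a) * P - R (t ℤ.- y Fin.zero a))
      ∣P∣≤ : ∣ P ∣ ≤ power (N * 3ℚ) n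
      ∣P∣≤ = product-bound n (λ l → ∑-abs L (λ a → bounded (y (Fin.suc l) a)))
      step-bound : ∀ a → ∣ step a ∣ ≤ ε * power (N * 3ℚ) n
      step-bound a = ∣*∣≤ {C t * C (y Fin.zero a) - (C (t ℤ.+ y Fin.zero a) + C (t ℤ.- y Fin.zero a))}
          (C-product t (y Fin.zero a)) ∣P∣≤
      rest-bound : ∀ a → ∣ rest a ∣ ≤ expansionError N n * ε + expansionError N n * ε
      rest-bound a = ∣+∣≤ (expansion L n (λ l → y (Fin.suc l)) (t ℤ.+ y Fin.zero a))
          (expansion L n (λ l → y (Fin.suc l)) (t ℤ.- y Fin.zero a))
      errors : N * (ε * power (N * 3ℚ) n) + N * (expansionError N n * ε + expansionError N n * ε) ≡
          expansionError N (suc n) * ε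
      errors = lem N ε (power (N * 3ℚ) n) (expansionError N n)
        where lem : ∀ N ε P e → N * (ε * P) + N * (e * ε + e * ε) ≡ (N * P + N * (e + e)) * ε
              lem = solve-∀ ℚ-ring
      regroup : ∑ (allFuns (suc n) (signed L)) (λ q → C
          (t ℤ.+ Σℤ (suc n) (λ l → sgn (proj₁ (q l)) ℤ.* y l (proj₂ (q l)))))
              ≡ ∑ L (λ a → R (t ℤ.+ y Fin.zero a) + R (t ℤ.- y Fin.zero a))
      regroup = trans (∑-allFuns n (signed L) _) (trans (∑-signed L _) (∑-cong L (λ a → cong₂ _+_
          (∑-cong (allFuns n (signed L)) (λ q → cong C (lem₊ t (y Fin.zero a) _)))
          (∑-cong (allFuns n (signed L)) (λ q → cong C (lem₋ t (y Fin.zero a) _))))))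
        where lem₊ : ∀ t y s → t ℤ.+ (1ℤ ℤ.* y ℤ.+ s) ≡ t ℤ.+ y ℤ.+ s
              lem₊ = solveℤ
              lem₋ : ∀ t y s → t ℤ.+ (-1ℤ ℤ.* y ℤ.+ s) ≡ t ℤ.- y ℤ.+ s
              lem₋ = solveℤ
      distribute : C t * product (suc n) (λ l → ∑ L (λ a → C (y l a))) ≡ ∑ L (λ a → C t * (C (y Fin.zero a) * P))
      distribute = trans (cong (C t *_) (trans (product-suc n (λ l → ∑ L (λ a → C (y l a))))
          (sym (∑-*ʳ L P (λ a → C (y Fin.zero a))))))
        (sym (∑-*ˡ L (C t) (λ a → C (y Fin.zero a) * P)))
      split : C t * product (suc n) (λ l → ∑ L (λ a → C (y l a)))
              - ∑ (allFuns (suc n) (signed L)) (λ q → C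
                  (t ℤ.+ Σℤ (suc n) (λ l → sgn (proj₁ (q l)) ℤ.* y l (proj₂ (q l)))))
              ≡ ∑ L step + ∑ L rest
      split = begin
        _ ≡⟨ cong₂ _-_ distribute regroup ⟩
        ∑ L full - ∑ L tail
          ≡⟨ cong (_- ∑ L tail) (∑-cong L (λ a → lem (C t) (C (y Fin.zero a)) P (C (t ℤ.+ y Fin.zero a))
              (C (t ℤ.- y Fin.zero a)) (R (t ℤ.+ y Fin.zero a)) (R (t ℤ.- y Fin.zero a)))) ⟩
        ∑ L (λ a → step a + rest a + tail a) - ∑ L tail
          ≡⟨ cong (_- ∑ L tail) (trans (∑-+ L (λ a → step a + rest a) tail)
              (cong (_+ ∑ L tail) (∑-+ L step rest))) ⟩
        ∑ L step + ∑ L rest + ∑ L tail - ∑ L tail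
          ≡⟨ lem₂ (∑ L step + ∑ L rest) (∑ L tail) ⟩
        ∑ L step + ∑ L rest ∎
        where
        open ≡-Reasoning
        full tail : _ → ℚ
        full a = C t * (C (y Fin.zero a) * P)
        tail a = R (t ℤ.+ y Fin.zero a) + R (t ℤ.- y Fin.zero a)
        lem : ∀ c d P a b r s → c * (d * P) ≡ (c * d - (a + b)) * P + ((a * P - r) + (b * P - s)) + (r + s)
        lem = solve-∀ ℚ-ring
        lem₂ : ∀ a b → a + b - b ≡ a
        lem₂ = solve-∀ ℚ-ring

    ∑-affine-zero : ∀ a t → t ≉0 → ∑ (allFin p) (λ i → C (a ℤ.+ t ℤ.* ℤ.+ toℕ i)) ≡ 0ℚ
    ∑-affine-zero a t t≉0 = trans (∑-affine pr C periodic a t t≉0) mean-zero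

    -- Summing over the one coordinate with nonzero coefficient already gives zero, whatever the
    -- other coordinates are.
    ∑-linear-zero : ∀ n (c : Fin n → ℤ) → ∃[ j ] c j ≉0 → ∀ a →
      ∑ (allFuns n (allFin p)) (λ r → C (a ℤ.+ Σℤ n (λ j → c j ℤ.* ℤ.+ toℕ (r j)))) ≡ 0ℚ
    ∑-linear-zero (suc n) c (Fin.suc j , cj) a = trans (∑-allFuns n (allFin p) _) (∑-zero (allFin p) (λ i →
      trans (∑-cong (allFuns n (allFin p)) (λ r → cong C (sym (ℤₚ.+-assoc a (c Fin.zero ℤ.* ℤ.+ toℕ i) _))))
        (∑-linear-zero n (λ l → c (Fin.suc l)) (j , cj) (a ℤ.+ c Fin.zero ℤ.* ℤ.+ toℕ i))))
    ∑-linear-zero (suc n) c (Fin.zero , c0) a = trans (∑-allFuns n (allFin p) _)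
        (trans (∑-swap (allFin p) (allFuns n (allFin p)) _)
      (∑-zero (allFuns n (allFin p)) (λ r → trans (∑-cong (allFin p)
          (λ i → cong C (lem a (c Fin.zero ℤ.* ℤ.+ toℕ i) _)))
        (∑-affine-zero (a ℤ.+ Σℤ n (λ l → c (Fin.suc l) ℤ.* ℤ.+ toℕ (r l))) (c Fin.zero) c0))))
      where lem : ∀ a b s → a ℤ.+ (b ℤ.+ s) ≡ a ℤ.+ s ℤ.+ b
            lem = solveℤ

-- Translation by solutions and cancellation over the solution set.

module SolutionSums where
  open import Defs
  open RationalBounds
  open FiniteSums
  open ModularArithmetic
  open ApproximateCosine
  open CharacterExpansion
  open import Data.Rational
  open import Data.Rational.Properties hiding (-‿cong)

  private variable
    A : Set

  ∑-cong-∈ : (xs : List A) {f g : A → ℚ} → (∀ x → x ∈ xs → f x ≡ g x) → ∑ xs f ≡ ∑ xs g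
  ∑-cong-∈ []       e = refl
  ∑-cong-∈ (x ∷ xs) e = cong₂ _+_ (e x (here refl)) (∑-cong-∈ xs (λ y m → e y (there m)))

  all-or-counterexample : {P : A → Set} → (∀ x → Dec (P x)) → (xs : List A) →
                          (∀ x → x ∈ xs → P x) ⊎ ∃[ x ] (x ∈ xs × ¬ P x)
  all-or-counterexample P? []       = inj₁ λ _ ()
  all-or-counterexample P? (x ∷ xs) with P? x | all-or-counterexample P? xs
  ... | no ¬px | _                   = inj₂ (x , here refl , ¬px)
  ... | yes px | inj₂ (y , m , ¬py)  = inj₂ (y , there m , ¬py)
  ... | yes px | inj₁ all            = inj₁ λ { _ (here refl) → px ; y (there m) → all y m }

  -- A given function is met only up to pointwise equality, so its listed representative has to be
  -- carried along.
  allFuns-complete : ∀ n {xs : List A} (f : Fin n → A) → (∀ i → f i ∈ xs) → ∃[ g ]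
      (g ∈ allFuns n xs × (∀ i → g i ≡ f i))
  allFuns-complete zero    f e = (λ ()) , here refl , λ ()
  allFuns-complete (suc n) {xs} f e with allFuns-complete n (λ i → f (Fin.suc i)) (λ i → e (Fin.suc i))
  ... | g , g∈ , g≡ = (f Fin.zero ∷ᵛ g) ,
      ∈-concatMap⁺ (λ a → map (λ g → a ∷ᵛ g) (allFuns n xs)) (Any.map (λ { refl → ∈-map⁺ (f Fin.zero ∷ᵛ_) g∈ }) (e Fin.zero)) ,
      λ { Fin.zero → refl ; (Fin.suc i) → g≡ i }

  ∈-filterᵇ⁻ : (P : A → Bool) (xs : List A) → ∀ {x} → x ∈ filterᵇ P xs → P x ≡ true
  ∈-filterᵇ⁻ P xs m = Equivalence.to T-≡ (proj₂ (∈-filter⁻ (λ x → T? (P x)) {xs = xs} m))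

  ∈-filterᵇ⁺ : (P : A → Bool) {xs : List A} → ∀ {x} → x ∈ xs → P x ≡ true → x ∈ filterᵇ P xs
  ∈-filterᵇ⁺ P m e = ∈-filter⁺ (λ x → T? (P x)) m (Equivalence.from T-≡ e)

  true-iff : ∀ {a b : Bool} → (a ≡ true → b ≡ true) → (b ≡ true → a ≡ true) → a ≡ b
  true-iff {true}  {b}     f g = sym (f refl)
  true-iff {false} {false} f g = refl
  true-iff {false} {true}  f g = g refl

  ∧⁻ : ∀ {a b} → a ∧ b ≡ true → a ≡ true × b ≡ true
  ∧⁻ {true} e = refl , e

  ∧⁺ : ∀ {a b} → a ≡ true → b ≡ true → a ∧ b ≡ true
  ∧⁺ refl refl = refl

  foldr-+-Σℤ : ∀ n (F : Fin n → ℕ) → ℤ.+ foldr (λ l s → F l ℕ.+ s) 0 (allFin n) ≡ Σℤ n (λ l → ℤ.+ F l)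
  foldr-+-Σℤ zero    F = refl
  foldr-+-Σℤ (suc n) F = trans (cong ℤ.+_ (foldr-allFin n (λ l s → F l ℕ.+ s) 0))
    (trans (ℤₚ.pos-+ (F Fin.zero) _) (cong (λ z → ℤ.+ F Fin.zero ℤ.+ z) (foldr-+-Σℤ n (λ l → F (Fin.suc l)))))

  module _ (p : ℕ) .{{_ : ℕ.NonZero p}} where
    open Modular p

    Σℤ-≈-linear : ∀ n {F F′ G : Fin n → ℤ} c → (∀ i → F′ i ≈ F i ℤ.+ c ℤ.* G i) → Σℤ n F′ ≈ Σℤ n F ℤ.+ c ℤ.* Σℤ n G
    Σℤ-≈-linear n {F} {F′} {G} c e = ≈-trans (Σℤ-≈ n e)
        (≡⇒≈ (trans (Σℤ-+ n F (λ i → c ℤ.* G i)) (cong (λ z → Σℤ n F ℤ.+ z) (Σℤ-*ˡ n c G))))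
      where
      Σℤ-≈ : ∀ n {F G : Fin n → ℤ} → (∀ i → F i ≈ G i) → Σℤ n F ≈ Σℤ n G
      Σℤ-≈ zero    e = ≡⇒≈ refl
      Σℤ-≈ (suc n) e = +-cong (e Fin.zero) (Σℤ-≈ n (λ i → e (Fin.suc i)))

    ≈-scale : ∀ w {x y v} c → y ≈ x ℤ.+ c ℤ.* v → w ℤ.* y ≈ w ℤ.* x ℤ.+ c ℤ.* (w ℤ.* v)
    ≈-scale w {x} {y} {v} c e = ≈-trans (*-congˡ w e) (≡⇒≈ (lem w x c v))
      where lem : ∀ w x c v → w ℤ.* (x ℤ.+ c ℤ.* v) ≡ w ℤ.* x ℤ.+ c ℤ.* (w ℤ.* v)
            lem = solveℤ

    lift : ∀ {n} → Points p n → Fin n → ℤ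
    lift v i = ℤ.+ toℕ (v i)

    module System {k : ℕ} (M : Matrix2 p k) where

      m : Fin 2 → Fin k → ℤ
      m i l = ℤ.+ toℕ (M i l)

      dot : Fin k → (Fin 2 → ℤ) → ℤ
      dot l v = Σℤ 2 (λ i → m i l ℤ.* v i)

      -- Stated for integer vectors modulo p, so that determinants and multiples can serve as
      -- solutions without reduction.
      Solution : (Fin k → Fin 2 → ℤ) → Set
      Solution V = ∀ i j → ℤ.+ p ∣ Σℤ k (λ l → m i l ℤ.* V l j)

      private
        total : (Fin k → Points p 2) → Fin 2 → Fin 2 → ℕ
        total x i j = foldr (λ l s → toℕ (M i l) ℕ.* toℕ (x l j) ℕ.+ s) 0 (allFin k)

        test : (Fin k → Points p 2) → Fin 2 → Fin 2 → Bool
        test x i j = (total x i j ℕ.% p) ℕ.≡ᵇ 0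

        test-Σ : ∀ (x : Fin k → Points p 2) (i j : Fin 2) → ℤ.+ total x i j ≡ Σℤ k (λ l → m i l ℤ.* lift (x l) j)
        test-Σ x i j = trans (foldr-+-Σℤ k (λ l → toℕ (M i l) ℕ.* toℕ (x l j)))
            (Σℤ-cong k (λ l → ℤₚ.pos-* (toℕ (M i l)) (toℕ (x l j))))

        test⁻ : ∀ x i j → test x i j ≡ true → ℤ.+ p ∣ Σℤ k (λ l → m i l ℤ.* lift (x l) j)
        test⁻ x i j e = subst (ℤ.+ p ∣_) (test-Σ x i j)
            (∣ᵤ⇒∣ {ℤ.+ p} {ℤ.+ total x i j} (ℕ∣.m%n≡0⇒n∣m (total x i j) p (ℕₚ.≡ᵇ⇒≡ _ 0 (Equivalence.from T-≡ e))))

        test⁺ : ∀ x i j → ℤ.+ p ∣ Σℤ k (λ l → m i l ℤ.* lift (x l) j) → test x i j ≡ true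
        test⁺ x i j d = Equivalence.to T-≡ (ℕₚ.≡⇒≡ᵇ _ 0
            (ℕ∣.n∣m⇒m%n≡0 (total x i j) p (∣⇒∣ᵤ (subst (ℤ.+ p ∣_) (sym (test-Σ x i j)) d))))

      isSol⁻ : ∀ x → isSol p M x ≡ true → Solution (λ l → lift (x l))
      isSol⁻ x e with ∧⁻ {test x Fin.zero Fin.zero} e
      ... | e₀₀ , e′ with ∧⁻ {test x Fin.zero (Fin.suc Fin.zero)} e′
      ... | e₀₁ , e″ with ∧⁻ {test x (Fin.suc Fin.zero) Fin.zero} e″
      ... | e₁₀ , e‴ with ∧⁻ {test x (Fin.suc Fin.zero) (Fin.suc Fin.zero)} e‴
      ... | e₁₁ , _ = λ
        { Fin.zero           Fin.zero           → test⁻ x _ _ e₀₀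
        ; Fin.zero           (Fin.suc Fin.zero) → test⁻ x _ _ e₀₁
        ; (Fin.suc Fin.zero) Fin.zero           → test⁻ x _ _ e₁₀
        ; (Fin.suc Fin.zero) (Fin.suc Fin.zero) → test⁻ x _ _ e₁₁ }

      isSol⁺ : ∀ x → Solution (λ l → lift (x l)) → isSol p M x ≡ true
      isSol⁺ x s = ∧⁺ (t Fin.zero Fin.zero) (∧⁺ (t Fin.zero (Fin.suc Fin.zero))
        (∧⁺ (t (Fin.suc Fin.zero) Fin.zero) (∧⁺ (t (Fin.suc Fin.zero) (Fin.suc Fin.zero)) refl)))
        where
        t : ∀ i j → test x i j ≡ true
        t i j = test⁺ x i j (s i j)

      Solution-translate : ∀ {X Y V} c → (∀ l j → Y l j ≈ X l j ℤ.+ c ℤ.* V l j) → Solution V → Solution X →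
          Solution Y
      Solution-translate {X} {Y} {V} c e sv sx i j = ∣-resp
        (Σℤ-≈-linear k {λ l → m i l ℤ.* X l j} {λ l → m i l ℤ.* Y l j} {λ l → m i l ℤ.* V l j} c
            (λ l → ≈-scale (m i l) c (e l j)))
        (∣m∣n⇒∣m+n (sx i j) (∣n⇒∣m*n c (sv i j)))

      isSol-translate : ∀ {x y V} c → (∀ l j → lift (y l) j ≈ lift (x l) j ℤ.+ c ℤ.* V l j) → Solution V → isSol
          p M y ≡ isSol p M x
      isSol-translate {x} {y} {V} c e sv = true-iff
        (λ h → isSol⁺ x (Solution-translate {Y = λ l → lift (x l)} (ℤ.- c) back sv (isSol⁻ y h)))
        (λ h → isSol⁺ y (Solution-translate {Y = λ l → lift (y l)} c e sv (isSol⁻ x h)))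
        where
        back : ∀ l j → lift (x l) j ≈ lift (y l) j ℤ.+ (ℤ.- c) ℤ.* V l j
        back l j = ≈-trans (≡⇒≈ (lem (lift (x l) j) c (V l j))) (+-cong (≈-sym (e l j)) (≡⇒≈ refl))
          where lem : ∀ x c v → x ≡ x ℤ.+ c ℤ.* v ℤ.+ (ℤ.- c) ℤ.* v
                lem = solveℤ

      isSol-cong : ∀ {x y : Fin k → Points p 2} → (∀ l j → x l j ≡ y l j) → isSol p M x ≡ isSol p M y
      isSol-cong {x} {y} e = isSol-translate {y} {x} {λ _ _ → 0ℤ} 0ℤ
        (λ l j → ≡⇒≈ (trans (cong (λ z → ℤ.+ toℕ z) (e l j)) (sym (ℤₚ.+-identityʳ _))))
        (λ i j → subst (ℤ.+ p ∣_) (sym (Σℤ-zero k (λ l → ℤₚ.*-zeroʳ (m i l)))) (divides 0ℤ refl))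

      -- An index of one term of the expansion: a sign and a column for every variable. The argument
      -- of that term at the point X is `phase q X`.
      Choice : Set
      Choice = Fin k → Bool × Fin k

      sign : Choice → Fin k → ℤ
      sign q l = sgn (proj₁ (q l))

      phase : Choice → (Fin k → Fin 2 → ℤ) → ℤ
      phase q X = Σℤ k (λ l → sign q l ℤ.* dot (proj₂ (q l)) (X l))

      phase-translate : ∀ q {X Y V} c → (∀ l j → Y l j ≈ X l j ℤ.+ c ℤ.* V l j) → phase q Y ≈ phase q X ℤ.+ c
          ℤ.* phase q V
      phase-translate q {X} {Y} {V} c e = Σℤ-≈-linear k {λ l → sign q l ℤ.* dot (proj₂ (q l)) (X l)} c
          (λ l → ≈-scale (sign q l) c
        (Σℤ-≈-linear 2 {λ i → m i (proj₂ (q l)) ℤ.* X l i} c (λ i → ≈-scale (m i (proj₂ (q l))) c (e l i))))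

      sols : List (Fin k → Points p 2)
      sols = sol p 2 M

      module _ (pr : Prime p) {ε : ℚ} (Cos : ApproxCos p ε) where
        open ApproxCos Cos

        shiftPoint : (Fin k → Fin 2 → ℤ) → Fin k → Points p 2 → Points p 2
        shiftPoint V l v j = rem (lift v j ℤ.+ V l j)

        rem-cong : ∀ {a b} → a ≈ b → rem a ≡ rem b
        rem-cong {a} {b} e = Fin-unique (≈-trans (rem-≈ a) (≈-trans e (≈-sym (rem-≈ b))))

        ∑-allFin-shift : ∀ t (H : Fin p → ℚ) → ∑ (allFin p) H ≡ ∑ (allFin p) (λ i → H (rem (ℤ.+ toℕ i ℤ.+ t)))
        ∑-allFin-shift t H = begin
          ∑ (allFin p) H
            ≡⟨ ∑-cong (allFin p) (λ i → cong H (sym (Fin-unique (rem-≈ (ℤ.+ toℕ i))))) ⟩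
          ∑ (allFin p) (λ i → H (rem (ℤ.+ toℕ i)))
            ≡⟨ sym (∑-affine pr (λ n → H (rem n)) (λ e → cong H (rem-cong e)) t 1ℤ (1≉0 pr)) ⟩
          ∑ (allFin p) (λ i → H (rem (t ℤ.+ 1ℤ ℤ.* ℤ.+ toℕ i)))
            ≡⟨ ∑-cong (allFin p) (λ i → cong (λ z → H (rem z)) (lem t (ℤ.+ toℕ i))) ⟩
          ∑ (allFin p) (λ i → H (rem (ℤ.+ toℕ i ℤ.+ t))) ∎
          where
          open ≡-Reasoning
          lem : ∀ t i → t ℤ.+ 1ℤ ℤ.* i ≡ i ℤ.+ t
          lem = solveℤ

        -- Invariance is used at two levels: coordinates within a point, then points within a tuple.
        ∑-shift : ∀ V (G : (Fin k → Points p 2) → ℚ) → (∀ {x y} → (∀ l j → x l j ≡ y l j) → G x ≡ G y) →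
                  ∑ (allFuns k (allPoints p 2)) G ≡ ∑ (allFuns k (allPoints p 2))
                      (λ x → G (λ l → shiftPoint V l (x l)))
        ∑-shift V = ∑-allFuns-invariant (λ v w → ∀ j → v j ≡ w j) (λ _ → refl) (allPoints p 2) k (shiftPoint V)
          (λ l → ∑-allFuns-invariant _≡_ refl (allFin p) 2 (λ j y → rem (ℤ.+ toℕ y ℤ.+ V l j))
              (λ j H _ → ∑-allFin-shift (V l j) H))

        -- A solution V on which the phase does not vanish makes the phase equidistributed over the solutions.
        characterSum-zero : ∀ q V → Solution V → phase q V ≉0 → ∀ a → ∑ sols
            (λ x → C (a ℤ.+ phase q (λ l → lift (x l)))) ≡ 0ℚ
        characterSum-zero q V sv ph≉0 a = *-cancelˡ-≡0 (ι p) (0<ιp p)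
            (trans (sym (trans (∑-const (allFin p) S) (cong (_* S) (length-allFin p))))
          (trans (∑-cong (allFin p) (λ i → shifted (ℤ.+ toℕ i))) (trans (∑-swap (allFin p) sols _)
          (∑-zero sols (λ x → trans (∑-cong (allFin p)
              (λ i → cong C (lem a (phase q (λ l → lift (x l))) (ℤ.+ toℕ i) (phase q V))))
             (∑-affine-zero p pr Cos (a ℤ.+ phase q (λ l → lift (x l))) (phase q V) ph≉0))))))
          where
          S : ℚ
          S = ∑ sols (λ x → C (a ℤ.+ phase q (λ l → lift (x l))))
          0<ιp : ∀ p .{{_ : ℕ.NonZero p}} → 0ℚ < ι p
          0<ιp (suc p) = 0<ι p
          *-cancelˡ-≡0 : ∀ c {s} → 0ℚ < c → c * s ≡ 0ℚ → s ≡ 0ℚ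
          *-cancelˡ-≡0 c {s} 0<c e = ≤-antisym (*-cancelˡ-≤-pos c {{positive 0<c}}
              (≤-reflexive (trans e (sym (*-zeroʳ c)))))
                                               (*-cancelˡ-≤-pos c {{positive 0<c}}
                                                   (≤-reflexive (trans (*-zeroʳ c) (sym e))))
          lem : ∀ a e i d → a ℤ.+ (e ℤ.+ i ℤ.* d) ≡ a ℤ.+ e ℤ.+ d ℤ.* i
          lem = solveℤ
          -- Translation by c·V preserves the solution set. Adding this up over all residues c gives
          -- p·S on one side and, for each x, a complete sum of `C` on the other.
          shifted : ∀ c → S ≡ ∑ sols (λ x → C (a ℤ.+ (phase q (λ l → lift (x l)) ℤ.+ c ℤ.* phase q V)))
          shifted c = trans (∑-filter (isSol p M) (allFuns k (allPoints p 2)) _)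
            (trans (∑-shift (λ l j → c ℤ.* V l j) _ (λ {x} {y} e → cong₂ (λ b z → if b then C (a ℤ.+ z) else 0ℚ) (isSol-cong {x} {y} e)
                (Σℤ-cong k (λ l → cong (sign q l ℤ.*_)
                    (Σℤ-cong 2 (λ i → cong (λ z → m i (proj₂ (q l)) ℤ.* ℤ.+ toℕ z) (e l i)))))))
            (trans (∑-cong (allFuns k (allPoints p 2))
                (λ x → cong₂ (λ b z → if b then z else 0ℚ) (isSol-translate {x} {shift x} c (moved x) sv)
                (periodic (+-cong {a} (≡⇒≈ refl) (phase-translate q {λ l → lift (x l)} {λ l → lift (shift x l)}
                    {V} c (moved x))))))
              (sym (∑-filter (isSol p M) (allFuns k (allPoints p 2)) _))))
            where
            shift : (Fin k → Points p 2) → Fin k → Points p 2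
            shift x l = shiftPoint (λ l j → c ℤ.* V l j) l (x l)
            moved : ∀ x l j → lift (shift x l) j ≈ lift (x l) j ℤ.+ c ℤ.* V l j
            moved x l j = rem-≈ (lift (x l) j ℤ.+ c ℤ.* V l j)

-- Linear algebra of the two rows: independent columns, sign vectors and the dichotomy for choices.

module RowSpace where
  open import Defs
  open RationalBounds
  open FiniteSums
  open ModularArithmetic
  open ApproximateCosine
  open CharacterExpansion
  open SolutionSums
  open import Data.Nat.DivMod using (_mod_; m%n<n)
  open import Data.Integer using (+_; _+_; _*_; _-_; -_)

  foldr-+≤ : ∀ n (f : Fin n → ℕ) → (∀ l → f l ℕ.≤ 1) → foldr (λ l s → f l ℕ.+ s) 0 (allFin n) ℕ.≤ n
  foldr-+≤ zero    f b = z≤n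
  foldr-+≤ (suc n) f b = subst (ℕ._≤ suc n) (sym (foldr-allFin n (λ l s → f l ℕ.+ s) 0))
      (ℕₚ.+-mono-≤ (b 0F) (foldr-+≤ n _ (λ l → b (Fin.suc l))))

  foldr-+<₁ : ∀ n (f : Fin n → ℕ) → (∀ l → f l ℕ.≤ 1) → ∀ a → f a ≡ 0 → suc
      (foldr (λ l s → f l ℕ.+ s) 0 (allFin n)) ℕ.≤ n
  foldr-+<₁ (suc n) f b a fa rewrite foldr-allFin n (λ l s → f l ℕ.+ s) 0 with a
  ... | 0F        rewrite fa = s≤s (foldr-+≤ n _ (λ l → b (Fin.suc l)))
  ... | Fin.suc a = ℕₚ.≤-trans (ℕₚ.≤-reflexive (sym (ℕₚ.+-suc (f 0F) _)))
      (ℕₚ.+-mono-≤ (b 0F) (foldr-+<₁ n _ (λ l → b (Fin.suc l)) a fa))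

  foldr-+<₂ : ∀ n (f : Fin n → ℕ) → (∀ l → f l ℕ.≤ 1) → ∀ a b → a ≢ b → f a ≡ 0 → f b ≡ 0 →
              suc (suc (foldr (λ l s → f l ℕ.+ s) 0 (allFin n))) ℕ.≤ n
  foldr-+<₂ (suc n) f bd a b a≢b fa fb rewrite foldr-allFin n (λ l s → f l ℕ.+ s) 0 with a | b
  ... | 0F        | 0F        = contradiction refl a≢b
  ... | 0F        | Fin.suc b rewrite fa = s≤s (foldr-+<₁ n _ (λ l → bd (Fin.suc l)) b fb)
  ... | Fin.suc a | 0F        rewrite fb = s≤s (foldr-+<₁ n _ (λ l → bd (Fin.suc l)) a fa)
  ... | Fin.suc a | Fin.suc b = ℕₚ.≤-trans (ℕₚ.≤-reflexive
      (sym (trans (ℕₚ.+-suc (f 0F) _) (cong suc (ℕₚ.+-suc (f 0F) _)))))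
      (ℕₚ.+-mono-≤ (bd 0F) (foldr-+<₂ n _ (λ l → bd (Fin.suc l)) a b (λ e → a≢b (cong Fin.suc e)) fa fb))

  Σℤ-const : ∀ n c → Σℤ n (λ _ → c) ≡ + n * c
  Σℤ-const zero    c = refl
  Σℤ-const (suc n) c = trans (cong (λ z → c + z) (Σℤ-const n c)) (lem c (+ n))
    where lem : ∀ c n → c + n * c ≡ (1ℤ + n) * c
          lem = solveℤ

  Σℤ-δ₃ : ∀ n (a b c : Fin n) (F : Fin n → ℤ) x y z →
          Σℤ n (λ l → F l * (δ l a * x + δ l b * y + δ l c * z)) ≡ F a * x + F b * y + F c * z
  Σℤ-δ₃ n a b c F x y z = begin
    Σℤ n (λ l → F l * (δ l a * x + δ l b * y + δ l c * z))
      ≡⟨ Σℤ-cong n (λ l → lem (F l) (δ l a) (δ l b) (δ l c) x y z) ⟩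
    Σℤ n (λ l → F l * x * δ l a + F l * y * δ l b + F l * z * δ l c)
      ≡⟨ trans (Σℤ-+ n (λ l → F l * x * δ l a + F l * y * δ l b) (λ l → F l * z * δ l c))
               (cong (_+ Σℤ n (λ l → F l * z * δ l c)) (Σℤ-+ n (λ l → F l * x * δ l a) (λ l → F l * y * δ l b))) ⟩
    Σℤ n (λ l → F l * x * δ l a) + Σℤ n (λ l → F l * y * δ l b) + Σℤ n (λ l → F l * z * δ l c)
      ≡⟨ cong₂ _+_ (cong₂ _+_ (Σℤ-δ n a (λ l → F l * x)) (Σℤ-δ n b (λ l → F l * y))) (Σℤ-δ n c (λ l → F l * z)) ⟩
    F a * x + F b * y + F c * z ∎
    where
    open ≡-Reasoning
    lem : ∀ f d e g x y z → f * (d * x + e * y + g * z) ≡ f * x * d + f * y * e + f * z * g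
    lem = solveℤ

  module _ (p : ℕ) .{{_ : ℕ.NonZero p}} (pr : Prime p) (2<p : 2 ℕ.< p) {k : ℕ} (2<k : 2 ℕ.< k) (M : Matrix2 p k)
           (fullRank : FullRank p M) (s≡k-1 : sIs p M (k ℕ.∸ 1)) where
    open Modular p
    open System p M

    toℕ-mod-≈ : ∀ n → + toℕ (n mod p) ≈ + n
    toℕ-mod-≈ n = subst (λ z → + z ≈ + n) (sym (Finₚ.toℕ-fromℕ< (m%n<n n p))) (%ℕ-≈ (+ n))

    mulF-≈ : ∀ a b → + toℕ (mulF p a b) ≈ + toℕ a * + toℕ b
    mulF-≈ a b = ≈-trans (toℕ-mod-≈ (toℕ a ℕ.* toℕ b)) (≡⇒≈ (ℤₚ.pos-* (toℕ a) (toℕ b)))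

    rowComb-≈ : ∀ A B l → + toℕ (rowComb p M A B l) ≈ + toℕ A * m 0F l + + toℕ B * m 1F l
    rowComb-≈ A B l = ≈-trans (toℕ-mod-≈ (toℕ (mulF p A (M 0F l)) ℕ.+ toℕ (mulF p B (M 1F l))))
      (≈-trans (≡⇒≈ (ℤₚ.pos-+ (toℕ (mulF p A (M 0F l))) _)) (+-cong (mulF-≈ A (M 0F l)) (mulF-≈ B (M 1F l))))

    residue-zero : ∀ {i : Fin p} → + p ∣ + toℕ i → toℕ i ≡ 0
    residue-zero {i} d = residue-unique (Finₚ.toℕ<n i) (ℕₚ.<-trans ℕₚ.0<1+n 2<p) (∣⇒≈0 d)

    rem-row-≈ : ∀ α β l → + toℕ (rowComb p M (rem α) (rem β) l) ≈ α * m 0F l + β * m 1F l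
    rem-row-≈ α β l = ≈-trans (rowComb-≈ (rem α) (rem β) l)
      (+-cong (*-cong (rem-≈ α) (≡⇒≈ refl)) (*-cong (rem-≈ β) (≡⇒≈ refl)))

    -- Such an equation has length at most k - 2, below the minimum k - 1, so it is the zero
    -- equation, and full rank kills its coefficients.
    two-zeros : ∀ {a b} → a ≢ b → ∀ α β → + p ∣ α * m 0F a + β * m 1F a → + p ∣ α * m 0F b + β * m 1F b →
        (+ p ∣ α) × (+ p ∣ β)
    two-zeros {a} {b} a≢b α β da db with Finₚ.all? (λ l → toℕ (rowComb p M (rem α) (rem β) l) ℕ.≟ 0)
    ... | yes z = zero⇒∣ (proj₁ (fullRank (rem α) (rem β) z)) , zero⇒∣ (proj₂ (fullRank (rem α) (rem β) z))
      where
      zero⇒∣ : ∀ {γ} → toℕ (rem γ) ≡ 0 → + p ∣ γ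
      zero⇒∣ {γ} e = ∣-resp (≈-sym (subst (λ z → + z ≈ γ) e (rem-≈ γ))) (divides 0ℤ refl)
    ... | no nz = contradiction (ℕₚ.≤-trans (s≤s (proj₁ s≡k-1 (rem α) (rem β) nz))
        (ℕ.s≤s⁻¹ (ℕₚ.≤-trans short (ℕₚ.≤-reflexive
        (sym (ℕₚ.m+[n∸m]≡n {1} {k} (ℕₚ.<⇒≤ (ℕₚ.<-trans (s≤s (s≤s z≤n)) 2<k))))))))
                                (ℕₚ.<-irrefl refl)
      where
      f : Fin k → ℕ
      f l = if toℕ (rowComb p M (rem α) (rem β) l) ℕ.≡ᵇ 0 then 0 else 1
      f≤1 : ∀ l → f l ℕ.≤ 1
      f≤1 l with toℕ (rowComb p M (rem α) (rem β) l) ℕ.≡ᵇ 0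
      ... | true  = z≤n
      ... | false = s≤s z≤n
      f≡0 : ∀ l → + p ∣ α * m 0F l + β * m 1F l → f l ≡ 0
      f≡0 l d = cong (λ n → if n ℕ.≡ᵇ 0 then 0 else 1)
          (residue-zero {rowComb p M (rem α) (rem β) l} (∣-resp (rem-row-≈ α β l) d))
      short : suc (suc (eqLength p (rowComb p M (rem α) (rem β)))) ℕ.≤ k
      short = foldr-+<₂ k f f≤1 a b a≢b (f≡0 a da) (f≡0 b db)

    det : Fin k → Fin k → ℤ
    det a b = m 0F a * m 1F b - m 1F a * m 0F b

    -- If column a vanished, the combination with coefficients (y_b, -x_b) would vanish at a and b,
    -- forcing column b to vanish too; then the first row would have two zeros.
    column-≉0 : ∀ {a b} → a ≢ b → ¬ ((+ p ∣ m 0F a) × (+ p ∣ m 1F a))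
    column-≉0 {a} {b} a≢b (d₀ , d₁) = both-zero (two-zeros a≢b (m 1F b) (- m 0F b)
        (∣m∣n⇒∣m+n (∣n⇒∣m*n (m 1F b) d₀) (∣n⇒∣m*n (- m 0F b) d₁))
        (subst (+ p ∣_) (lem (m 0F b) (m 1F b)) (divides 0ℤ refl)))
      where
      lem : ∀ x y → 0ℤ ≡ y * x + - x * y
      lem = solveℤ
      both-zero : (+ p ∣ m 1F b) × (+ p ∣ - m 0F b) → _
      both-zero (e₁ , e₀) = 1≉0 pr (proj₁ (two-zeros a≢b 1ℤ 0ℤ
        (∣m∣n⇒∣m+n (∣n⇒∣m*n 1ℤ d₀) (∣n⇒∣m*n 0ℤ d₁))
        (∣m∣n⇒∣m+n (∣n⇒∣m*n 1ℤ (subst (+ p ∣_) (neg-neg (m 0F b)) (∣n⇒∣m*n -1ℤ e₀))) (∣n⇒∣m*n 0ℤ e₁))))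
        where neg-neg : ∀ x → -1ℤ * - x ≡ x
              neg-neg = solveℤ

    other : ∀ a → ∃[ b ] a ≢ b
    other a with a Fin.≟ Fin.fromℕ< (ℕₚ.<-trans ℕₚ.0<1+n 2<k)
    ... | no ne = _ , ne
    ... | yes e = Fin.fromℕ< (ℕₚ.<-trans (s≤s (s≤s z≤n)) 2<k) ,
      λ e′ → contradiction (trans (sym (Finₚ.toℕ-fromℕ< _))
          (trans (cong toℕ (trans (sym e) e′)) (Finₚ.toℕ-fromℕ< _))) λ ()

    column-nonzero : ∀ a → ∃[ i ] m i a ≉0
    column-nonzero a with + p ∣? m 0F a | + p ∣? m 1F a
    ... | no x≉0 | _      = 0F , x≉0
    ... | yes _  | no y≉0 = 1F , y≉0
    ... | yes d₀ | yes d₁ = contradiction (d₀ , d₁) (column-≉0 (proj₂ (other a)))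

    -- The combination with coefficients (y_a, -x_a) vanishes at a and equals -det at b; a second
    -- zero would make column a vanish.
    det-≉0 : ∀ {a b} → a ≢ b → det a b ≉0
    det-≉0 {a} {b} a≢b d = column-≉0 a≢b (subst (+ p ∣_) (neg-neg (m 0F a)) (∣n⇒∣m*n -1ℤ (proj₂ both)) , proj₁ both)
      where
      lem₁ : ∀ x y → 0ℤ ≡ y * x + - x * y
      lem₁ = solveℤ
      lem₂ : ∀ xa ya xb yb → -1ℤ * (xa * yb - ya * xb) ≡ ya * xb + - xa * yb
      lem₂ = solveℤ
      neg-neg : ∀ x → -1ℤ * - x ≡ x
      neg-neg = solveℤ
      both = two-zeros a≢b (m 1F a) (- m 0F a) (subst (+ p ∣_) (lem₁ (m 0F a) (m 1F a)) (divides 0ℤ refl))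
               (subst (+ p ∣_) (lem₂ (m 0F a) (m 1F a) (m 0F b) (m 1F b)) (∣n⇒∣m*n -1ℤ d))

    -- Cramer's relation m_a[b,c] + m_b[c,a] + m_c[a,b] = 0 gives solutions supported on three variables.
    cramer : Fin k → Fin k → Fin k → Fin 2 → Fin k → Fin 2 → ℤ
    cramer a b c i l j = δ j i * (δ l a * det b c + δ l b * det c a + δ l c * det a b)

    cramer-solution : ∀ a b c i → Solution (cramer a b c i)
    cramer-solution a b c i i′ j = subst (+ p ∣_) (sym
        (trans (Σℤ-cong k (λ l → lem (m i′ l) (δ j i) (δ l a * det b c + δ l b * det c a + δ l c * det a b)))
        (trans (Σℤ-*ˡ k (δ j i) (λ l → m i′ l * (δ l a * det b c + δ l b * det c a + δ l c * det a b)))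
        (trans (cong (δ j i *_) (trans (Σℤ-δ₃ k a b c (m i′) (det b c) (det c a) (det a b)) (relation i′)))
            (ℤₚ.*-zeroʳ (δ j i)))))) (divides 0ℤ refl)
      where
      lem : ∀ x d y → x * (d * y) ≡ d * (x * y)
      lem = solveℤ
      lem₀ : ∀ xa ya xb yb xc yc → xa * (xb * yc - yb * xc) + xb * (xc * ya - yc * xa) + xc *
          (xa * yb - ya * xb) ≡ 0ℤ
      lem₀ = solveℤ
      lem₁ : ∀ xa ya xb yb xc yc → ya * (xb * yc - yb * xc) + yb * (xc * ya - yc * xa) + yc *
          (xa * yb - ya * xb) ≡ 0ℤ
      lem₁ = solveℤ
      relation : ∀ i′ → m i′ a * det b c + m i′ b * det c a + m i′ c * det a b ≡ 0ℤ
      relation 0F = lem₀ (m 0F a) (m 1F a) (m 0F b) (m 1F b) (m 0F c) (m 1F c)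
      relation 1F = lem₁ (m 0F a) (m 1F a) (m 0F b) (m 1F b) (m 0F c) (m 1F c)

    cramer-phase : ∀ q a b c i → phase q (cramer a b c i) ≡
      sign q a * m i (proj₂ (q a)) * det b c + sign q b * m i (proj₂ (q b)) * det c a + sign q c * m i
          (proj₂ (q c)) * det a b
    cramer-phase q a b c i = trans (Σℤ-cong k (λ l → trans (cong (sign q l *_) (inner l))
        (sym (ℤₚ.*-assoc (sign q l) (m i (proj₂ (q l))) _))))
        (Σℤ-δ₃ k a b c (λ l → sign q l * m i (proj₂ (q l))) (det b c) (det c a) (det a b))
      where
      lem : ∀ x d y → x * (d * y) ≡ x * y * d
      lem = solveℤ
      inner : ∀ l → dot (proj₂ (q l)) (cramer a b c i l) ≡ m i (proj₂ (q l)) *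
          (δ l a * det b c + δ l b * det c a + δ l c * det a b)
      inner l = trans (Σℤ-cong 2 (λ j → lem (m j (proj₂ (q l))) (δ j i)
          (δ l a * det b c + δ l b * det c a + δ l c * det a b)))
        (Σℤ-δ 2 i (λ j → m j (proj₂ (q l)) * (δ l a * det b c + δ l b * det c a + δ l c * det a b)))

    sgn-sq : ∀ s → sgn s * sgn s ≡ 1ℤ
    sgn-sq true  = refl
    sgn-sq false = refl

    sgn-≉0 : ∀ s → sgn s ≉0
    sgn-≉0 s d = 1≉0 pr (subst (+ p ∣_) (sgn-sq s) (∣n⇒∣m*n (sgn s) d))

    -- The coefficient of the shift r_j in the term indexed by q.
    weight : Choice → Fin k → ℤ
    weight q j = Σℤ k (λ l → sign q l * δ (proj₂ (q l)) j)

    -- A ±1 vector in the row space is a full-length equation, so the ratios with a second row are distinct.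
    module SignVector (w : Fin k → Bool) (α β : ℤ) (w≈ : ∀ l → sgn (w l) ≈ α * m 0F l + β * m 1F l) where

      0F′ : Fin k
      0F′ = Fin.fromℕ< (ℕₚ.<-trans ℕₚ.0<1+n 2<k)

      -- Signs are their own inverses, so sgn(w_l)·t_l is the quotient of the two rows; the
      -- hypothesis makes it injective in l.
      length≤p′ : (t : Fin k → ℤ) → (∀ {a b} → a ≢ b → (sgn (w a) * t b - sgn (w b) * t a) ≉0) → k ℕ.≤ p
      length≤p′ t indep = Finₚ.injective⇒≤ {f = λ l → rem (sgn (w l) * t l)} inj
        where
        lem : ∀ s r x y → s * r * (s * x - r * y) ≡ s * s * (r * x) - r * r * (s * y)
        lem = solveℤ
        inj : ∀ {a b} → rem (sgn (w a) * t a) ≡ rem (sgn (w b) * t b) → a ≡ b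
        inj {a} {b} e with a Fin.≟ b
        ... | yes eq = eq
        ... | no ne = contradiction
            (subst (+ p ∣_) (trans (lem (sgn (w a)) (sgn (w b)) (t a) (t b))
                (trans (cong₂ (λ x y → x * (sgn (w b) * t a) - y * (sgn (w a) * t b)) (sgn-sq (w a)) (sgn-sq (w b)))
                (neg (sgn (w b) * t a) (sgn (w a) * t b))))
              (∣n⇒∣m*n (sgn (w a) * sgn (w b)) (_≈_.difference
                  (≈-trans (≈-sym (rem-≈ (sgn (w a) * t a)))
                  (≈-trans (≡⇒≈ (cong (λ z → + toℕ z) e)) (rem-≈ (sgn (w b) * t b)))))))
            (λ d → indep ne (subst (+ p ∣_) (neg′ (sgn (w b) * t a) (sgn (w a) * t b)) (∣n⇒∣m*n -1ℤ d)))
          where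
          neg : ∀ x y → 1ℤ * x - 1ℤ * y ≡ x - y
          neg = solveℤ
          neg′ : ∀ x y → -1ℤ * (x - y) ≡ y - x
          neg′ = solveℤ

      -- The second row is whichever row of M is independent of w: crossing w with row 1 gives
      -- α·det, crossing with row 0 gives β·det up to sign. If both coefficients vanished, so would
      -- w.
      length≤p : k ℕ.≤ p
      length≤p with + p ∣? α | + p ∣? β
      ... | no α≉0 | _ = length≤p′ (m 1F) (λ {a} {b} a≢b d → ≉0-* pr α≉0 (det-≉0 a≢b) (∣-resp (≈-sym (by∣ (subst (+ p ∣_)
              (lem α β (sgn (w a)) (sgn (w b)) (m 0F a) (m 1F a) (m 0F b) (m 1F b))
              (∣m∣n⇒∣m-n (∣n⇒∣m*n (m 1F b) (_≈_.difference (w≈ a)))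
                  (∣n⇒∣m*n (m 1F a) (_≈_.difference (w≈ b))))))) d))
        where lem : ∀ α β s r xa ya xb yb → yb * (s - (α * xa + β * ya)) - ya * (r - (α * xb + β * yb)) ≡ s * yb - r * ya - α * (xa * yb - ya * xb)
              lem = solveℤ
      ... | yes _ | no β≉0 = length≤p′ (m 0F) (λ {a} {b} a≢b d → ≉0-* pr β≉0 (det-≉0 (λ e → a≢b (sym e))) (∣-resp (≈-sym (by∣ (subst (+ p ∣_)
              (lem α β (sgn (w a)) (sgn (w b)) (m 0F a) (m 1F a) (m 0F b) (m 1F b))
              (∣m∣n⇒∣m-n (∣n⇒∣m*n (m 0F b) (_≈_.difference (w≈ a)))
                  (∣n⇒∣m*n (m 0F a) (_≈_.difference (w≈ b))))))) d))
        where lem : ∀ α β s r xa ya xb yb → xb * (s - (α * xa + β * ya)) - xa * (r - (α * xb + β * yb)) ≡ s * xb - r * xa - β * (xb * ya - yb * xa)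
              lem = solveℤ
      ... | yes α≈0 | yes β≈0 = contradiction (∣-resp (w≈ 0F′)
          (∣m∣n⇒∣m+n (∣m⇒∣m*n (m 0F 0F′) α≈0) (∣m⇒∣m*n (m 1F 0F′) β≈0))) (sgn-≉0 (w 0F′))

      balanced⇒additive : 2 ℕ.* countTrue p w ≡ k → ContainsAdditiveTuple p M
      balanced⇒additive bal = rem α , rem β , nonzero , oneF p , one≢0 , w , bal , entries
        where
        toℕ-one : toℕ (oneF p) ≡ 1
        toℕ-one = residue-unique (Finₚ.toℕ<n (oneF p)) (ℕₚ.<-trans (s≤s (s≤s z≤n)) 2<p) (toℕ-mod-≈ 1)
        one≢0 : toℕ (oneF p) ≢ 0
        one≢0 e with trans (sym toℕ-one) e
        ... | ()
        nonzero : ¬ IsZeroVec p (rowComb p M (rem α) (rem β))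
        nonzero z = sgn-≉0 (w 0F′) (∣-resp (≈-trans (w≈ 0F′) (≈-sym (rem-row-≈ α β 0F′)))
            (subst (λ z → + p ∣ + z) (sym (z 0F′)) (divides 0ℤ refl)))
        minus-one : + toℕ (minusOneF p) ≈ -1ℤ
        minus-one = ≈-trans (toℕ-mod-≈ (p ℕ.∸ 1)) (by∣
            (divides 1ℤ (trans (cong (_+ 1ℤ) (trans (sym (ℤₚ.⊖-≥ 1≤p)) (sym (ℤₚ.m-n≡m⊖n p 1)))) (lem (+ p)))))
          where
          1≤p = ℕₚ.<⇒≤ (ℕₚ.<-trans (s≤s (s≤s z≤n)) 2<p)
          lem : ∀ p → p - 1ℤ + 1ℤ ≡ 1ℤ * p
          lem = solveℤ
        sgn-≈ : ∀ b → sgn b ≈ + toℕ (if b then oneF p else minusOneF p)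
        sgn-≈ true  = ≈-sym (toℕ-mod-≈ 1)
        sgn-≈ false = ≈-sym minus-one
        entries : ∀ l → rowComb p M (rem α) (rem β) l ≡ mulF p (oneF p) (if w l then oneF p else minusOneF p)
        entries l = Fin-unique (≈-trans (rem-row-≈ α β l) (≈-trans (≈-sym (w≈ l)) (≈-trans (sgn-≈ (w l))
          (≈-sym (≈-trans (mulF-≈ (oneF p) (if w l then oneF p else minusOneF p))
              (≡⇒≈ (trans (cong (λ z → + z * + toℕ (if w l then oneF p else minusOneF p)) toℕ-one)
              (ℤₚ.*-identityˡ _))))))))

    sum-sgn : ∀ (w : Fin k → Bool) → Σℤ k (λ l → sgn (w l)) ≡ + (2 ℕ.* countTrue p w) - + k
    sum-sgn w = begin
      Σℤ k (λ l → sgn (w l))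
        ≡⟨ Σℤ-cong k (λ l → sgn-count (w l)) ⟩
      Σℤ k (λ l → + 2 * + (if w l then 1 else 0) + -1ℤ)
        ≡⟨ Σℤ-+ k (λ l → + 2 * + (if w l then 1 else 0)) (λ _ → -1ℤ) ⟩
      Σℤ k (λ l → + 2 * + (if w l then 1 else 0)) + Σℤ k (λ _ → -1ℤ)
        ≡⟨ cong₂ _+_ (trans (Σℤ-*ˡ k (+ 2) (λ l → + (if w l then 1 else 0)))
            (cong (+ 2 *_) (sym (foldr-+-Σℤ k (λ l → if w l then 1 else 0))))) (Σℤ-const k -1ℤ) ⟩
      + 2 * + countTrue p w + + k * -1ℤ
        ≡⟨ cong₂ _+_ (sym (ℤₚ.pos-* 2 (countTrue p w))) (lem (+ k)) ⟩
      + (2 ℕ.* countTrue p w) - + k ∎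
      where
      open ≡-Reasoning
      lem : ∀ x → x * -1ℤ ≡ - x
      lem = solveℤ
      sgn-count : ∀ b → sgn b ≡ + 2 * + (if b then 1 else 0) + -1ℤ
      sgn-count true  = refl
      sgn-count false = refl

    -- The sum of signs is 2·count - k, of absolute value at most k < p, so a multiple of p must be
    -- zero.
    balanced : ∀ (w : Fin k → Bool) → k ℕ.< p → + p ∣ Σℤ k (λ l → sgn (w l)) → 2 ℕ.* countTrue p w ≡ k
    balanced w k<p d with ℕₚ.≤-total (2 ℕ.* countTrue p w) k
    ... | inj₁ le = ℕₚ.≤-antisym le (ℕₚ.m∸n≡0⇒m≤n (residue-unique
        (ℕₚ.≤-<-trans (ℕₚ.m∸n≤m k (2 ℕ.* countTrue p w)) k<p) (ℕₚ.<-trans ℕₚ.0<1+n 2<p)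
          (≈-trans (≡⇒≈ (trans (sym (ℤₚ.⊖-≥ le)) (sym (ℤₚ.m-n≡m⊖n k (2 ℕ.* countTrue p w)))))
              (∣⇒≈0 (subst (+ p ∣_) (lem (+ (2 ℕ.* countTrue p w)) (+ k))
              (∣n⇒∣m*n -1ℤ (subst (+ p ∣_) (sum-sgn w) d)))))))
      where lem : ∀ x y → -1ℤ * (x - y) ≡ y - x
            lem = solveℤ
    ... | inj₂ ge = ℕₚ.≤-antisym (ℕₚ.m∸n≡0⇒m≤n (residue-unique (ℕₚ.≤-<-trans (ℕₚ.m≤n+o⇒m∸n≤o _ k bound) k<p)
        (ℕₚ.<-trans ℕₚ.0<1+n 2<p)
          (≈-trans (≡⇒≈ (trans (sym (ℤₚ.⊖-≥ ge)) (sym (ℤₚ.m-n≡m⊖n (2 ℕ.* countTrue p w) k))))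
              (∣⇒≈0 (subst (+ p ∣_) (sum-sgn w) d))))) ge
      where
      count≤k : countTrue p w ℕ.≤ k
      count≤k = foldr-+≤ k (λ l → if w l then 1 else 0) (λ l → le1 (w l))
        where le1 : ∀ b → (if b then 1 else 0) ℕ.≤ 1
              le1 true  = s≤s z≤n
              le1 false = z≤n
      bound : 2 ℕ.* countTrue p w ℕ.≤ k ℕ.+ k
      bound = ℕₚ.≤-trans (ℕₚ.*-monoʳ-≤ 2 count≤k) (ℕₚ.≤-reflexive (cong (k ℕ.+_) (ℕₚ.+-identityʳ k)))

    module _ (k-even : 2 ℕ∣.∣ k) (¬additive : ¬ ContainsAdditiveTuple p M) where

      k≢p : k ≢ p
      k≢p refl with prime⇒irreducible pr k-even
      ... | inj₁ ()
      ... | inj₂ e = contradiction e (ℕₚ.<⇒≢ 2<p)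

      -- A vanishing phase forces the indices chosen by q to be constant or injective.
      module Vanishing (q : Choice) (vanish : ∀ a b c i → + p ∣ phase q (cramer a b c i)) where

        idx : Fin k → Fin k
        idx l = proj₂ (q l)

        vanish′ : ∀ a b c i → + p ∣ sign q a * m i (idx a) * det b c + sign q b * m i
            (idx b) * det c a + sign q c * m i (idx c) * det a b
        vanish′ a b c i = subst (+ p ∣_) (cramer-phase q a b c i) (vanish a b c i)

        module Repeated {a b : Fin k} (a≢b : a ≢ b) (idx≡ : idx a ≡ idx b) where

          -- With columns a and b sent to one index, crossing the vanishing relation with that
          -- column eliminates both terms and leaves a sign times det(idx c, idx a) times det(a, b).
          constant : ∀ c → idx c ≡ idx a
          constant c with idx c Fin.≟ idx a
          ... | yes e = e
          ... | no ne = contradiction (subst (+ p ∣_)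
              (lem (sign q a) (sign q b) (sign q c) (m 0F (idx a)) (m 1F (idx a)) (m 0F (idx c)) (m 1F (idx c))
              (det b c) (det c a) (det a b))
                  (∣m∣n⇒∣m-n (∣n⇒∣m*n (m 1F (idx a)) (v 0F)) (∣n⇒∣m*n (m 0F (idx a)) (v 1F))))
                (≉0-* pr (≉0-* pr (sgn-≉0 (proj₁ (q c))) (det-≉0 ne)) (det-≉0 a≢b))
            where
            v : ∀ i → + p ∣ sign q a * m i (idx a) * det b c + sign q b * m i (idx a) * det c a + sign q c * m i
                (idx c) * det a b
            v i = subst (λ n → + p ∣ sign q a * m i
                (idx a) * det b c + sign q b * m i n * det c a + sign q c * m i (idx c) * det a b) (sym idx≡)
                (vanish′ a b c i)
            lem : ∀ sa sb sc x y xc yc A B D → y * (sa * x * A + sb * x * B + sc * xc * D) - x *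
                (sa * y * A + sb * y * B + sc * yc * D)
                ≡ sc * (xc * y - yc * x) * D
            lem = solveℤ

          -- All three terms now contain the same column, so one of its nonzero entries cancels: the
          -- signs obey the same three-term relation as the columns.
          relation : ∀ c → + p ∣ sign q a * det b c + sign q b * det c a + sign q c * det a b
          relation c = cancel-≉0 pr (proj₂ (column-nonzero (idx a))) (subst (+ p ∣_)
              (lem (sign q a) (sign q b) (sign q c) (m i (idx a)) (det b c) (det c a) (det a b))
              (subst₂ (λ n n′ → + p ∣ sign q a * m i
                  (idx a) * det b c + sign q b * m i n * det c a + sign q c * m i n′ * det a b) (sym idx≡)
                  (constant c) (vanish′ a b c i)))
            where
            i = proj₁ (column-nonzero (idx a))
            lem : ∀ sa sb sc x A B D → sa * x * A + sb * x * B + sc * x * D ≡ x * (sa * A + sb * B + sc * D)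
            lem = solveℤ

          D⁻¹ : ℤ
          D⁻¹ = proj₁ (inverse pr (det a b) (det-≉0 a≢b))

          -- Cramer's rule for the row combination taking the values sign a and sign b at a and b;
          -- `relation` propagates the agreement to every c.
          α β : ℤ
          α = D⁻¹ * (sign q a * m 1F b - sign q b * m 1F a)
          β = D⁻¹ * (sign q b * m 0F a - sign q a * m 0F b)

          in-row-space : ∀ c → sign q c ≈ α * m 0F c + β * m 1F c
          in-row-space c = by∣ (subst (+ p ∣_)
              (lem (sign q a) (sign q b) (sign q c) (m 0F a) (m 1F a) (m 0F b) (m 1F b) (m 0F c) (m 1F c) D⁻¹)
              (∣m∣n⇒∣m-n (∣n⇒∣m*n D⁻¹ (relation c))
                  (∣n⇒∣m*n (sign q c) (_≈_.difference (proj₂ (inverse pr (det a b) (det-≉0 a≢b)))))))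
            where lem : ∀ sa sb sc xa ya xb yb xc yc E →
                    E * (sa * (xb * yc - yb * xc) + sb * (xc * ya - yc * xa) + sc * (xa * yb - ya * xb)) - sc *
                        ((xa * yb - ya * xb) * E - 1ℤ)
                    ≡ sc - (E * (sa * yb - sb * ya) * xc + E * (sb * xa - sa * xb) * yc)
                  lem = solveℤ

          -- All signs fall on one index, so the weight is their sum; if p divided it, the sign
          -- vector would be balanced and hence an additive tuple.
          weight-≉0 : weight q (idx a) ≉0
          weight-≉0 d = ¬additive (balanced⇒additive (balanced w (ℕₚ.≤∧≢⇒< length≤p k≢p)
              (subst (+ p ∣_) (Σℤ-cong k (λ l → trans
                  (cong (sign q l *_) (trans (cong (λ n → δ n (idx a)) (constant l)) (δ-refl (idx a))))
                  (ℤₚ.*-identityʳ (sign q l)))) d)))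
            where
            w : Fin k → Bool
            w l = proj₁ (q l)
            open SignVector w α β in-row-space

        -- Only the variable a reaches its index, so the weight is a single sign.
        injective-weight : (∀ {a b} → a ≢ b → idx a ≢ idx b) → ∀ a → weight q (idx a) ≉0
        injective-weight inj a d = sgn-≉0 (proj₁ (q a))
            (subst (+ p ∣_) (trans (Σℤ-single k a (λ l → sign q l * δ (idx l) (idx a))
            (λ l l≢a → trans (cong (sign q l *_) (δ-≢ (inj l≢a))) (ℤₚ.*-zeroʳ (sign q l))))
          (trans (cong (sign q a *_) (δ-refl (idx a))) (ℤₚ.*-identityʳ (sign q a)))) d)

      -- Two ways for a term to cancel: in the sum over solutions, or in the average over shifts.
      -- Only the solutions from `cramer` are searched, since their phases decide the structure of
      -- q.
      dichotomy : ∀ q → (∃[ V ] Solution V × phase q V ≉0) ⊎ (∃[ j ] weight q j ≉0)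
      dichotomy q with Finₚ.any? (λ a → Finₚ.any? (λ b → Finₚ.any?
          (λ c → Finₚ.any? (λ i → ¬? (+ p ∣? phase q (cramer a b c i))))))
      ... | yes (a , b , c , i , nz) = inj₁ (cramer a b c i , cramer-solution a b c i , nz)
      ... | no none = inj₂ (nonzero-weight (Finₚ.any?
          (λ a → Finₚ.any? (λ b → ¬? (a Fin.≟ b) ×-dec (idx a Fin.≟ idx b)))))
        where
        open Vanishing q (λ a b c i → decidable-stable (+ p ∣? phase q (cramer a b c i))
            (λ nz → none (a , b , c , i , nz)))
        nonzero-weight : Dec (∃[ a ] ∃[ b ] (a ≢ b × idx a ≡ idx b)) → ∃[ j ] weight q j ≉0
        nonzero-weight (yes (a , b , a≢b , e)) = idx a , Repeated.weight-≉0 a≢b e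
        nonzero-weight (no ¬rep) = idx a₀ , injective-weight (λ {a} {b} a≢b e → ¬rep (a , b , a≢b , e)) a₀
          where
          a₀ : Fin k
          a₀ = Fin.fromℕ< (ℕₚ.<-trans ℕₚ.0<1+n 2<k)

-- Averaging over the shifts, and the choice of f.

module NegativeAverage where
  open import Defs
  open RationalBounds
  open FiniteSums
  open ModularArithmetic
  open ApproximateCosine
  open CharacterExpansion
  open SolutionSums
  open RowSpace
  open import Data.Rational
  open import Data.Rational.Properties hiding (-‿cong)

  mean-zero⁺ : ∀ xs → sumℚ xs ≡ 0ℚ → mean xs ≡ 0ℚ
  mean-zero⁺ []       e = refl
  mean-zero⁺ (x ∷ xs) e = trans (cong (_* (ℤ.+ 1 / suc (length xs))) e) (*-zeroˡ (ℤ.+ 1 / suc (length xs)))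

  mean-neg : ∀ xs → sumℚ xs < 0ℚ → mean xs < 0ℚ
  mean-neg []       lt = contradiction lt (<-irrefl refl)
  mean-neg (x ∷ xs) lt = subst (sumℚ (x ∷ xs) * c <_) (*-zeroˡ c)
      (*-monoˡ-<-pos c {{normalize-pos 1 (suc (length xs))}} lt)
    where c = ℤ.+ 1 / suc (length xs)

  0<power : ∀ {c} → 0ℚ < c → ∀ n → 0ℚ < power c n
  0<power 0<c zero    = positive⁻¹ 1ℚ
  0<power 0<c (suc n) = 0<* 0<c (0<power 0<c n)

  0<power-neg : ∀ {c} → 0ℚ < c → ∀ n → 0ℚ < power (- c) (n ℕ.* 2)
  0<power-neg 0<c zero    = positive⁻¹ 1ℚ
  0<power-neg {c} 0<c (suc n) = subst (0ℚ <_) (lem c (power (- c) (n ℕ.* 2)))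
      (0<* (0<* 0<c 0<c) (0<power-neg 0<c n))
    where lem : ∀ c x → c * c * x ≡ - c * (- c * x)
          lem = solve-∀ ℚ-ring

  ∑-const-∈ : ∀ {A : Set} (xs : List A) {f : A → ℚ} {c} → (∀ x → x ∈ xs → f x ≡ c) → ∑ xs f ≡ ι (length xs) * c
  ∑-const-∈ xs {c = c} e = trans (∑-cong-∈ xs e) (∑-const xs c)

  1≤length : ∀ {A : Set} {xs : List A} {x} → x ∈ xs → 1ℚ ≤ ι (length xs)
  1≤length {xs = _ ∷ xs} _ = 1≤ι (length xs)

  δ-sym : ∀ {n} (i j : Fin n) → δ i j ≡ δ j i
  δ-sym i j with i Fin.≟ j
  ... | yes refl = sym (δ-refl i)
  ... | no ne    = sym (δ-≢ (λ e → ne (sym e)))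

  module _ (p : ℕ) .{{_ : ℕ.NonZero p}} (pr : Prime p) (2<p : 2 ℕ.< p) {k : ℕ} (2<k : 2 ℕ.< k) (M : Matrix2 p k)
           (fullRank : FullRank p M) (s≡k-1 : sIs p M (k ℕ.∸ 1)) where
    open Modular p
    open System p M

    shifts : List (Fin k → Fin p)
    shifts = allFuns k (allFin p)

    choices : List Choice
    choices = allFuns k (signed (allFin k))

    offset : Choice → (Fin k → Fin p) → ℤ
    offset q r = Σℤ k (λ l → sign q l ℤ.* ℤ.+ toℕ (r (proj₂ (q l))))

    offset-weight : ∀ q r → offset q r ≡ Σℤ k (λ j → weight p pr 2<p 2<k M fullRank s≡k-1 q j ℤ.* ℤ.+ toℕ (r j))
    offset-weight q r = sym (begin
      Σℤ k (λ j → Σℤ k (λ l → sign q l ℤ.* δ (proj₂ (q l)) j) ℤ.* ℤ.+ toℕ (r j))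
        ≡⟨ Σℤ-cong k (λ j → trans (ℤₚ.*-comm _ (ℤ.+ toℕ (r j)))
            (sym (Σℤ-*ˡ k (ℤ.+ toℕ (r j)) (λ l → sign q l ℤ.* δ (proj₂ (q l)) j)))) ⟩
      Σℤ k (λ j → Σℤ k (λ l → ℤ.+ toℕ (r j) ℤ.* (sign q l ℤ.* δ (proj₂ (q l)) j)))
        ≡⟨ Σℤ-swap k k (λ j l → ℤ.+ toℕ (r j) ℤ.* (sign q l ℤ.* δ (proj₂ (q l)) j)) ⟩
      Σℤ k (λ l → Σℤ k (λ j → ℤ.+ toℕ (r j) ℤ.* (sign q l ℤ.* δ (proj₂ (q l)) j)))
        ≡⟨ Σℤ-cong k (λ l → trans (Σℤ-cong k (λ j → trans (lem (ℤ.+ toℕ (r j)) (sign q l) (δ (proj₂ (q l)) j))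
            (cong (λ d → sign q l ℤ.* (ℤ.+ toℕ (r j) ℤ.* d)) (δ-sym (proj₂ (q l)) j))))
             (trans (Σℤ-*ˡ k (sign q l) (λ j → ℤ.+ toℕ (r j) ℤ.* δ j (proj₂ (q l))))
                 (cong (sign q l ℤ.*_) (Σℤ-δ k (proj₂ (q l)) (λ j → ℤ.+ toℕ (r j)))))) ⟩
      offset q r ∎)
      where
      open ≡-Reasoning
      lem : ∀ r s d → r ℤ.* (s ℤ.* d) ≡ s ℤ.* (r ℤ.* d)
      lem = solveℤ

    residue₀ : Fin p
    residue₀ = rem 0ℤ

    residue₀≡0 : toℕ residue₀ ≡ 0
    residue₀≡0 = residue-unique (Finₚ.toℕ<n residue₀) (ℕₚ.<-trans ℕₚ.0<1+n 2<p) (rem-≈ 0ℤ)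

    zero-shift : ∃[ r ] (r ∈ shifts × (∀ j → r j ≡ residue₀))
    zero-shift = allFuns-complete k (λ _ → residue₀) (λ _ → ∈-allFin residue₀)

    1≤∣sols∣ : 1ℚ ≤ ι (length sols)
    1≤∣sols∣ = from-zero (allFuns-complete 2 (λ _ → residue₀) (λ _ → ∈-allFin residue₀))
      where
      from-zero : ∃[ v ] (v ∈ allPoints p 2 × (∀ j → v j ≡ residue₀)) → 1ℚ ≤ ι (length sols)
      from-zero (v , v∈ , v≡) = from-zero′ (allFuns-complete k (λ _ → v) (λ _ → v∈))
        where
        from-zero′ : ∃[ x ] (x ∈ allFuns k (allPoints p 2) × (∀ l → x l ≡ v)) → 1ℚ ≤ ι (length sols)
        from-zero′ (x , x∈ , x≡) = 1≤length (∈-filterᵇ⁺ (isSol p M) x∈ (isSol⁺ x (λ i j → subst (ℤ.+ p ∣_)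
          (sym (Σℤ-zero k (λ l → trans (cong (m i l ℤ.*_)
              (cong ℤ.+_ (trans (cong (λ w → toℕ (w j)) (x≡ l)) (trans (cong toℕ (v≡ j)) residue₀≡0))))
              (ℤₚ.*-zeroʳ (m i l)))))
          (divides 0ℤ refl))))

    identity-choice : ∃[ q ] (q ∈ choices × (∀ l → q l ≡ (true , l)))
    identity-choice = allFuns-complete k (λ l → true , l) (λ l → ∈-++⁺ˡ (∈-map⁺ (true ,_) (∈-allFin l)))

    -- The phase is the trace of the 2 × 2 matrix M X: row 0 read in coordinate 0 plus row 1 read in
    -- coordinate 1.
    identity-phase : ∀ {q} → (∀ l → q l ≡ (true , l)) → ∀ {X} → Solution X → ℤ.+ p ∣ phase q X
    identity-phase {q} q≡ {X} sX = subst (ℤ.+ p ∣_)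
        (sym (trans (Σℤ-cong k (λ l → trans (cong (λ c → sgn (proj₁ c) ℤ.* dot (proj₂ c) (X l)) (q≡ l))
        (ℤₚ.*-identityˡ (dot l (X l)))))
        (Σℤ-swap k 2 (λ l i → m i l ℤ.* X l i))))
      (∣m∣n⇒∣m+n (sX 0F 0F) (∣m∣n⇒∣m+n (sX 1F 1F) (divides 0ℤ refl)))

    module Average {ε : ℚ} (Cos : ApproxCos p ε) where
      open ApproxCos Cos using (C; periodic; bounded; 1≤C0)

      wave : (Fin k → Fin p) → Points p 2 → ℚ
      wave r v = ∑ (allFin k) (λ a → C (dot a (lift p v) ℤ.+ ℤ.+ toℕ (r a)))

      wave-bound : ∀ r v → ∣ wave r v ∣ ≤ ι k * 3ℚ
      wave-bound r v = subst (λ z → ∣ wave r v ∣ ≤ z * 3ℚ) (length-allFin k) (∑-abs (allFin k) (λ a → bounded _))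

      wave-mean : ∀ r → ∑ (allPoints p 2) (wave r) ≡ 0ℚ
      wave-mean r = trans (∑-swap (allPoints p 2) (allFin k) _) (∑-zero (allFin k) (λ a →
        trans (∑-cong (allPoints p 2) (λ v → cong C (ℤₚ.+-comm (dot a (lift p v)) (ℤ.+ toℕ (r a)))))
          (∑-linear-zero p pr Cos 2 (λ i → m i a) (column-nonzero p pr 2<p 2<k M fullRank s≡k-1 a)
              (ℤ.+ toℕ (r a)))))

      total : (Fin k → Fin p) → ℚ
      total r = ∑ sols (λ x → product k (λ l → wave r (x l)))

      term : Choice → (Fin k → Fin p) → (Fin k → Points p 2) → ℚ
      term q r x = C (offset q r ℤ.+ phase q (λ l → lift p (x l)))

      main : (Fin k → Fin p) → ℚ
      main r = ∑ sols (λ x → ∑ choices (λ q → term q r x))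

      error : ℚ
      error = expansionError (ι (length (allFin k))) k * ε

      -- The expansion starts from phase 0 and so keeps a factor `C 0ℤ`; being at least 1, it does
      -- not affect the sign of `total r`.
      total≈main : ∀ r → ∣ C 0ℤ * total r - main r ∣ ≤ ι (length sols) * error
      total≈main r = subst (λ z → ∣ z ∣ ≤ ι (length sols) * error)
          (trans (∑-+ sols (λ x → C 0ℤ * prod x) (λ x → - expanded x))
            (cong₂ _+_ (∑-*ˡ sols (C 0ℤ) prod) (trans (∑-neg sols expanded)
                (cong -_ (∑-cong sols (λ x → ∑-cong choices (λ q → cong C (regroup q x))))))))
          (∑-abs sols (λ x → expansion p pr Cos (allFin k) k (λ l a → dot a (lift p (x l)) ℤ.+ ℤ.+ toℕ (r a)) 0ℤ))
        where
        prod expanded : (Fin k → Points p 2) → ℚ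
        prod x = product k (λ l → wave r (x l))
        expanded x = ∑ choices (λ q → C (0ℤ ℤ.+ Σℤ k
            (λ l → sgn (proj₁ (q l)) ℤ.* (dot (proj₂ (q l)) (lift p (x l)) ℤ.+ ℤ.+ toℕ (r (proj₂ (q l)))))))
        ∑-neg : ∀ {A : Set} (xs : List A) (f : A → ℚ) → ∑ xs (λ x → - f x) ≡ - ∑ xs f
        ∑-neg []       f = refl
        ∑-neg (x ∷ xs) f = trans (cong (- f x +_) (∑-neg xs f)) (sym (neg-distrib-+ (f x) (∑ xs f)))
        regroup : ∀ q x → 0ℤ ℤ.+ Σℤ k (λ l → sgn (proj₁ (q l)) ℤ.*
            (dot (proj₂ (q l)) (lift p (x l)) ℤ.+ ℤ.+ toℕ (r (proj₂ (q l)))))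
                ≡ offset q r ℤ.+ phase q (λ l → lift p (x l))
        regroup q x = trans (ℤₚ.+-identityˡ _) (trans
            (Σℤ-cong k (λ l → lem (sign q l) (dot (proj₂ (q l)) (lift p (x l))) (ℤ.+ toℕ (r (proj₂ (q l))))))
          (Σℤ-+ k (λ l → sign q l ℤ.* ℤ.+ toℕ (r (proj₂ (q l))))
              (λ l → sign q l ℤ.* dot (proj₂ (q l)) (lift p (x l)))))
          where lem : ∀ s d r → s ℤ.* (d ℤ.+ r) ≡ s ℤ.* r ℤ.+ s ℤ.* d
                lem = solveℤ

      0≤C0 : 0ℚ ≤ C 0ℤ
      0≤C0 = ≤-trans 0≤1 1≤C0

      constant-terms : ∀ {q r} → offset q r ≡ 0ℤ → (∀ x → x ∈ sols → ℤ.+ p ∣ phase q (λ l → lift p (x l))) →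
                       ∑ sols (term q r) ≡ ι (length sols) * C 0ℤ
      constant-terms {q} {r} off div = ∑-const-∈ sols
          (λ x x∈ → periodic (≈-trans (+-cong (≡⇒≈ off) (∣⇒≈0 (div x x∈))) (≡⇒≈ refl)))

      module _ {r : Fin k → Fin p} (r≡0 : ∀ j → r j ≡ residue₀) where

        offset≡0 : ∀ q → offset q r ≡ 0ℤ
        offset≡0 q = Σℤ-zero k (λ l → trans (cong (λ z → sign q l ℤ.* ℤ.+ z)
            (trans (cong toℕ (r≡0 (proj₂ (q l)))) residue₀≡0)) (ℤₚ.*-zeroʳ (sign q l)))

        -- Without shifts a choice contributes C(0) for every solution if its phase vanishes on all
        -- of them, and exactly zero otherwise.
        0≤terms : ∀ q → 0ℚ ≤ ∑ sols (term q r)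
        0≤terms q = decide (all-or-counterexample (λ x → ℤ.+ p ∣? phase q (λ l → lift p (x l))) sols)
          where
          decide : (∀ x → x ∈ sols → ℤ.+ p ∣ phase q (λ l → lift p (x l))) ⊎ ∃[ x ]
              (x ∈ sols × phase q (λ l → lift p (x l)) ≉0) → 0ℚ ≤ ∑ sols (term q r)
          decide (inj₁ div) = subst (0ℚ ≤_) (sym (constant-terms {q} {r} (offset≡0 q) div))
              (0≤* (0≤ι (length sols)) 0≤C0)
          decide (inj₂ (x , x∈ , ph)) = ≤-reflexive (sym (characterSum-zero pr Cos q (λ l → lift p (x l))
            (isSol⁻ x (∈-filterᵇ⁻ (isSol p M) (allFuns k (allPoints p 2)) x∈)) ph (offset q r)))

        -- No choice contributes negatively, and the identity choice alone contributes C(0) ≥ 1 per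
        -- solution.
        main-lower : ι (length sols) ≤ main r
        main-lower = lower identity-choice
          where
          lower : ∃[ q ] (q ∈ choices × (∀ l → q l ≡ (true , l))) → ι (length sols) ≤ main r
          lower (q , q∈ , q≡) = begin
            ι (length sols)                                   ≡⟨ sym (*-identityʳ _) ⟩
            ι (length sols) * 1ℚ                              ≤⟨ *-mono-≤ˡ _ (0≤ι (length sols)) 1≤C0 ⟩
            ι (length sols) * C 0ℤ                            ≡⟨ sym (constant-terms {q} {r} (offset≡0 q)
                (λ x x∈ → identity-phase q≡ (isSol⁻ x (∈-filterᵇ⁻ (isSol p M) (allFuns k (allPoints p 2)) x∈)))) ⟩
            ∑ sols (term q r)                                 ≤⟨ ∑-member {xs = choices}
                {f = λ q → ∑ sols (term q r)} (λ q _ → 0≤terms q) q∈ ⟩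
            ∑ choices (λ q → ∑ sols (term q r))               ≡⟨ ∑-swap choices sols (λ q → term q r) ⟩
            main r                                            ∎
            where open ≤-Reasoning

      main-average : 2 ℕ∣.∣ k → ¬ ContainsAdditiveTuple p M → ∑ shifts main ≡ 0ℚ
      main-average k-even ¬additive = begin
        ∑ shifts (λ r → ∑ sols (λ x → ∑ choices (λ q → term q r x)))
          ≡⟨ ∑-cong shifts (λ r → ∑-swap sols choices (λ x q → term q r x)) ⟩
        ∑ shifts (λ r → ∑ choices (λ q → ∑ sols (term q r)))
          ≡⟨ ∑-swap shifts choices (λ r q → ∑ sols (term q r)) ⟩
        ∑ choices (λ q → ∑ shifts (λ r → ∑ sols (term q r)))
          ≡⟨ ∑-zero choices (λ q → vanish q (dichotomy p pr 2<p 2<k M fullRank s≡k-1 k-even ¬additive q)) ⟩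
        0ℚ ∎
        where
        open ≡-Reasoning
        vanish : ∀ q → (∃[ V ] Solution V × phase q V ≉0) ⊎ (∃[ j ] weight p pr 2<p 2<k M fullRank s≡k-1 q j ≉0) →
                 ∑ shifts (λ r → ∑ sols (term q r)) ≡ 0ℚ
        vanish q (inj₁ (V , sV , ph)) = ∑-zero shifts (λ r → characterSum-zero pr Cos q V sV ph (offset q r))
        vanish q (inj₂ w) = trans (∑-swap shifts sols (term q)) (∑-zero sols (λ x →
          trans (∑-cong shifts (λ r → cong C (trans (ℤₚ.+-comm (offset q r) _)
              (cong (λ z → phase q (λ l → lift p (x l)) ℤ.+ z) (offset-weight q r)))))
            (∑-linear-zero p pr Cos k (weight p pr 2<p 2<k M fullRank s≡k-1 q) w (phase q (λ l → lift p (x l))))))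

      -- The summand for the shifts absorbs one deviation per shift in the averaging argument; the
      -- summand 1 gives e ≤ ½ for the single unshifted function.
      module Small {e : ℚ} (0≤e : 0ℚ ≤ e) (error≤e : error ≤ e) (e-small : (1ℚ + ι (length shifts)) * e ≤ ½) where

        n : ℚ
        n = ι (length sols)

        0<n : 0ℚ < n
        0<n = <-≤-trans (positive⁻¹ 1ℚ) 1≤∣sols∣

        deviation : ∀ r → ∣ C 0ℤ * total r - main r ∣ ≤ n * e
        deviation r = ≤-trans (total≈main r) (*-mono-≤ˡ n (<⇒≤ 0<n) error≤e)

        e≤½ : e ≤ ½
        e≤½ = ≤-trans (≤-by (ι (length shifts) * e) (0≤* (0≤ι (length shifts)) 0≤e) (lem (ι (length shifts)) e))
            e-small
          where lem : ∀ s e → (1ℚ + s) * e ≡ e + s * e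
                lem = solve-∀ ℚ-ring

        half<n : n * ½ < n
        half<n = <-by (n * ½) (0<* 0<n (positive⁻¹ ½)) (trans (sym (*-identityʳ n)) (*-distribˡ-+ n ½ ½))

        total-pos : ∀ {r} → (∀ j → r j ≡ residue₀) → 0ℚ < total r
        total-pos {r} r≡0 = *-cancelˡ-<-nonNeg (C 0ℤ) {{nonNegative 0≤C0}}
            (subst (_< C 0ℤ * total r) (sym (*-zeroʳ (C 0ℤ))) (begin-strict
          0ℚ                        ≡⟨ sym (+-inverseʳ (n * ½)) ⟩
          n * ½ - n * ½             <⟨ +-monoˡ-< (- (n * ½)) half<n ⟩
          n - n * ½                 ≤⟨ +-mono-≤ (main-lower r≡0) (neg-antimono-≤ (*-mono-≤ˡ n (<⇒≤ 0<n) e≤½)) ⟩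
          main r - n * e            ≤⟨ +-monoʳ-≤ (main r)
              (neg-antimono-≤ (≤-trans (-a≤∣a∣ (C 0ℤ * total r - main r)) (deviation r))) ⟩
          main r - - (C 0ℤ * total r - main r)  ≡⟨ lem (main r) (C 0ℤ * total r) ⟩
          C 0ℤ * total r            ∎))
          where
          open ≤-Reasoning
          lem : ∀ a b → a - - (b - a) ≡ b
          lem = solve-∀ ℚ-ring

        -- If every total were nonnegative, every main r + n·e would be too. These sum to (number of
        -- shifts)·n·e ≤ n/2, yet the one at the zero shift is at least n. A finite search makes
        -- this constructive.
        total-neg : 2 ℕ∣.∣ k → ¬ ContainsAdditiveTuple p M → ∃[ r ] total r < 0ℚ
        total-neg k-even ¬additive = decide (all-or-counterexample (λ r → 0ℚ ≤? total r) shifts)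
          where
          open ≤-Reasoning
          lem : ∀ a b → a + (b - a) ≡ b
          lem = solve-∀ ℚ-ring
          contradict : (∀ r → r ∈ shifts → 0ℚ ≤ total r) → n ≤ n * ½
          contradict nn = begin
            n                                            ≤⟨ main-lower (proj₂ (proj₂ zero-shift)) ⟩
            main r₀                                      ≤⟨ ≤-by (n * e) (0≤* (<⇒≤ 0<n) 0≤e) refl ⟩
            main r₀ + n * e                              ≤⟨ ∑-member {xs = shifts} {f = λ r → main r + n * e}
                lower (proj₁ (proj₂ zero-shift)) ⟩
            ∑ shifts (λ r → main r + n * e)              ≡⟨ ∑-+ shifts main (λ _ → n * e) ⟩
            ∑ shifts main + ∑ shifts (λ _ → n * e)       ≡⟨ cong₂ _+_ (main-average k-even ¬additive)
                (∑-const shifts (n * e)) ⟩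
            0ℚ + ι (length shifts) * (n * e)             ≤⟨ ≤-by (n * e) (0≤* (<⇒≤ 0<n) 0≤e)
                (lem₂ n (ι (length shifts)) e) ⟩
            n * ((1ℚ + ι (length shifts)) * e)           ≤⟨ *-mono-≤ˡ n (<⇒≤ 0<n) e-small ⟩
            n * ½                                        ∎
            where
            r₀ = proj₁ zero-shift
            lem₂ : ∀ n s e → n * ((1ℚ + s) * e) ≡ 0ℚ + s * (n * e) + n * e
            lem₂ = solve-∀ ℚ-ring
            lower : ∀ r → r ∈ shifts → 0ℚ ≤ main r + n * e
            lower r r∈ = begin
              0ℚ                                         ≤⟨ 0≤* 0≤C0 (nn r r∈) ⟩
              C 0ℤ * total r                             ≡⟨ sym (lem (main r) (C 0ℤ * total r)) ⟩
              main r + (C 0ℤ * total r - main r)         ≤⟨ +-monoʳ-≤ (main r) (≤-trans (a≤∣a∣ _) (deviation r)) ⟩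
              main r + n * e                             ∎
          decide : (∀ r → r ∈ shifts → 0ℚ ≤ total r) ⊎ ∃[ r ] (r ∈ shifts × ¬ (0ℚ ≤ total r)) → ∃[ r ] total r < 0ℚ
          decide (inj₁ nn) = contradiction (<-≤-trans half<n (contradict nn)) (<-irrefl refl)
          decide (inj₂ (r , _ , neg)) = r , ≰⇒> neg

      Witness : Set
      Witness = ∃[ f ] ((∀ x → (- 1ℚ ≤ f x) × (f x ≤ 1ℚ)) × (E p {2} f ≡ 0ℚ) × (T p {k} {2} M f < 0ℚ))

      -- A wave is a sum of k values of size at most 3; scaling by c brings it into [-1,1] and
      -- multiplies the total by c^k.
      scaledWave : ∀ r c → ∣ c ∣ * (ι k * 3ℚ) ≤ 1ℚ → power c k * total r < 0ℚ → Witness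
      scaledWave r c c-small neg = f , (λ x → lower x , upper x) , f-mean , f-neg
        where
        f : Points p 2 → ℚ
        f v = c * wave r v
        ∣f∣≤1 : ∀ v → ∣ f v ∣ ≤ 1ℚ
        ∣f∣≤1 v = ≤-trans (∣*∣≤ {c} ≤-refl (wave-bound r v)) c-small
        upper : ∀ v → f v ≤ 1ℚ
        upper v = ≤-trans (a≤∣a∣ (f v)) (∣f∣≤1 v)
        lower : ∀ v → - 1ℚ ≤ f v
        lower v = subst (- 1ℚ ≤_) (neg-neg (f v)) (neg-antimono-≤ (≤-trans (-a≤∣a∣ (f v)) (∣f∣≤1 v)))
          where neg-neg : ∀ a → - - a ≡ a
                neg-neg = solve-∀ ℚ-ring
        f-mean : E p {2} f ≡ 0ℚ
        f-mean = mean-zero⁺ (map f (allPoints p 2))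
            (trans (∑-*ˡ (allPoints p 2) c (wave r)) (trans (cong (c *_) (wave-mean r)) (*-zeroʳ c)))
        f-neg : T p {k} {2} M f < 0ℚ
        f-neg = mean-neg (map (λ x → product k (λ l → f (x l))) sols)
            (subst (_< 0ℚ) (sym (trans (∑-cong sols (λ x → product-scale k c (λ l → wave r (x l))))
          (∑-*ˡ sols (power c k) (λ x → product k (λ l → wave r (x l)))))) neg)

      conclude : ¬ ContainsAdditiveTuple p M → ∀ {e} → 0ℚ ≤ e → error ≤ e → (1ℚ + ι (length shifts)) * e ≤ ½ →
                 ∀ {c} → 0ℚ < c → ι k * 3ℚ * c ≤ 1ℚ → Witness
      conclude ¬additive 0≤e error≤e small {c} 0<c c-small = parity (2 ℕ∣.∣? k)
        where
        open Small 0≤e error≤e small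
        c-small′ : ∣ c ∣ * (ι k * 3ℚ) ≤ 1ℚ
        c-small′ = subst (_≤ 1ℚ) (trans (*-comm (ι k * 3ℚ) c)
            (cong (_* (ι k * 3ℚ)) (sym (0≤p⇒∣p∣≡p (<⇒≤ 0<c))))) c-small
        parity : Dec (2 ℕ∣.∣ k) → Witness
        parity (yes k-even) = even (total-neg k-even ¬additive)
          where
          even : ∃[ r ] total r < 0ℚ → Witness
          even (r , neg) = scaledWave r c c-small′ (subst (power c k * total r <_) (*-zeroʳ (power c k))
            (*-monoʳ-<-pos (power c k) {{positive (0<power 0<c k)}} neg))
        -- Here (-c)^k is -c times an even power, hence negative, and the total at the zero shift is
        -- positive.
        parity (no k-odd) = scaledWave r (- c) (subst (λ z → z * (ι k * 3ℚ) ≤ 1ℚ) (sym (∣-p∣≡∣p∣ c)) c-small′)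
            (subst (_< 0ℚ) (trans (lem c (power (- c) (k ℕ./ 2 ℕ.* 2)) (total r))
                (cong (λ j → power (- c) j * total r) (sym k≡)))
              (neg-antimono-< (0<* (0<* 0<c (0<power-neg 0<c (k ℕ./ 2))) (total-pos (proj₂ (proj₂ zero-shift))))))
          where
          r = proj₁ zero-shift
          lem : ∀ c x t → - (c * x * t) ≡ - c * x * t
          lem = solve-∀ ℚ-ring
          odd-remainder : ∀ a → a ℕ.< 2 → a ≢ 0 → a ≡ 1
          odd-remainder 0 _ ne = contradiction refl ne
          odd-remainder 1 _ _  = refl
          odd-remainder (suc (suc _)) (s≤s (s≤s ())) _
          k≡ : k ≡ suc (k ℕ./ 2 ℕ.* 2)
          k≡ = trans (ℕD.m≡m%n+[m/n]*n k 2) (cong (ℕ._+ k ℕ./ 2 ℕ.* 2)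
            (odd-remainder (k ℕ.% 2) (ℕD.m%n<n k 2) (λ e → k-odd (ℕ∣.m%n≡0⇒n∣m k 2 e))))

    -- The constant `B` is independent of ε, so the accuracy is chosen after it. Its absolute value
    -- is used to have a nonnegative bound at once.
    negativeFunction : ¬ ContainsAdditiveTuple p M →
      ∃[ f ] ((∀ x → (- 1ℚ ≤ f x) × (f x ≤ 1ℚ)) × (E p {2} f ≡ 0ℚ) × (T p {k} {2} M f < 0ℚ))
    negativeFunction ¬additive = build (halfPow-small ((1ℚ + ι (length shifts)) * ∣ B ∣) (positive⁻¹ ½))
        (halfPow-small (ι k * 3ℚ) (positive⁻¹ 1ℚ))
      where
      B : ℚ
      B = expansionError (ι (length (allFin k))) k
      build : ∃[ a ] ((1ℚ + ι (length shifts)) * ∣ B ∣) * halfPow a ≤ ½ → ∃[ b ] ι k * 3ℚ * halfPow b ≤ 1ℚ → _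
      build (a , small) (b , c-small) = Average.conclude (approxCos p (ℕₚ.<⇒≤ 2<p) (0<halfPow a)) ¬additive
        (0≤* (0≤∣p∣ B) (<⇒≤ (0<halfPow a))) (*-mono-≤ʳ (halfPow a) (<⇒≤ (0<halfPow a)) (a≤∣a∣ B))
        (≤-trans (≤-reflexive (sym (*-assoc (1ℚ + ι (length shifts)) ∣ B ∣ (halfPow a)))) small)
            (0<halfPow b) c-small

open import Defs
open import Data.Nat using (ℕ; _<_; _∸_; NonZero)
open import Data.Nat.Primality using (Prime)
open import Data.Rational using (ℚ; 0ℚ; -_; 1ℚ) renaming (_≤_ to _≤ℚ_; _<_ to _<ℚ_)
open import Data.Product using (_×_; ∃-syntax)
open import Relation.Binary.PropositionalEquality using (_≡_)
open import Relation.Nullary using (¬_)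

theorem3p1 : (p : ℕ) .{{_ : NonZero p}} → Prime p → 2 < p →
    (k : ℕ) → 2 < k → (M : Matrix2 p k) → FullRank p M →
    sIs p M (k ∸ 1) → ¬ ContainsAdditiveTuple p M →
    ∃[ f ] ((∀ x → (- 1ℚ ≤ℚ f x) × (f x ≤ℚ 1ℚ))
    × (E p {2} f ≡ 0ℚ) × (T p {k} {2} M f <ℚ 0ℚ))
theorem3p1 p pr 2<p k 2<k M fullRank s≡k-1 ¬additive =
  NegativeAverage.negativeFunction p pr 2<p 2<k M fullRank s≡k-1 ¬additive
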